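{- Let $H$ be a generalized Halin graph with maximum degree $\Delta \geq 13$. Then $\mathrm{ch}'_{\mathrm{star}}(H) \leq \left\lfloor \frac{3\Delta}{2} \right\rfloor$. Moreover, this upper bound is tight: for every integer $\Delta \geq 13$ there exists a generalized Halin graph $H$ with maximum degree $\Delta$ and $\mathrm{ch}'_{\mathrm{star}}(H) = \left\lfloor \frac{3\Delta}{2} \right\rfloor$.
   Context: All graphs are finite and simple. A star $k$-edge coloring of a graph $G$ is a proper edge coloring $\phi: E(G) \to \{1,\dots,k\}$ such that no path or cycle of length four (i.e. with four edges) in $G$ is bichromatic. Given a list assignment $L$ assigning a finite set $L(e)$ to each edge $e$, $G$ is star $k$-edge choosable if for every $L$ with $|L(e)| \geq k$ for all $e$ there is a star edge coloring $\varphi$ with $\varphi(e) \in L(e)$ for all $e$. The list star chromatic index $\mathrm{ch}'_{\mathrm{star}}(G)$ is the minimum such $k$. A generalized Halin graph $H = T \cup C$ is a plane graph consisting of a plane embedding of a tree $T$ with $\Delta(T) \geq 3$ together with a cycle $C$ connecting all the leaves of $T$ such that $C$ is the boundary of the exterior face. -}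

module Defs where

open import Data.Bool using (Bool; T; false)
open import Data.Nat using (ℕ; zero; suc; _+_; _*_; _≤_; _/_; _%_)
open import Data.Nat.DivMod using (m%n<n)
open import Data.Fin using (Fin; toℕ; fromℕ<)
open import Data.List using (List; length; filterᵇ; allFin)
open import Data.List.Relation.Unary.Unique.Propositional using (Unique)
open import Data.List.Membership.Propositional using (_∈_)
open import Data.Product using (Σ; ∃; _×_; _,_; proj₁)
open import Data.Sum using (_⊎_)
open import Relation.Nullary using (¬_)
open import Relation.Binary.PropositionalEquality using (_≡_; _≢_)
open import Function.Definitions using (Injective)

record Graph (n : ℕ) : Set where
  field
    adj   : Fin n → Fin n → Bool
    sym   : ∀ u v → adj u v ≡ adj v u
    irrefl : ∀ v → adj v v ≡ false
open Graph public

Adj : ∀ {n} → Graph n → Fin n → Fin n → Set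
Adj G u v = T (adj G u v)

deg : ∀ {n} → Graph n → Fin n → ℕ
deg {n} G v = length (filterᵇ (adj G v) (allFin n))

MaxDegree : ∀ {n} → Graph n → ℕ → Set
MaxDegree G D = (∀ v → deg G v ≤ D) × ∃ λ v → deg G v ≡ D

csuc : ∀ {k} → Fin k → Fin k
csuc {suc k} i = fromℕ< (m%n<n (suc (toℕ i)) (suc k))

iter : ∀ {A : Set} → ℕ → (A → A) → A → A
iter zero    f x = x
iter (suc j) f x = f (iter j f x)

data Walk {n} (G : Graph n) : Fin n → Fin n → Set where
  here : ∀ {v} → Walk G v v
  step : ∀ {u v w} → Adj G u v → Walk G v w → Walk G u w

Connected : ∀ {n} → Graph n → Set
Connected G = ∀ u v → Walk G u v

IsCycle : ∀ {n} → Graph n → (m : ℕ) → (Fin (3 + m) → Fin n) → Set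
IsCycle G m f = Injective _≡_ _≡_ f × (∀ i → Adj G (f i) (f (csuc i)))

Acyclic : ∀ {n} → Graph n → Set
Acyclic {n} G = ∀ m (f : Fin (3 + m) → Fin n) → ¬ IsCycle G m f

IsTree : ∀ {n} → Graph n → Set
IsTree G = Connected G × Acyclic G

IsLeaf : ∀ {n} → Graph n → Fin n → Set
IsLeaf T v = deg T v ≡ 1

-- Plane embeddings of a tree, combinatorially: a rotation system.
-- rot v is a cyclic permutation of the neighbours of v (successor in the
-- clockwise order around v).

IsRotation : ∀ {n} → Graph n → (Fin n → Fin n → Fin n) → Set
IsRotation T rot =
  (∀ v u → Adj T v u → Adj T v (rot v u)) ×
  (∀ v u w → Adj T v u → Adj T v w → ∃ λ j → iter (suc j) (rot v) u ≡ w)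

faceStep : ∀ {n} → (Fin n → Fin n → Fin n) → Fin n × Fin n → Fin n × Fin n
faceStep rot (u , v) = v , rot v u

-- c lists the leaves of T in the cyclic order in which the boundary walk of
-- the (unique) face of the embedded tree meets them.  A leaf x is visited
-- exactly when the walk uses a dart whose tail is x.
LeafOrder : ∀ {n} → Graph n → (Fin n → Fin n → Fin n) →
            (k : ℕ) → (Fin (3 + k) → Fin n) → Set
LeafOrder T rot k c =
  ∀ i p q → Adj T (c i) p → Adj T (c (csuc i)) q →
  ∃ λ j → (iter (suc j) (faceStep rot) (c i , p) ≡ (c (csuc i) , q)) ×
          (∀ m → 1 ≤ m → m ≤ j →
             ¬ IsLeaf T (proj₁ (iter m (faceStep rot) (c i , p))))

CEdge : ∀ {n} k → (Fin (3 + k) → Fin n) → Fin n → Fin n → Set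
CEdge k c u v = ∃ λ i → (c i ≡ u × c (csuc i) ≡ v) ⊎ (c i ≡ v × c (csuc i) ≡ u)

IsGenHalin : ∀ {n} → Graph n → Set
IsGenHalin {n} H =
  Σ (Graph n) λ T →
  IsTree T ×
  (∃ λ v → 3 ≤ deg T v) ×
  Σ (Fin n → Fin n → Fin n) λ rot → IsRotation T rot ×
  Σ ℕ λ k → Σ (Fin (3 + k) → Fin n) λ c →
    Injective _≡_ _≡_ c ×
    (∀ i → IsLeaf T (c i)) ×
    (∀ v → IsLeaf T v → ∃ λ i → c i ≡ v) ×
    LeafOrder T rot k c ×                                   -- C bounds the exterior face
    (∀ u v → (Adj H u v → Adj T u v ⊎ CEdge k c u v) ×
             (Adj T u v ⊎ CEdge k c u v → Adj H u v))

-- Star edge colourings (edge colourings given as symmetric functions on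
-- ordered adjacent pairs; colours are natural numbers)

Proper : ∀ {n} → Graph n → (Fin n → Fin n → ℕ) → Set
Proper G φ = ∀ u v w → Adj G u v → Adj G u w → v ≢ w → φ u v ≢ φ u w

-- no bichromatic path or cycle with four edges v0 v1 v2 v3 v4
NoBichromatic4 : ∀ {n} → Graph n → (Fin n → Fin n → ℕ) → Set
NoBichromatic4 G φ =
  ∀ v0 v1 v2 v3 v4 →
  Adj G v0 v1 → Adj G v1 v2 → Adj G v2 v3 → Adj G v3 v4 →
  v0 ≢ v2 → v0 ≢ v3 → v1 ≢ v3 → v1 ≢ v4 → v2 ≢ v4 →
  ¬ (φ v0 v1 ≡ φ v2 v3 × φ v1 v2 ≡ φ v3 v4)

IsStarEdgeColoring : ∀ {n} → Graph n → (Fin n → Fin n → ℕ) → Set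
IsStarEdgeColoring G φ = Proper G φ × NoBichromatic4 G φ

StarChoosable : ∀ {n} → Graph n → ℕ → Set
StarChoosable {n} G k =
  (L : Fin n → Fin n → List ℕ) →
  (∀ u v → Adj G u v → L u v ≡ L v u) →
  (∀ u v → Adj G u v → Unique (L u v) × k ≤ length (L u v)) →
  ∃ λ (φ : Fin n → Fin n → ℕ) →
    (∀ u v → Adj G u v → φ u v ≡ φ v u) ×
    (∀ u v → Adj G u v → φ u v ∈ L u v) ×
    IsStarEdgeColoring G φ

IsListStarChromaticIndex : ∀ {n} → Graph n → ℕ → Set
IsListStarChromaticIndex G m = StarChoosable G m × (∀ k → StarChoosable G k → m ≤ k)

-- Upper bound.  Put t = ⌊D/2⌋, so that lists have D + t colours, and root the
-- tree T at a vertex of degree D.  Give the edges at each vertex distinct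
-- positions in a regular tournament on 0, …, 2t, the edge to the parent getting
-- position 0, and colour the tree edges greedily from the root so that no edge
-- below a child v of u has the colour of an edge at u to which uv loses.  For a
-- path with four edges centred at u, one of its two middle edges loses to the
-- other, so the path is not bichromatic.  An edge below v avoids, besides its
-- earlier siblings, vu and the t edges beating it; only if its own position
-- exceeds t must it avoid all edges at u, and such edges come first, when few
-- siblings are coloured.  Consecutive leaves must also get distinct colours; by
-- planarity this costs something only at the first and last children, which are
-- therefore treated first among their siblings.  An edge of C then has to avoid
-- at most 2(t + 1) + 2 colours, which for D ≥ 13 leaves three, and cycles with at
-- least eight edges are star edge 3-choosable.
--
-- Lower bound.  Let the root have D children, each with D − 1 leaf children.  If
-- the colour of the root edge to v recurs below v′, then that of v′ does not
-- recur below v, so on average at most (D − 1)/2 root colours recur below a child,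
-- and D − 1 − (D − 1)/2 further colours are needed.

{-# OPTIONS --safe #-}
module Submission where

open import Defs renaming (sym to adj-sym; irrefl to adj-irrefl)
open import Data.Bool using (T; T?)
open import Data.Empty using (⊥; ⊥-elim)
open import Data.Unit using (⊤; tt)
open import Data.Nat using (ℕ; zero; suc; _+_; _*_; _∸_; _≤_; _<_; _/_; _%_; z≤n; s≤s; z<s; s<s; _≤?_; _<?_)
open import Data.Nat.Properties
open import Data.Nat.DivMod using (m%n<n; m<n⇒m%n≡m; n%n≡0; m≡m%n+[m/n]*n; m/n*n≤m; m*n/n≡m; /-monoˡ-≤; +-distrib-/-∣ˡ; m<n*o⇒m/o<n)
open import Data.Nat.Divisibility using (divides)
open import Data.Nat.Solver using (module +-*-Solver)
open import Data.Fin as Fin using (Fin; zero; suc; toℕ; fromℕ<)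
import Data.Fin.Properties as Finₚ
open import Data.List as List using (List; []; _∷_; _++_; length; lookup; filter; filterᵇ; allFin; map; applyUpTo)
open import Data.List.Properties using (length-++; length-map; length-applyUpTo; length-tabulate)
open import Data.List.Relation.Unary.Any as Any using (Any; here; there; index)
import Data.List.Relation.Unary.Any.Properties as Anyₚ
open import Data.List.Relation.Unary.All as All using (All; []; _∷_)
open import Data.List.Relation.Unary.AllPairs as AllPairs using ([]; _∷_)
open import Data.List.Relation.Unary.Unique.Propositional using (Unique)
import Data.List.Relation.Unary.Unique.Propositional.Properties as Uniqueₚ
open import Data.List.Membership.Propositional using (_∈_; _∉_; find; lose)
open import Data.List.Membership.Propositional.Properties using (∈-++⁺ˡ; ∈-++⁺ʳ; ∈-++⁻; ∈-filter⁺; ∈-filter⁻; ∈-allFin; ∈-lookup; ∈-map⁺; ∈-map⁻; ∈-applyUpTo⁺)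
import Data.List.Membership.DecPropositional as DecMem
open import Data.Product using (Σ; ∃; _×_; _,_; proj₁; proj₂; uncurry)
open import Data.Vec as Vec using (Vec; []; _∷_)
import Data.Vec.Properties as Vecₚ
open import Data.Vec.Properties using (lookup∘tabulate)
import Data.Vec.Relation.Unary.Any as VAny
import Data.Vec.Relation.Unary.Any.Properties as VAnyₚ
open import Data.Vec.Membership.Propositional.Properties using (∈-toList⁻)
open import Data.Sum using (_⊎_; inj₁; inj₂; [_,_]′)
open import Function using (_∘_; id; case_of_)
open import Function.Bundles using (mk⇔)
open import Function.Definitions using (Injective)
open import Relation.Nullary using (¬_; Dec; yes; no; does)
open import Relation.Nullary.Decidable using (¬?; _×-dec_; _⊎-dec_; dec-false; does-⇔; map′; _→-dec_; decidable-stable)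
open import Relation.Nullary.Negation using (contradiction)
open import Relation.Binary.PropositionalEquality using (_≡_; _≢_; refl; sym; trans; cong; cong₂; subst; subst₂; ≢-sym)
open import Relation.Binary.Definitions using (tri<; tri≈; tri>)

-- A path with four edges is judged at its middle vertex. At an inner vertex the tournament decides;
-- if the losing edge leads down to a leaf, the path goes on along C, so an edge of C must avoid the
-- colours to which the stems at its two ends lose (a stem is the tree edge at a leaf). At a leaf
-- the middle edges are either the stem and an edge of C, which is why stems of consecutive leaves
-- must differ, or two edges of C. In the latter case the path can leave C only along a stem, so
-- once the edges of C also avoid the nearby stems, all that remains is a star colouring of the
-- cycle itself. Every demand between T and C thus becomes a list of forbidden colours for C, and
-- the two can be coloured one after the other. That the index exists is a separate matter.
-- `StarChoosable` speaks of infinitely many list assignments, and finding the least `k` by search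
-- needs it to be decidable; a finite palette makes it so.

-- Lists without repetition and the pigeonhole principle.

lookup-injective : {A : Set} {xs : List A} → Unique xs →
                   ∀ i j → lookup xs i ≡ lookup xs j → i ≡ j
lookup-injective (_ ∷ _) zero zero _ = refl
lookup-injective {xs = _ ∷ xs} (x∉ ∷ _) zero (suc j) e = contradiction e (All.lookup x∉ (∈-lookup j))
lookup-injective {xs = _ ∷ xs} (x∉ ∷ _) (suc i) zero e = contradiction (sym e) (All.lookup x∉ (∈-lookup i))
lookup-injective (_ ∷ u) (suc i) (suc j) e = cong suc (lookup-injective u i j e)

-- The position at which each entry of `xs` is found in `ys` gives an injection of index sets.
-- Nearly all counting below rests on this.
unique-⊆⇒length≤ : {A : Set} {xs ys : List A} → Unique xs →
                   (∀ {x} → x ∈ xs → x ∈ ys) → length xs ≤ length ys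
unique-⊆⇒length≤ {xs = xs} {ys} u sub = Finₚ.injective⇒≤ {f = f} f-inj
  where
  f : Fin (length xs) → Fin (length ys)
  f i = index (sub (∈-lookup i))
  f-inj : Injective _≡_ _≡_ f
  f-inj {i} {j} e = lookup-injective u i j
    (trans (Anyₚ.lookup-index (sub (∈-lookup i)))
      (trans (cong (lookup ys) e) (sym (Anyₚ.lookup-index (sub (∈-lookup j))))))

open DecMem _≟_ public using (_∈?_; _∉?_)

_∖_ : List ℕ → List ℕ → List ℕ
xs ∖ ys = filter (_∉? ys) xs

∖-unique : ∀ {xs} ys → Unique xs → Unique (xs ∖ ys)
∖-unique ys = Uniqueₚ.filter⁺ (_∉? ys)

∈-∖⁻ : ∀ {x xs} ys → x ∈ xs ∖ ys → x ∈ xs × x ∉ ys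
∈-∖⁻ ys = ∈-filter⁻ (_∉? ys)

length-∖ : ∀ {xs} ys → Unique xs → length xs ≤ length ys + length (xs ∖ ys)
length-∖ {xs} ys u = ≤-trans (unique-⊆⇒length≤ u sub) (≤-reflexive (length-++ ys))
  where
  sub : ∀ {x} → x ∈ xs → x ∈ ys ++ (xs ∖ ys)
  sub {x} x∈ with x ∈? ys
  ... | yes p = ∈-++⁺ˡ p
  ... | no ¬p = ∈-++⁺ʳ ys (∈-filter⁺ (_∉? ys) x∈ ¬p)

abstract
  pick : ∀ {xs : List ℕ} (ys : List ℕ) → Unique xs → length ys < length xs → ∃ λ x → x ∈ xs × x ∉ ys
  pick {xs} ys u lt with xs ∖ ys | length-∖ ys u | (λ {x} → ∈-∖⁻ {x} {xs} ys)
  ... | [] | le | _ = contradiction (≤-trans le (≤-reflexive (+-identityʳ _))) (<⇒≱ lt)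
  ... | x ∷ _ | _ | f = x , f (here refl)

map-unique : {A B : Set} (f : A → B) {xs : List A} → (∀ {x y} → x ∈ xs → y ∈ xs → f x ≡ f y → x ≡ y) →
             Unique xs → Unique (map f xs)
map-unique f inj [] = []
map-unique f {x ∷ xs} inj (x∉ ∷ u) =
  All.tabulate (λ b∈ e → case ∈-map⁻ f b∈ of λ where
    (y , y∈ , refl) → All.lookup x∉ y∈ (inj (here refl) (there y∈) e))
  ∷ map-unique f (λ p q → inj (there p) (there q)) u

-- Neighbourhoods and degrees.

-- The very list whose length is `deg`, so that degree bounds become pigeonhole arguments.
nbrs : ∀ {n} → Graph n → Fin n → List (Fin n)
nbrs {n} G v = filterᵇ (adj G v) (allFin n)

module _ {n} (G : Graph n) where

  ∈-nbrs⁺ : ∀ {v u} → Adj G v u → u ∈ nbrs G v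
  ∈-nbrs⁺ {v} {u} a = ∈-filter⁺ (T? ∘ adj G v) (∈-allFin u) a

  ∈-nbrs⁻ : ∀ {v u} → u ∈ nbrs G v → Adj G v u
  ∈-nbrs⁻ {v} u∈ = proj₂ (∈-filter⁻ (T? ∘ adj G v) {xs = allFin n} u∈)

  nbrs-unique : ∀ v → Unique (nbrs G v)
  nbrs-unique v = Uniqueₚ.filter⁺ (T? ∘ adj G v) (Uniqueₚ.allFin⁺ n)

  Adj-sym : ∀ {u v} → Adj G u v → Adj G v u
  Adj-sym {u} {v} = subst T (adj-sym G u v)

  Adj-irrefl : ∀ {u} → ¬ Adj G u u
  Adj-irrefl {u} = subst T (adj-irrefl G u)

  Adj⇒≢ : ∀ {u v} → Adj G u v → u ≢ v
  Adj⇒≢ a refl = Adj-irrefl a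

  leaf-nbr-unique : ∀ {v u w} → IsLeaf G v → Adj G v u → Adj G v w → u ≡ w
  leaf-nbr-unique {v} {u} {w} l a b with nbrs G v | l | ∈-nbrs⁺ a | ∈-nbrs⁺ b
  ... | _ ∷ [] | _ | here p | here q = trans p (sym q)

  leaf? : ∀ v → Dec (IsLeaf G v)
  leaf? v = deg G v ≟ 1

  unique-nbrs≤deg : ∀ {v} {xs : List (Fin n)} → Unique xs → (∀ {x} → x ∈ xs → Adj G v x) → length xs ≤ deg G v
  unique-nbrs≤deg u f = unique-⊆⇒length≤ u (λ x∈ → ∈-nbrs⁺ (f x∈))

  deg≤cover : ∀ {v} (xs : List (Fin n)) → (∀ {x} → Adj G v x → x ∈ xs) → deg G v ≤ length xs
  deg≤cover {v} xs f = unique-⊆⇒length≤ (nbrs-unique v) (λ x∈ → f (∈-nbrs⁻ x∈))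

  two-nbrs⇒nonleaf : ∀ {v u w} → Adj G v u → Adj G v w → u ≢ w → ¬ IsLeaf G v
  two-nbrs⇒nonleaf a b ne l = ne (leaf-nbr-unique l a b)

csuc-< : ∀ {k} (i : Fin k) → suc (toℕ i) < k → toℕ (csuc i) ≡ suc (toℕ i)
csuc-< {suc k} i lt = trans (Finₚ.toℕ-fromℕ< _) (m<n⇒m%n≡m lt)

csuc-last : ∀ {k} (i : Fin k) → suc (toℕ i) ≡ k → toℕ (csuc i) ≡ 0
csuc-last {suc k} i e = trans (Finₚ.toℕ-fromℕ< _) (trans (cong (_% suc k) e) (n%n≡0 (suc k)))

iter-suc : {A : Set} (f : A → A) (j : ℕ) (x : A) → iter (suc j) f x ≡ iter j f (f x)
iter-suc f zero x = refl
iter-suc f (suc j) x = cong f (iter-suc f j x)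

-- Rooted trees.

-- The value of `par` at the root is left free; the laws about `par` apply only away from `r`. The
-- bound `depth<` limits the greedy keys and serves as fuel for walks up and down the tree.
record Rooting {n} (G : Graph n) (r : Fin n) : Set where
  field
    par       : Fin n → Fin n
    depth     : Fin n → ℕ
    par-adj   : ∀ {v} → v ≢ r → Adj G v (par v)
    depth-par : ∀ {v} → v ≢ r → depth v ≡ suc (depth (par v))
    edge      : ∀ {u v} → Adj G u v → (u ≢ r × par u ≡ v) ⊎ (v ≢ r × par v ≡ u)
    depth<    : ∀ v → depth v < n

-- A shortest repetition on a walk without backtracking is a cycle, so such
-- walks are injective in an acyclic graph, and any two of them with the same
-- ends agree.
module RootedTree {n} (G : Graph n) (acyc : Acyclic G) (r : Fin n) where

  data Path : Fin n → List (Fin n) → Set where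
    stop : Path r []
    last : ∀ {x} → Adj G x r → Path x (r ∷ [])
    more : ∀ {x y z l} → Adj G x y → x ≢ z → Path y (z ∷ l) → Path x (y ∷ z ∷ l)

  at : Fin n → List (Fin n) → ℕ → Fin n
  at x l zero = x
  at x [] (suc i) = x
  at x (y ∷ l) (suc i) = at y l i

  at-adj : ∀ {x l} → Path x l → ∀ i → i < length l → Adj G (at x l i) (at x l (suc i))
  at-adj (last a) zero _ = a
  at-adj (last a) (suc i) (s≤s ())
  at-adj (more a _ p) zero _ = a
  at-adj (more a _ p) (suc i) (s≤s lt) = at-adj p i lt

  at-∈ : ∀ x l i → i ≤ length l → at x l i ∈ x ∷ l
  at-∈ x l zero _ = here refl
  at-∈ x (y ∷ l) (suc i) (s≤s le) = there (at-∈ y l i le)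

  at-inj : ∀ x l → Unique (x ∷ l) → ∀ i j → i ≤ length l → j ≤ length l → at x l i ≡ at x l j → i ≡ j
  at-inj x l u zero zero _ _ _ = refl
  at-inj x (y ∷ l) (x∉ ∷ _) zero (suc j) _ (s≤s q) e = contradiction e (All.lookup x∉ (at-∈ y l j q))
  at-inj x (y ∷ l) (x∉ ∷ _) (suc i) zero (s≤s p) _ e = contradiction (sym e) (All.lookup x∉ (at-∈ y l i p))
  at-inj x (y ∷ l) (_ ∷ u) (suc i) (suc j) (s≤s p) (s≤s q) e = cong suc (at-inj y l u i j p q e)

  at-surj : ∀ {v} x l → v ∈ l → ∃ λ i → i < length l × at x l (suc i) ≡ v
  at-surj x (y ∷ l) (here refl) = 0 , z<s , refl
  at-surj x (y ∷ l) (there v∈) with at-surj y l v∈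
  ... | i , lt , e = suc i , s<s lt , e

  -- If the walk came back to `x` after `z`, the stretch from `y` to that point, closed by the edge
  -- `xy`, would be a cycle; it has at least the three vertices `y`, `z`, `x`.
  closing : ∀ {x y z l} → Path y (z ∷ l) → Unique (y ∷ z ∷ l) → Adj G x y → x ∉ l
  closing {x} {y} {z} {l} p u a x∈ with at-surj z l x∈
  ... | i , i< , e = acyc i f (f-inj , f-adj)
    where
    f : Fin (3 + i) → Fin n
    f j = at y (z ∷ l) (toℕ j)
    bound : ∀ j → toℕ {3 + i} j ≤ length (z ∷ l)
    bound j = ≤-trans (Finₚ.toℕ≤pred[n] j) (s≤s i<)
    f-inj : Injective _≡_ _≡_ f
    f-inj {j} {k} q = Finₚ.toℕ-injective (at-inj y (z ∷ l) u (toℕ j) (toℕ k) (bound j) (bound k) q)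
    f-adj : ∀ j → Adj G (f j) (f (csuc j))
    f-adj j with suc (toℕ j) <? 3 + i
    ... | yes lt rewrite csuc-< j lt = at-adj p (toℕ j) (≤-trans (≤-pred lt) (s≤s i<))
    ... | no ≮ = subst₂ (Adj G) (sym (trans (cong (at y (z ∷ l)) (suc-injective je)) e))
                   (sym (cong (at y (z ∷ l)) (csuc-last j je))) a
      where
      je : suc (toℕ j) ≡ 3 + i
      je = ≤-antisym (Finₚ.toℕ<n j) (≮⇒≥ ≮)

  path-unique : ∀ {x l} → Path x l → Unique (x ∷ l)
  path-unique stop = [] ∷ []
  path-unique (last a) = (Adj⇒≢ G a ∷ []) ∷ [] ∷ []
  path-unique {x} (more {y = y} {z} {l} a ne p) = All.tabulate x∉ ∷ u
    where
    u = path-unique p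
    x∉ : ∀ {v} → v ∈ y ∷ z ∷ l → x ≢ v
    x∉ (here refl) = Adj⇒≢ G a
    x∉ (there (here refl)) = ne
    x∉ (there (there v∈)) refl = closing p u a v∈

  r∈path : ∀ {x l} → Path x l → r ∈ x ∷ l
  r∈path stop = here refl
  r∈path (last _) = there (here refl)
  r∈path (more _ _ p) = there (r∈path p)

  -- Reversing the first path onto the second gives a path meeting r twice.
  no-fork : ∀ {x y z l k} → Path x (y ∷ l) → Path x (z ∷ k) → y ≢ z → ⊥
  no-fork {x} (last a) q ne = All.lookup r∉ (r∈path q) refl
    where
    r∉ = AllPairs.head (path-unique (more (Adj-sym G a) ne q))
  no-fork (more a x≢w p) q ne = no-fork p (more (Adj-sym G a) ne q) (≢-sym x≢w)

  no-detour : ∀ {y l} → ¬ Path r (y ∷ l)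
  no-detour p with path-unique p | p
  ... | _ | last a = Adj-irrefl G a
  ... | r∉ ∷ _ | more _ _ q = All.lookup r∉ (r∈path q) refl

  path-tail : ∀ {x y l} → Path x (y ∷ l) → Path y l
  path-tail (last _) = stop
  path-tail (more _ _ p) = p

  path-det : ∀ {x l k} → Path x l → Path x k → l ≡ k
  path-det {l = []} {[]} _ _ = refl
  path-det {l = []} {_ ∷ _} stop q = contradiction q no-detour
  path-det {l = _ ∷ _} {[]} p stop = contradiction p no-detour
  path-det {l = y ∷ l} {z ∷ k} p q with y Finₚ.≟ z
  ... | yes refl = cong (y ∷_) (path-det (path-tail p) (path-tail q))
  ... | no ne = ⊥-elim (no-fork p q ne)

  -- The two outcomes decide which end of an edge is the parent of the other: prepending an edge can
  -- fail only by backtracking.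
  path-step : ∀ {x y l} → Adj G x y → Path y l → Path x (y ∷ l) ⊎ ∃ λ k → l ≡ x ∷ k
  path-step a stop = inj₁ (last a)
  path-step {x} a p@(last b) with x Finₚ.≟ r
  ... | yes refl = inj₂ (_ , refl)
  ... | no ne = inj₁ (more a ne p)
  path-step {x} a p@(more {y = z} _ _ _) with x Finₚ.≟ z
  ... | yes refl = inj₂ (_ , refl)
  ... | no ne = inj₁ (more a ne p)

  path-exists : ∀ {x} → Walk G x r → ∃ (Path x)
  path-exists here = [] , stop
  path-exists (step a w) with path-exists w
  ... | l , p with path-step a p
  ... | inj₁ q = _ , q
  ... | inj₂ (k , refl) = k , path-tail p

  module _ (conn : Connected G) where
    private
      toRoot : Fin n → List (Fin n)
      toRoot v = proj₁ (path-exists (conn v r))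

      isPath : ∀ v → Path v (toRoot v)
      isPath v = proj₂ (path-exists (conn v r))

      head : Fin n → List (Fin n) → Fin n
      head x [] = x
      head _ (y ∷ _) = y

      parent : Fin n → Fin n
      parent v = head v (toRoot v)

      first-adj : ∀ {v y l} → Path v (y ∷ l) → Adj G v y
      first-adj (last a) = a
      first-adj (more a _ _) = a

      onPath : ∀ {v y l} → Path v (y ∷ l) → v ≢ r × parent v ≡ y
      onPath {v} p = (λ { refl → no-detour p }) , cong (head v) (path-det (isPath v) p)

      path-length : ∀ {v l} → Path v l → v ≢ r → length l ≡ suc (length (toRoot (head v l)))
      path-length stop ne = contradiction refl ne
      path-length (last a) ne = cong suc (cong length (path-det stop (isPath r)))
      path-length (more a _ p) ne = cong suc (cong length (path-det p (isPath _)))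

      parent-adj : ∀ {v l} → Path v l → v ≢ r → Adj G v (head v l)
      parent-adj stop ne = contradiction refl ne
      parent-adj p@(last _) ne = first-adj p
      parent-adj p@(more _ _ _) ne = first-adj p

    rooting : Rooting G r
    rooting = record
      { par = parent
      ; depth = length ∘ toRoot
      ; par-adj = λ {v} → parent-adj (isPath v)
      ; depth-par = λ {v} → path-length (isPath v)
      ; edge = edge
      ; depth< = λ v → ≤-trans (unique-⊆⇒length≤ (path-unique (isPath v)) (λ {x} _ → ∈-allFin x))
                               (≤-reflexive (Data.List.Properties.length-tabulate id))
      }
      where
      import Data.List.Properties
      edge : ∀ {u v} → Adj G u v → (u ≢ r × parent u ≡ v) ⊎ (v ≢ r × parent v ≡ u)
      edge {u} {v} a with path-step a (isPath v)
      ... | inj₁ p = inj₁ (onPath p)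
      ... | inj₂ (k , e) = inj₂ (onPath (subst (Path v) e (isPath v)))

-- Rotations and the boundary walk of the embedded tree.

-- A cyclic permutation with a fixed point has just one element, so the boundary walk turns straight
-- back only at leaves.
rot-fixed⇒leaf : ∀ {n} (G : Graph n) {rot} → IsRotation G rot → ∀ {u v} → Adj G v u → rot v u ≡ u → IsLeaf G v
rot-fixed⇒leaf G {rot} (_ , cyc) {u} {v} a fix with nbrs G v | (λ {x} → ∈-nbrs⁻ G {v} {x}) | ∈-nbrs⁺ G a | nbrs-unique G v
... | [] | _ | () | _
... | _ ∷ [] | _ | _ | _ = refl
... | x ∷ y ∷ _ | adjacent | _ | (x≢y ∷ _) ∷ _ =
      contradiction (trans (sym (all-u (here refl))) (all-u (there (here refl)))) x≢y
  where
  stays : ∀ j → iter j (rot v) u ≡ u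
  stays zero = refl
  stays (suc j) = trans (cong (rot v) (stays j)) fix
  all-u : ∀ {w} → w ∈ x ∷ y ∷ _ → u ≡ w
  all-u w∈ with cyc v u _ a (adjacent w∈)
  ... | j , e = trans (sym (stays (suc j))) e

module FaceWalk {n} (G : Graph n) (r : Fin n) (R : Rooting G r) (r-inner : ¬ IsLeaf G r)
                (rot : Fin n → Fin n → Fin n) (isRot : IsRotation G rot) where
  open Rooting R

  Last First : Fin n → Set
  Last z = par z ≢ r × rot (par z) z ≡ par (par z)
  First z = par z ≢ r × rot (par z) (par (par z)) ≡ z

  parent-inner : ∀ {u} → u ≢ r → ¬ IsLeaf G (par u)
  parent-inner {u} u≢r with par u Finₚ.≟ r
  ... | yes e = subst (¬_ ∘ IsLeaf G) (sym e) r-inner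
  ... | no ne = two-nbrs⇒nonleaf G (Adj-sym G (par-adj u≢r)) (par-adj ne)
                  λ e → <⇒≢ (m<n⇒m<1+n (n<1+n _)) (trans (cong depth (sym e)) (trans (depth-par u≢r) (cong suc (depth-par ne))))

  module _ {z} (z≢r : z ≢ r) where
    -- Tailored to the colouring order: of two consecutive leaves that are not siblings, the deeper
    -- one, which is coloured later, is a last or first child; at equal depth the first leaf is a
    -- last child and the second a first child.
    LastOrBelow FirstOrAbove : Fin n → Set
    LastOrBelow v = Last z ⊎ depth z < depth v ⊎ par v ≡ par z
    FirstOrAbove v = First v ⊎ depth v < depth z ⊎ par v ≡ par z

    -- After leaving the leaf z, the boundary walk of the face climbs along last
    -- children, turns once, and then descends along first children.
    data State : Fin n × Fin n → Set where
      up   : ∀ {u} → u ≢ r → u ≡ z ⊎ (Last z × depth u < depth z) → State (u , par u)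
      down : ∀ {v} → v ≢ r → LastOrBelow v → FirstOrAbove v → State (par v , v)

    advance : ∀ {d} → State d → ¬ IsLeaf G (proj₂ d) → State (faceStep rot d)
    advance (up {u} u≢r st) inner with rot (par u) u in ew | edge (proj₁ isRot (par u) u (Adj-sym G (par-adj u≢r)))
    ... | w | inj₁ (pu≢r , refl) = up pu≢r (inj₂ (climb st))
      where
      climb : u ≡ z ⊎ (Last z × depth u < depth z) → Last z × depth (par u) < depth z
      climb (inj₁ refl) = (pu≢r , ew) , ≤-reflexive (sym (depth-par u≢r))
      climb (inj₂ (l , lt)) = l , <-trans (≤-reflexive (sym (depth-par u≢r))) lt
    ... | w | inj₂ (w≢r , e) = subst (λ x → State (x , w)) e (turn st)
      where
      turn : u ≡ z ⊎ (Last z × depth u < depth z) → State (par w , w)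
      turn (inj₁ refl) = down w≢r (inj₂ (inj₂ e)) (inj₂ (inj₂ e))
      -- The walk turns into a sibling of `u`, which already lies higher than `z`.
      turn (inj₂ (l , lt)) = down w≢r (inj₁ l) (inj₂ (inj₁
        (≤-trans (≤-reflexive (cong suc (trans (depth-par w≢r) (trans (cong (suc ∘ depth) e) (sym (depth-par u≢r)))))) lt)))
    advance (down {v} v≢r lb fa) inner with rot v (par v) in ew | edge (proj₁ isRot v (par v) (par-adj v≢r))
    -- Going back along the edge just descended would make `v` a leaf, where the walk would have
    -- stopped.
    ... | w | inj₁ (_ , refl) = contradiction (rot-fixed⇒leaf G isRot (par-adj v≢r) ew) inner
    ... | w | inj₂ (w≢r , refl) = down w≢r (deeper lb) (inj₁ (v≢r , ew))
      where
      deeper : LastOrBelow v → LastOrBelow w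
      deeper (inj₁ l) = inj₁ l
      deeper (inj₂ (inj₁ lt)) = inj₂ (inj₁ (subst (depth z <_) (sym (depth-par w≢r)) (m<n⇒m<1+n lt)))
      deeper (inj₂ (inj₂ e)) = inj₂ (inj₁ (≤-reflexive (sym (trans (depth-par w≢r)
        (cong suc (trans (depth-par v≢r) (trans (cong (suc ∘ depth) e) (sym (depth-par z≢r)))))))))

    next-leaf : ∀ {z′ q} j → IsLeaf G z′ → iter (suc j) (faceStep rot) (z , par z) ≡ (z′ , q) →
                (∀ m → 1 ≤ m → m ≤ j → ¬ IsLeaf G (proj₁ (iter m (faceStep rot) (z , par z)))) →
                LastOrBelow z′ × FirstOrAbove z′
    next-leaf {z′} j leaf′ e inner = arrive (states j ≤-refl) (cong proj₁ e)
      where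
      states : ∀ m → m ≤ j → State (iter m (faceStep rot) (z , par z))
      states zero _ = up z≢r (inj₁ refl)
      states (suc m) le = advance (states m (<⇒≤ le)) (inner (suc m) z<s le)
      arrive : ∀ {d} → State d → proj₂ d ≡ z′ → LastOrBelow z′ × FirstOrAbove z′
      arrive (up u≢r _) refl = contradiction leaf′ (parent-inner u≢r)
      arrive (down _ lb fa) refl = lb , fa

-- If two entries had the same image, the list without one of them would still cover `xs`, against
-- the pigeonhole principle.
surjective⇒injective : {A : Set} (_≟A_ : (x y : A) → Dec (x ≡ y)) (f : A → A) {xs : List A} → Unique xs →
                       (∀ {x} → x ∈ xs → ∃ λ y → y ∈ xs × f y ≡ x) →
                       ∀ {v w} → v ∈ xs → w ∈ xs → f v ≡ f w → v ≡ w
surjective⇒injective _≟A_ f {xs} u surj {v} {w} v∈ w∈ e with v ≟A w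
... | yes p = p
... | no v≢w = contradiction (≤-trans (unique-⊆⇒length≤ u covered) (≤-reflexive (length-map f rest))) (<⇒≱ shorter)
  where
  rest = filter (λ x → ¬? (x ≟A v)) xs
  covered : ∀ {x} → x ∈ xs → x ∈ map f rest
  covered x∈ with surj x∈
  ... | y , y∈ , refl with y ≟A v
  ... | yes refl = subst (_∈ map f rest) (sym e) (∈-map⁺ f (∈-filter⁺ (λ x → ¬? (x ≟A v)) w∈ (≢-sym v≢w)))
  ... | no ne = ∈-map⁺ f (∈-filter⁺ (λ x → ¬? (x ≟A v)) y∈ ne)
  shorter : length rest < length xs
  shorter = unique-⊆⇒length≤
    (All.tabulate (λ x∈ e′ → proj₂ (∈-filter⁻ (λ x → ¬? (x ≟A v)) {xs = xs} x∈) (sym e′)) ∷ Uniqueₚ.filter⁺ (λ x → ¬? (x ≟A v)) u)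
    (λ { (here refl) → v∈ ; (there x∈) → proj₁ (∈-filter⁻ (λ x → ¬? (x ≟A v)) {xs = xs} x∈) })

-- Going round the rotation from `x` back to `x` passes through a preimage of `x`; so the rotation
-- maps the finite neighbourhood onto itself.
rot-injective : ∀ {n} (G : Graph n) {rot} → IsRotation G rot → ∀ {v u w} → Adj G v u → Adj G v w →
                rot v u ≡ rot v w → u ≡ w
rot-injective G {rot} (closed , cyc) {v} a b = surjective⇒injective Finₚ._≟_ (rot v) (nbrs-unique G v) surj
    (∈-nbrs⁺ G a) (∈-nbrs⁺ G b)
  where
  orbit : ∀ {x} j → Adj G v x → Adj G v (iter j (rot v) x)
  orbit zero c = c
  orbit (suc j) c = closed v _ (orbit j c)
  surj : ∀ {x} → x ∈ nbrs G v → ∃ λ y → y ∈ nbrs G v × rot v y ≡ x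
  surj {x} x∈ with cyc v x x (∈-nbrs⁻ G x∈) (∈-nbrs⁻ G x∈)
  ... | j , e = iter j (rot v) x , ∈-nbrs⁺ G (orbit j (∈-nbrs⁻ G x∈)) , e

-- Greedy list colouring and the regular tournament.

-- Round `m` colours all vertices with key `m`. Members of `E z` with larger keys count towards the
-- length of `E z` but yield no promise, so `E z` may be listed generously.
module Greedy {n} (key : Fin n → ℕ) (E : Fin n → List (Fin n)) (L : Fin n → List ℕ)
              {P : Fin n → Set} (P? : ∀ z → Dec (P z))
              (L-unique : ∀ {z} → P z → Unique (L z)) (E<L : ∀ {z} → P z → length (E z) < length (L z)) where

  Good : ℕ → (Fin n → ℕ) → Set
  Good m φ = ∀ {z} → P z → key z < m → φ z ∈ L z × (∀ {w} → w ∈ E z → key w < key z → φ z ≢ φ w)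

  extend : ∀ m → ∃ (Good m) → ∃ (Good (suc m))
  extend m (φ , good) = φ′ , good′
    where
    new : ∀ z → P z → ∃ λ x → x ∈ L z × x ∉ map φ (E z)
    new z p = pick (map φ (E z)) (L-unique p) (subst (_< length (L z)) (sym (length-map φ (E z))) (E<L p))
    φ′ : Fin n → ℕ
    φ′ z with P? z | key z ≟ m
    ... | yes p | yes _ = proj₁ (new z p)
    ... | _ | _ = φ z
    old : ∀ {z} → key z < m → φ′ z ≡ φ z
    old {z} lt with P? z | key z ≟ m
    ... | yes p | yes e = contradiction e (<⇒≢ lt)
    ... | yes _ | no _ = refl
    ... | no _ | yes _ = refl
    ... | no _ | no _ = refl
    good′ : Good (suc m) φ′
    good′ {z} p lt with P? z | key z ≟ m
    ... | no ¬p | _ = contradiction p ¬p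
    ... | yes p′ | yes refl = proj₁ (proj₂ (new z p′)) ,
          λ {w} w∈ w< e → proj₂ (proj₂ (new z p′)) (subst (_∈ _) (sym (trans e (old w<))) (∈-map⁺ φ w∈))
    ... | yes _ | no ne = proj₁ (good p z<m) , λ w∈ w< e → proj₂ (good p z<m) w∈ w< (trans e (old (<-trans w< z<m)))
      where
      z<m : key z < m
      z<m = ≤∧≢⇒< (≤-pred lt) ne

  good-upto : ∀ m → ∃ (Good m)
  good-upto zero = (λ _ → 0) , λ _ ()
  good-upto (suc m) = extend m (good-upto m)

  colouring : (B : ℕ) → (∀ z → key z < B) →
              ∃ λ φ → ∀ {z} → P z → φ z ∈ L z × (∀ {w} → w ∈ E z → key w < key z → φ z ≢ φ w)
  colouring B bound with good-upto B
  ... | φ , good = φ , λ {z} p → good p (bound z)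

-- Positions 0, …, 2t form a regular tournament, in which p loses to the t
-- positions preceding it cyclically; In p q says that p loses to q.
In : ℕ → ℕ → ℕ → Set
In t p q = (q < p × p ≤ q + t) ⊎ (p + t < q)

In? : ∀ t p q → Dec (In t p q)
In? t p q = ((q <? p) ×-dec (p ≤? q + t)) ⊎-dec (p + t <? q)

In-total : ∀ t {p q} → p ≢ q → In t p q ⊎ In t q p
In-total t {p} {q} ne with <-cmp p q
... | tri≈ _ e _ = contradiction e ne
... | tri< p<q _ _ with q ≤? p + t
...   | yes le = inj₂ (inj₁ (p<q , le))
...   | no ≰ = inj₁ (inj₂ (≰⇒> ≰))
In-total t {p} {q} ne | tri> _ _ q<p with p ≤? q + t
...   | yes le = inj₁ (inj₁ (q<p , le))
...   | no ≰ = inj₂ (inj₂ (≰⇒> ≰))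

-- The `t` positions cyclically before `p`. For `p ≤ t` this interval wraps round, leaving `t ∸ p`
-- positions at the upper end of 0, ..., 2t.
In-list : ∀ t p → List ℕ
In-list t p with p ≤? t
... | yes _ = applyUpTo id p ++ applyUpTo (λ i → suc (p + t) + i) (t ∸ p)
... | no _ = applyUpTo (λ i → (p ∸ t) + i) t

In-list-length : ∀ t p → length (In-list t p) ≤ t
In-list-length t p with p ≤? t
... | yes le = ≤-reflexive (trans (length-++ (applyUpTo id p))
                 (trans (cong₂ _+_ (length-applyUpTo id p) (length-applyUpTo _ (t ∸ p))) (m+[n∸m]≡n le)))
... | no _ = ≤-reflexive (length-applyUpTo _ t)

applyUpTo-∋ : ∀ b m {q} → b ≤ q → q < b + m → q ∈ applyUpTo (b +_) m
applyUpTo-∋ b m {q} le lt = subst (_∈ applyUpTo (b +_) m) (m+[n∸m]≡n le)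
  (∈-applyUpTo⁺ (b +_) (+-cancelˡ-< b _ _ (subst (_< b + m) (sym (m+[n∸m]≡n le)) lt)))

∈-In-list : ∀ t {p q} → q ≤ t + t → In t p q → q ∈ In-list t p
∈-In-list t {p} {q} q≤ i with p ≤? t | i
... | yes _ | inj₁ (q<p , _) = ∈-++⁺ˡ (∈-applyUpTo⁺ id q<p)
... | yes le | inj₂ lt = ∈-++⁺ʳ (applyUpTo id p) (applyUpTo-∋ (suc (p + t)) (t ∸ p) lt
      (s≤s (≤-trans q≤ (≤-reflexive (sym (trans (cong (_+ (t ∸ p)) (+-comm p t)) (trans (+-assoc t p _) (cong (t +_) (m+[n∸m]≡n le)))))))))
... | no ≰ | inj₁ (q<p , le) = applyUpTo-∋ (p ∸ t) t (m≤n+o⇒m∸n≤o p t (subst (p ≤_) (+-comm q t) le))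
      (subst (q <_) (sym (m∸n+n≡m (<⇒≤ (≰⇒> ≰)))) q<p)
... | no ≰ | inj₂ lt = contradiction (≤-trans lt q≤) (<⇒≱ (s≤s (+-monoˡ-≤ t (<⇒≤ (≰⇒> ≰)))))

-- Colouring the tree edges.

lex-< : ∀ {n a b i j} → a < b → i < n → a * n + i < b * n + j
lex-< {n} {a} {b} {i} {j} a<b i<n = begin-strict
  a * n + i <⟨ +-monoʳ-< (a * n) i<n ⟩
  a * n + n ≡⟨ +-comm (a * n) n ⟩
  suc a * n ≤⟨ *-monoˡ-≤ n a<b ⟩
  b * n ≤⟨ m≤m+n (b * n) j ⟩
  b * n + j ∎
  where open ≤-Reasoning

-- The list `extra z` holds further vertices whose colours a special `z` avoids; it will be filled
-- with the neighbours of a leaf on the outer cycle.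
module TreeColouring {n} (G : Graph n) (r : Fin n) (R : Rooting G r) (r-inner : ¬ IsLeaf G r)
                     (rot : Fin n → Fin n → Fin n) (isRot : IsRotation G rot)
                     (D t : ℕ) (deg≤D : ∀ v → deg G v ≤ D) (D≤ : D ≤ 1 + (t + t)) (6≤t : 6 ≤ t)
                     (L : Fin n → List ℕ)
                     (extra : Fin n → List (Fin n)) (extra≤2 : ∀ z → length (extra z) ≤ 2) where
  open Rooting R
  open FaceWalk G r R r-inner rot isRot using (Last; First)

  Special : Fin n → Set
  Special z = Last z ⊎ First z

  Last? : ∀ z → Dec (Last z)
  Last? z = ¬? (par z Finₚ.≟ r) ×-dec (rot (par z) z Finₚ.≟ par (par z))

  First? : ∀ z → Dec (First z)
  First? z = ¬? (par z Finₚ.≟ r) ×-dec (rot (par z) (par (par z)) Finₚ.≟ z)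

  abstract
    Special? : ∀ z → Dec (Special z)
    Special? z = Last? z ⊎-dec First? z

  -- Vertices are processed by depth, and among siblings the special ones first.
  class : Fin n → ℕ
  class z with Special? z
  ... | yes _ = 0
  ... | no _ = 1

  abstract
    -- Depth, class and vertex number compared lexicographically, written in mixed radix; the last
    -- digit makes the keys distinct.
    key : Fin n → ℕ
    key z = (depth z * 2 + class z) * n + toℕ z

    class<2 : ∀ z → class z < 2
    class<2 z with Special? z
    ... | yes _ = z<s
    ... | no _ = s<s z<s

    key-depth : ∀ {w z} → depth w < depth z → key w < key z
    key-depth {w} {z} lt = lex-< (lex-< lt (class<2 w)) (Finₚ.toℕ<n w)

    key-special : ∀ {w z} → depth w ≡ depth z → Special w → ¬ Special z → key w < key z
    key-special {w} {z} e s ns = lex-< {n} {depth w * 2 + class w} {depth z * 2 + class z}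
        (subst (λ d → depth w * 2 + class w < d * 2 + class z) e (+-monoʳ-< (depth w * 2) {class w} {class z} lt))
        (Finₚ.toℕ<n w)
      where
      lt : class w < class z
      lt with Special? w | Special? z
      ... | no ¬p | _ = contradiction s ¬p
      ... | yes _ | yes p = contradiction p ns
      ... | yes _ | no _ = z<s

    key-injective : ∀ {w z} → key w ≡ key z → w ≡ z
    key-injective {w} {z} e with <-cmp (depth w * 2 + class w) (depth z * 2 + class z)
    ... | tri< lt _ _ = contradiction e (<⇒≢ (lex-< lt (Finₚ.toℕ<n w)))
    ... | tri> _ _ gt = contradiction (sym e) (<⇒≢ (lex-< gt (Finₚ.toℕ<n z)))
    ... | tri≈ _ eq _ = Finₚ.toℕ-injective (+-cancelˡ-≡ ((depth w * 2 + class w) * n) _ _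
                          (trans e (cong (λ a → a * n + toℕ z) (sym eq))))

    key-bound : ∀ z → key z < (n * 2) * n + n
    key-bound z = lex-< (subst (depth z * 2 + class z <_) (+-identityʳ (n * 2)) (lex-< (depth< z) (class<2 z))) (Finₚ.toℕ<n z)

  sib-depth : ∀ {w z} → w ≢ r → z ≢ r → par w ≡ par z → depth w ≡ depth z
  sib-depth w≢r z≢r e = trans (depth-par w≢r) (trans (cong (suc ∘ depth) e) (sym (depth-par z≢r)))

  child-adj : ∀ {w} → w ≢ r → Adj G (par w) w
  child-adj w≢r = Adj-sym G (par-adj w≢r)

  par-depth< : ∀ {v} → v ≢ r → depth (par v) < depth v
  par-depth< v≢r = ≤-reflexive (sym (depth-par v≢r))

  Earlier : Fin n → Fin n → Set
  Earlier z w = w ≢ r × par w ≡ par z × key w < key z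

  Earlier? : ∀ z w → Dec (Earlier z w)
  Earlier? z w = ¬? (w Finₚ.≟ r) ×-dec ((par w Finₚ.≟ par z) ×-dec (key w <? key z))

  abstract
    earlier : Fin n → List (Fin n)
    earlier z = filter (Earlier? z) (allFin n)

    earlier⁺ : ∀ {z w} → Earlier z w → w ∈ earlier z
    earlier⁺ {z} {w} p = ∈-filter⁺ (Earlier? z) (∈-allFin w) p

    earlier⁻ : ∀ {z w} → w ∈ earlier z → Earlier z w
    earlier⁻ {z} w∈ = proj₂ (∈-filter⁻ (Earlier? z) {xs = allFin n} w∈)

    earlier-unique : ∀ z → Unique (earlier z)
    earlier-unique z = Uniqueₚ.filter⁺ (Earlier? z) (Uniqueₚ.allFin⁺ n)

  rank : Fin n → ℕ
  rank z = length (earlier z)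

  -- The position of the edge from z to its parent among the edges at the
  -- parent; position 0 is left to the edge from the parent to its own parent.
  pos : Fin n → ℕ
  pos z = (t + t) ∸ rank z

  z∷earlier-unique : ∀ z → Unique (z ∷ earlier z)
  z∷earlier-unique z = All.tabulate (λ w∈ e → <⇒≢ (proj₂ (proj₂ (earlier⁻ {z} w∈))) (cong key (sym e))) ∷ earlier-unique z

  rank-< : ∀ {w z} → Earlier z w → rank w < rank z
  rank-< {w} {z} p@(w≢r , e , lt) = unique-⊆⇒length≤ (z∷earlier-unique w) sub
    where
    sub : ∀ {x} → x ∈ w ∷ earlier w → x ∈ earlier z
    sub (here refl) = earlier⁺ p
    sub (there x∈) with earlier⁻ {w} x∈
    ... | x≢r , e′ , lt′ = earlier⁺ (x≢r , trans e′ e , <-trans lt′ lt)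

  child-nbr : ∀ {z x} → z ≢ r → x ∈ z ∷ earlier z → Adj G (par z) x
  child-nbr z≢r (here refl) = child-adj z≢r
  child-nbr {z} z≢r (there x∈) with earlier⁻ {z} x∈
  ... | x≢r , e , _ = subst (λ v → Adj G v _) e (child-adj x≢r)

  rank<D : ∀ {z} → z ≢ r → rank z < D
  rank<D {z} z≢r = ≤-trans (unique-nbrs≤deg G (z∷earlier-unique z) (child-nbr z≢r)) (deg≤D (par z))

  par≢child : ∀ {z x} → z ≢ r → x ∈ z ∷ earlier z → par z ≢ r → par (par z) ≢ x
  par≢child {z} z≢r x∈ v≢r refl = <⇒≢ (<-trans (par-depth< v≢r) (par-depth< z≢r)) (depth≡ x∈)
    where
    depth≡ : ∀ {x} → x ∈ z ∷ earlier z → depth x ≡ depth z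
    depth≡ (here refl) = refl
    depth≡ (there x∈) with earlier⁻ {z} x∈
    ... | x≢r , e , _ = sib-depth x≢r z≢r e

  -- Below a vertex other than the root, the edge to the grandparent takes one more place of the
  -- degree. This place pays for `par z` itself in `avoided-by`.
  rank+2≤D : ∀ {z} → z ≢ r → par z ≢ r → 2 + rank z ≤ D
  rank+2≤D {z} z≢r v≢r = ≤-trans (unique-nbrs≤deg G
      (All.tabulate (λ x∈ → par≢child z≢r x∈ v≢r) ∷ z∷earlier-unique z)
      (λ { (here refl) → par-adj v≢r ; (there x∈) → child-nbr z≢r x∈ })) (deg≤D (par z))

  -- Siblings before a special vertex are special too, and since the rotation is injective, a parent
  -- has only one last and one first child.
  special-rank : ∀ {z} → z ≢ r → Special z → rank z ≤ 2
  special-rank {z} z≢r s = unique-⊆⇒length≤ (earlier-unique z) sub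
    where
    v = par z
    v≢r : v ≢ r
    v≢r = [ proj₁ , proj₁ ]′ s
    -- Found by following the rotation from `par v` until just before `par v` recurs.
    lastChild : ∃ λ l → Adj G v l × rot v l ≡ par v
    lastChild with proj₂ isRot v (par v) (par v) (par-adj v≢r) (par-adj v≢r)
    ... | j , e = iter j (rot v) (par v) , orbit j , e
      where
      orbit : ∀ j → Adj G v (iter j (rot v) (par v))
      orbit zero = par-adj v≢r
      orbit (suc j) = proj₁ isRot v _ (orbit j)
    sub : ∀ {w} → w ∈ earlier z → w ∈ proj₁ lastChild ∷ rot v (par v) ∷ []
    sub {w} w∈ with earlier⁻ {z} w∈ | Special? w
    ... | w≢r , e , lt | no ns = contradiction lt (<-asym (key-special (sym (sib-depth w≢r z≢r e)) s ns))
    ... | w≢r , e , lt | yes (inj₁ (_ , l)) = here (rot-injective G isRot (subst (λ x → Adj G x w) e (child-adj w≢r))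
          (proj₁ (proj₂ lastChild)) (trans (trans (cong (λ x → rot x w) (sym e)) (trans l (cong par e))) (sym (proj₂ (proj₂ lastChild)))))
    ... | w≢r , e , lt | yes (inj₂ (_ , f)) = there (here (trans (sym f) (cong (λ x → rot x (par x)) e)))

  rank≤2t : ∀ {z} → z ≢ r → rank z ≤ t + t
  rank≤2t z≢r = ≤-pred (≤-trans (rank<D z≢r) D≤)

  rank<2t : ∀ {z} → z ≢ r → par z ≢ r → rank z < t + t
  rank<2t z≢r v≢r = ≤-pred (≤-trans (rank+2≤D z≢r v≢r) D≤)

  pos-injective : ∀ {w z} → w ≢ r → z ≢ r → par w ≡ par z → pos w ≡ pos z → w ≡ z
  pos-injective {w} {z} w≢r z≢r e pe with <-cmp (key w) (key z) | ∸-cancelˡ-≡ (rank≤2t w≢r) (rank≤2t z≢r) pe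
  ... | tri< lt _ _ | re = contradiction re (<⇒≢ (rank-< (w≢r , e , lt)))
  ... | tri> _ _ gt | re = contradiction (sym re) (<⇒≢ (rank-< (z≢r , sym e , gt)))
  ... | tri≈ _ ke _ | _ = key-injective ke

  pos>0 : ∀ {z} → z ≢ r → par z ≢ r → 0 < pos z
  pos>0 z≢r v≢r = m<n⇒0<n∸m (rank<2t z≢r v≢r)

  -- A tree edge is represented by its lower end.
  Incident : Fin n → Fin n → Set
  Incident u w = w ≢ r × (w ≡ u ⊎ par w ≡ u)

  Incident? : ∀ u w → Dec (Incident u w)
  Incident? u w = ¬? (w Finₚ.≟ r) ×-dec ((w Finₚ.≟ u) ⊎-dec (par w Finₚ.≟ u))

  abstract
    incident : Fin n → List (Fin n)
    incident u = filter (Incident? u) (allFin n)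

    incident⁺ : ∀ {u w} → Incident u w → w ∈ incident u
    incident⁺ {u} {w} p = ∈-filter⁺ (Incident? u) (∈-allFin w) p

    incident⁻ : ∀ {u w} → w ∈ incident u → Incident u w
    incident⁻ {u} w∈ = proj₂ (∈-filter⁻ (Incident? u) {xs = allFin n} w∈)

    incident-unique : ∀ u → Unique (incident u)
    incident-unique u = Uniqueₚ.filter⁺ (Incident? u) (Uniqueₚ.allFin⁺ n)

  abstract
    posAt : Fin n → Fin n → ℕ
    posAt u w with w Finₚ.≟ u
    ... | yes _ = 0
    ... | no _ = pos w

    posAt-self : ∀ u → posAt u u ≡ 0
    posAt-self u with u Finₚ.≟ u
    ... | yes _ = refl
    ... | no ne = contradiction refl ne

    posAt-child : ∀ {w} → w ≢ r → posAt (par w) w ≡ pos w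
    posAt-child {w} w≢r with w Finₚ.≟ par w
    ... | yes e = contradiction e (Adj⇒≢ G (par-adj w≢r))
    ... | no _ = refl

    posAt≤ : ∀ u w → posAt u w ≤ t + t
    posAt≤ u w with w Finₚ.≟ u
    ... | yes _ = z≤n
    ... | no _ = m∸n≤m (t + t) (rank w)

    posAt-injective : ∀ {u v w} → Incident u v → Incident u w → posAt u v ≡ posAt u w → v ≡ w
    posAt-injective {u} {v} {w} (v≢r , p) (w≢r , q) e with v Finₚ.≟ u | w Finₚ.≟ u | p | q
    ... | yes refl | yes refl | _ | _ = refl
    ... | yes refl | no ne | _ | inj₁ e′ = contradiction e′ ne
    ... | yes refl | no _ | _ | inj₂ refl = contradiction e (<⇒≢ (pos>0 w≢r v≢r))
    ... | no ne | yes refl | inj₁ e′ | _ = contradiction e′ ne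
    ... | no _ | yes refl | inj₂ refl | _ = contradiction (sym e) (<⇒≢ (pos>0 v≢r w≢r))
    ... | no ne | no _ | inj₁ e′ | _ = contradiction e′ ne
    ... | no _ | no ne | _ | inj₁ e′ = contradiction e′ ne
    ... | no _ | no _ | inj₂ a | inj₂ b = pos-injective v≢r w≢r (trans a (sym b)) e

  incident≤D : ∀ u → length (incident u) ≤ D
  incident≤D u = ≤-trans (≤-reflexive (sym (length-map end (incident u))))
      (≤-trans (unique-nbrs≤deg G (map-unique end inj (incident-unique u)) nbr) (deg≤D u))
    where
    end : Fin n → Fin n
    end w with w Finₚ.≟ u
    ... | yes _ = par u
    ... | no _ = w
    child≢par : ∀ {w} → u ≢ r → w ≢ r → par w ≡ u → par u ≢ w
    child≢par u≢r w≢r refl e = <⇒≢ (<-trans (par-depth< u≢r) (par-depth< w≢r)) (cong depth e)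
    inj : ∀ {v w} → v ∈ incident u → w ∈ incident u → end v ≡ end w → v ≡ w
    inj {v} {w} v∈ w∈ e with incident⁻ v∈ | incident⁻ w∈ | v Finₚ.≟ u | w Finₚ.≟ u
    ... | _ | _ | yes refl | yes refl = refl
    ... | _ | _ | no _ | no _ = e
    ... | _ | _ , inj₁ e′ | yes _ | no ne = contradiction e′ ne
    ... | v≢r , _ | w≢r , inj₂ e′ | yes refl | no _ = contradiction e (child≢par v≢r w≢r e′)
    ... | _ , inj₁ e′ | _ | no ne | yes _ = contradiction e′ ne
    ... | v≢r , inj₂ e′ | w≢r , _ | no _ | yes refl = contradiction (sym e) (child≢par w≢r v≢r e′)
    nbr : ∀ {x} → x ∈ map end (incident u) → Adj G u x
    nbr x∈ with ∈-map⁻ end x∈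
    ... | w , w∈ , refl with incident⁻ w∈ | w Finₚ.≟ u
    ... | w≢r , _ | yes refl = par-adj w≢r
    ... | w≢r , inj₁ e | no ne = contradiction e ne
    ... | w≢r , inj₂ refl | no _ = child-adj w≢r

  -- A path centred at `par v` through the edges of `v` and `w` will be broken on the side of `v`:
  -- no edge beyond `v` may take the colour of `w`.
  Threat : Fin n → Fin n → Set
  Threat v w = In t (pos v) (posAt (par v) w)

  Threat? : ∀ v w → Dec (Threat v w)
  Threat? v w = In? t (pos v) (posAt (par v) w)

  abstract
    threats : Fin n → List (Fin n)
    threats v = filter (Threat? v) (incident (par v))

    threats⁺ : ∀ {v w} → Incident (par v) w → Threat v w → w ∈ threats v
    threats⁺ {v} p q = ∈-filter⁺ (Threat? v) (incident⁺ p) q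

    threats⁻ : ∀ {v w} → w ∈ threats v → Incident (par v) w × Threat v w
    threats⁻ {v} w∈ with ∈-filter⁻ (Threat? v) {xs = incident (par v)} w∈
    ... | p , q = incident⁻ p , q

    threats-unique : ∀ v → Unique (threats v)
    threats-unique v = Uniqueₚ.filter⁺ (Threat? v) (incident-unique (par v))

  -- Distinct edges at a vertex have distinct positions, and a position loses to at most `t` of the
  -- positions up to 2t.
  threats≤t : ∀ v → length (threats v) ≤ t
  threats≤t v = ≤-trans (≤-reflexive (sym (length-map (posAt (par v)) (threats v))))
      (≤-trans (unique-⊆⇒length≤
        (map-unique (posAt (par v)) (λ p q → posAt-injective (proj₁ (threats⁻ p)) (proj₁ (threats⁻ q)))
          (threats-unique v))
        sub) (In-list-length t (pos v)))
    where
    sub : ∀ {q} → q ∈ map (posAt (par v)) (threats v) → q ∈ In-list t (pos v)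
    sub q∈ with ∈-map⁻ (posAt (par v)) q∈
    ... | w , w∈ , refl = ∈-In-list t (posAt≤ (par v) w) (proj₂ (threats⁻ w∈))

  abstract
    extra′ : Fin n → List (Fin n)
    extra′ z with Special? z
    ... | yes _ = extra z
    ... | no _ = []

    extra′-cases : ∀ z → (Special z × extra′ z ≡ extra z) ⊎ (¬ Special z × extra′ z ≡ [])
    extra′-cases z with Special? z
    ... | yes s = inj₁ (s , refl)
    ... | no ns = inj₂ (ns , refl)

  -- rank z < t means pos z > t: the parent edge of par z, in position 0 at
  -- par z, loses to that of z, whose colour must then differ from all colours at
  -- par (par z).
  avoided-by : ∀ z → Dec (par z ≡ r) → Dec (rank z < t) → List (Fin n)
  avoided-by z (yes _) _ = earlier z
  avoided-by z (no _) (yes _) = incident (par (par z)) ++ (earlier z ++ extra′ z)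
  avoided-by z (no _) (no _) = par z ∷ (threats (par z) ++ earlier z)

  avoided : Fin n → List (Fin n)
  avoided z = avoided-by z (par z Finₚ.≟ r) (rank z <? t)

  -- A special vertex has at most two earlier siblings and two extras, well below `t`. This is the
  -- gain from treating special children first.
  extra′-length : ∀ {z} → z ≢ r → rank z < t → rank z + length (extra′ z) < t
  extra′-length {z} z≢r lt with extra′-cases z
  ... | inj₁ (s , e) = ≤-trans (s≤s (+-mono-≤ (special-rank z≢r s) (subst (λ l → length l ≤ 2) (sym e) (extra≤2 z)))) (≤-trans (n≤1+n 5) 6≤t)
  ... | inj₂ (_ , e) = subst (_< t) (sym (trans (cong (λ l → rank z + length l) e) (+-identityʳ (rank z)))) lt

  -- Below the root only siblings count. If `rank z < t`, the siblings leave room for all `D` edges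
  -- at the grandparent. Otherwise `t` threats, the edge of `par z` and at most `D ∸ 2` siblings
  -- stay below `D + t`.
  avoided-length : ∀ {z} → z ≢ r → length (avoided z) < D + t
  avoided-length {z} z≢r = bound (par z Finₚ.≟ r) (rank z <? t)
    where
    open ≤-Reasoning
    bound : ∀ a b → length (avoided-by z a b) < D + t
    bound (yes _) _ = ≤-trans (rank<D z≢r) (m≤m+n D t)
    bound (no _) (yes lt) = begin-strict
          length (incident (par (par z)) ++ (earlier z ++ extra′ z))
            ≡⟨ length-++ (incident (par (par z))) ⟩
          length (incident (par (par z))) + length (earlier z ++ extra′ z)
            ≡⟨ cong (length (incident (par (par z))) +_) (length-++ (earlier z)) ⟩
          length (incident (par (par z))) + (rank z + length (extra′ z))
            <⟨ +-mono-≤-< (incident≤D (par (par z))) (extra′-length z≢r lt) ⟩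
          D + t ∎
    bound (no v≢r) (no _) = begin
          2 + length (threats (par z) ++ earlier z)
            ≡⟨ cong (2 +_) (length-++ (threats (par z))) ⟩
          2 + (length (threats (par z)) + rank z)
            ≤⟨ +-monoʳ-≤ 2 (+-monoˡ-≤ (rank z) (threats≤t (par z))) ⟩
          2 + (t + rank z)
            ≡⟨ cong (2 +_) (+-comm t (rank z)) ⟩
          2 + rank z + t
            ≤⟨ +-monoˡ-≤ t (rank+2≤D z≢r v≢r) ⟩
          D + t ∎

  -- The fields `threat` and `top` are the two ways in which an edge at a vertex can lose: the
  -- losing edge leads down to a child, or up to the parent, where it holds position 0.
  record Colouring (φ : Fin n → ℕ) : Set where
    field
      listed   : ∀ {z} → z ≢ r → φ z ∈ L z
      siblings : ∀ {w z} → w ≢ r → z ≢ r → par w ≡ par z → w ≢ z → φ w ≢ φ z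
      parent   : ∀ {z} → z ≢ r → par z ≢ r → φ z ≢ φ (par z)
      threat   : ∀ {z w} → z ≢ r → par z ≢ r → Incident (par (par z)) w → Threat (par z) w → φ z ≢ φ w
      top      : ∀ {z w} → z ≢ r → par z ≢ r → In t 0 (pos z) → Incident (par (par z)) w → φ z ≢ φ w
      special  : ∀ {z w} → z ≢ r → Special z → w ∈ extra z → key w < key z → φ z ≢ φ w

  incident-key : ∀ {z w} → z ≢ r → par z ≢ r → Incident (par (par z)) w → key w < key z
  incident-key z≢r v≢r (_ , inj₁ refl) = key-depth (<-trans (par-depth< v≢r) (par-depth< z≢r))
  incident-key z≢r v≢r (w≢r , inj₂ e) = key-depth (≤-trans (s≤s (≤-reflexive (sib-depth w≢r v≢r e))) (par-depth< z≢r))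

  colouring : (∀ {z} → z ≢ r → Unique (L z)) → (∀ {z} → z ≢ r → D + t ≤ length (L z)) → ∃ Colouring
  colouring L-unique L-long with Greedy.colouring key avoided L (λ z → ¬? (z Finₚ.≟ r)) L-unique
                                   (λ z≢r → ≤-trans (avoided-length z≢r) (L-long z≢r)) _ key-bound
  ... | φ , good = φ , record
    { listed = λ z≢r → proj₁ (good z≢r)
    ; siblings = siblings
    ; parent = parent
    ; threat = threat
    ; top = top
    ; special = special }
    where
    earlier≢ : ∀ {z w} → z ≢ r → Earlier z w → φ z ≢ φ w
    earlier≢ {z} {w} z≢r p = proj₂ (good z≢r) (mem (par z Finₚ.≟ r) (rank z <? t)) (proj₂ (proj₂ p))
      where
      mem : ∀ a b → w ∈ avoided-by z a b
      mem (yes _) _ = earlier⁺ p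
      mem (no _) (yes _) = ∈-++⁺ʳ (incident (par (par z))) (∈-++⁺ˡ (earlier⁺ p))
      mem (no _) (no _) = there (∈-++⁺ʳ (threats (par z)) (earlier⁺ p))
    siblings : ∀ {w z} → w ≢ r → z ≢ r → par w ≡ par z → w ≢ z → φ w ≢ φ z
    siblings {w} {z} w≢r z≢r e ne with <-cmp (key w) (key z)
    ... | tri< lt _ _ = λ q → earlier≢ z≢r (w≢r , e , lt) (sym q)
    ... | tri> _ _ gt = earlier≢ w≢r (z≢r , sym e , gt)
    ... | tri≈ _ k _ = contradiction (key-injective k) ne
    parent : ∀ {z} → z ≢ r → par z ≢ r → φ z ≢ φ (par z)
    parent {z} z≢r v≢r = proj₂ (good z≢r) (mem (par z Finₚ.≟ r) (rank z <? t)) (key-depth (par-depth< z≢r))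
      where
      mem : ∀ a b → par z ∈ avoided-by z a b
      mem (yes e) _ = contradiction e v≢r
      mem (no _) (yes _) = ∈-++⁺ˡ (incident⁺ (v≢r , inj₂ refl))
      mem (no _) (no _) = here refl
    threat : ∀ {z w} → z ≢ r → par z ≢ r → Incident (par (par z)) w → Threat (par z) w → φ z ≢ φ w
    threat {z} {w} z≢r v≢r i th = proj₂ (good z≢r) (mem (par z Finₚ.≟ r) (rank z <? t)) (incident-key z≢r v≢r i)
      where
      mem : ∀ a b → w ∈ avoided-by z a b
      mem (yes e) _ = contradiction e v≢r
      mem (no _) (yes _) = ∈-++⁺ˡ (incident⁺ i)
      mem (no _) (no _) = there (∈-++⁺ˡ (threats⁺ i th))
    top : ∀ {z w} → z ≢ r → par z ≢ r → In t 0 (pos z) → Incident (par (par z)) w → φ z ≢ φ w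
    top {z} {w} z≢r v≢r (inj₁ (() , _)) i
    top {z} {w} z≢r v≢r (inj₂ lt) i = proj₂ (good z≢r) (mem (par z Finₚ.≟ r) (rank z <? t)) (incident-key z≢r v≢r i)
      where
      -- From `t < pos z`, that is `t < 2t ∸ rank z`, so `z` falls into the case that avoids all
      -- edges at the grandparent.
      rank<t : rank z < t
      rank<t = +-cancelˡ-< t _ _ (subst (t + rank z <_) (m∸n+n≡m (<⇒≤ (rank<2t z≢r v≢r))) (+-monoˡ-< (rank z) lt))
      mem : ∀ a b → w ∈ avoided-by z a b
      mem (yes e) _ = contradiction e v≢r
      mem (no _) (yes _) = ∈-++⁺ˡ (incident⁺ i)
      mem (no _) (no ≮) = contradiction rank<t ≮
    special : ∀ {z w} → z ≢ r → Special z → w ∈ extra z → key w < key z → φ z ≢ φ w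
    special {z} {w} z≢r s w∈ lt = proj₂ (good z≢r) (mem (par z Finₚ.≟ r) (rank z <? t)) lt
      where
      mem : ∀ a b → w ∈ avoided-by z a b
      mem (yes e) _ = contradiction e ([ proj₁ , proj₁ ]′ s)
      -- Rank at most 2 is below `t`, so a special vertex always falls into the case that includes
      -- `extra′`.
      mem (no _) (no ≮) = contradiction (≤-trans (s≤s (special-rank z≢r s)) (≤-trans (m≤m+n 3 3) 6≤t)) ≮
      mem (no _) (yes _) with extra′-cases z
      ...   | inj₁ (_ , e) = ∈-++⁺ʳ (incident (par (par z))) (∈-++⁺ʳ (earlier z) (subst (w ∈_) (sym e) w∈))
      ...   | inj₂ (ns , _) = contradiction s ns

-- Cyclic successor and predecessor.

csuc-iter : ∀ {k} (i : Fin k) j → toℕ i + j < k → toℕ (iter j csuc i) ≡ toℕ i + j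
csuc-iter i zero lt = sym (+-identityʳ (toℕ i))
csuc-iter {k} i (suc j) lt = trans (csuc-< (iter j csuc i) (subst (λ x → suc x < k) (sym ih) lt′))
                               (trans (cong suc ih) (sym (+-suc (toℕ i) j)))
  where
  lt′ : suc (toℕ i + j) < k
  lt′ = subst (_< k) (+-suc (toℕ i) j) lt
  ih = csuc-iter i j (<-trans (n<1+n _) lt′)

csuc-from-zero : ∀ {k} (i : Fin (suc k)) → iter (toℕ i) csuc zero ≡ i
csuc-from-zero i = Finₚ.toℕ-injective (csuc-iter zero (toℕ i) (Finₚ.toℕ<n i))

csuc-to-zero : ∀ {k} (i : Fin (suc k)) → ∃ λ j → iter (suc j) csuc i ≡ zero
csuc-to-zero {k} i = k ∸ toℕ i , Finₚ.toℕ-injective (csuc-last _ (cong suc (trans (csuc-iter i (k ∸ toℕ i) (s≤s (≤-reflexive e))) e)))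
  where
  e : toℕ i + (k ∸ toℕ i) ≡ k
  e = m+[n∸m]≡n (Finₚ.toℕ≤pred[n] i)

csuc-injective : ∀ {k} {i j : Fin k} → csuc i ≡ csuc j → i ≡ j
csuc-injective {suc k} {i} {j} = surjective⇒injective Finₚ._≟_ csuc (Uniqueₚ.allFin⁺ (suc k)) (λ {x} _ → before x)
    (∈-allFin i) (∈-allFin j)
  where
  before : (x : Fin (suc k)) → ∃ λ y → y ∈ allFin (suc k) × csuc y ≡ x
  before zero = iter (proj₁ (csuc-to-zero {k} zero)) csuc zero , ∈-allFin _ , proj₂ (csuc-to-zero {k} zero)
  before (suc x) = iter (toℕ x) csuc zero , ∈-allFin _ , csuc-from-zero (suc x)

cpred : ∀ {k} → Fin (suc k) → Fin (suc k)
cpred {k} zero = iter (proj₁ (csuc-to-zero {k} zero)) csuc zero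
cpred (suc x) = iter (toℕ x) csuc zero

csuc-cpred : ∀ {k} (i : Fin (suc k)) → csuc (cpred i) ≡ i
csuc-cpred {k} zero = proj₂ (csuc-to-zero {k} zero)
csuc-cpred (suc x) = csuc-from-zero (suc x)

cpred-csuc : ∀ {k} (i : Fin (suc k)) → cpred (csuc i) ≡ i
cpred-csuc i = csuc-injective (csuc-cpred (csuc i))

csuc≢ : ∀ {k} (i : Fin (2 + k)) → csuc i ≢ i
csuc≢ {k} i e with suc (toℕ i) <? 2 + k
... | yes lt = contradiction (trans (sym (csuc-< i lt)) (cong toℕ e)) 1+n≢n
... | no ≮ = contradiction (trans (cong suc (trans (sym (csuc-last i last)) (cong toℕ e))) last) λ ()
  where
  last = ≤-antisym (Finₚ.toℕ<n i) (≮⇒≥ ≮)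

-- Star edge colourings of long cycles from lists of three colours.

Window : ℕ → ℕ → ℕ → ℕ → Set
Window a b c d = a ≢ b × ¬ (a ≡ c × b ≡ d)

-- As `i` runs round the whole cycle, comparing the first two colours of each window makes the
-- colouring proper.
StarCycle : ∀ {M} → (Fin M → ℕ) → Set
StarCycle s = ∀ i → Window (s i) (s (csuc i)) (s (csuc (csuc i))) (s (csuc (csuc (csuc i))))

ListStarCycle : ∀ {M} → (Fin M → List ℕ) → Set
ListStarCycle {M} L = ∃ λ (s : Fin M → ℕ) → (∀ i → s i ∈ L i) × StarCycle s

rotate : ∀ {k} {L : Fin (suc k) → List ℕ} → ListStarCycle (L ∘ csuc) → ListStarCycle L
rotate {L = L} (s , s∈ , star) = s ∘ cpred , (λ i → subst (λ x → s (cpred i) ∈ L x) (csuc-cpred i) (s∈ (cpred i))) , star′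
  where
  shift : ∀ i → cpred (csuc i) ≡ csuc (cpred i)
  shift i = trans (cpred-csuc i) (sym (csuc-cpred i))
  star′ : StarCycle (s ∘ cpred)
  star′ i rewrite shift (csuc (csuc i)) | shift (csuc i) | shift i = star (cpred i)

rotate* : ∀ {k} j {L : Fin (suc k) → List ℕ} → ListStarCycle (L ∘ iter j csuc) → ListStarCycle L
rotate* zero p = p
rotate* (suc j) {L} p = rotate (rotate* j {L ∘ csuc} p)

-- Replaces cyclic indices by natural numbers: only the windows at the last three starting points
-- wrap round, and these are listed one by one.
close-up : ∀ {p} (s : ℕ → ℕ) →
           (∀ j → j < p → Window (s j) (s (1 + j)) (s (2 + j)) (s (3 + j))) →
           Window (s p) (s (1 + p)) (s (2 + p)) (s 0) →
           Window (s (1 + p)) (s (2 + p)) (s 0) (s 1) →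
           Window (s (2 + p)) (s 0) (s 1) (s 2) →
           StarCycle {3 + p} (s ∘ toℕ)
close-up {p} s w w₀ w₁ w₂ i = go (toℕ i <? p)
  where
  M = 3 + p
  Goal = Window (s (toℕ i)) (s (toℕ (csuc i))) (s (toℕ (csuc (csuc i)))) (s (toℕ (csuc (csuc (csuc i)))))
  next : ∀ (j : Fin M) {x} → toℕ j ≡ x → suc x < M → toℕ (csuc j) ≡ suc x
  next j refl lt = csuc-< j lt
  wrap : ∀ (j : Fin M) {x} → toℕ j ≡ x → suc x ≡ M → toℕ (csuc j) ≡ 0
  wrap j refl e = csuc-last j e
  at : ∀ {a b c d} → toℕ i ≡ a → toℕ (csuc i) ≡ b → toℕ (csuc (csuc i)) ≡ c → toℕ (csuc (csuc (csuc i))) ≡ d →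
       Window (s a) (s b) (s c) (s d) → Goal
  at ea eb ec ed x rewrite ea | eb | ec | ed = x
  go : Dec (toℕ i < p) → Goal
  go (yes lt) = at refl e₁ e₂ (next (csuc (csuc i)) e₂ (s≤s (s≤s (s≤s lt)))) (w (toℕ i) lt)
    where
    e₁ = next i refl (s≤s (s≤s (≤-trans (n≤1+n _) (≤-trans lt (n≤1+n _)))))
    e₂ = next (csuc i) e₁ (s≤s (s≤s (s≤s (≤-trans (n≤1+n _) lt))))
  go (no ≮) with m≤n⇒m<n∨m≡n (≮⇒≥ ≮)
  ... | inj₂ e = at (sym e) e₁ e₂ (wrap (csuc (csuc i)) e₂ refl) w₀
    where
    e₁ = next i (sym e) (s≤s (s≤s (n≤1+n p)))
    e₂ = next (csuc i) e₁ ≤-refl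
  ... | inj₁ lt with m≤n⇒m<n∨m≡n lt
  ...   | inj₂ e = at (sym e) e₁ e₂ (next (csuc (csuc i)) e₂ (s≤s (s≤s z≤n))) w₁
    where
    e₁ = next i (sym e) ≤-refl
    e₂ = wrap (csuc i) e₁ refl
  ...   | inj₁ lt′ = at e e₁ e₂ (next (csuc (csuc i)) e₂ (s≤s (s≤s (s≤s z≤n)))) w₂
    where
    e : toℕ i ≡ 2 + p
    e = ≤-antisym (Finₚ.toℕ≤pred[n] i) lt′
    e₁ = wrap i e refl
    e₂ = next (csuc i) e₁ (s≤s (s≤s z≤n))

-- Start with a colour c that the last edge cannot have, and avoid the previous two
-- colours at each step; if the last but one edge gets c, the last edge is free to
-- avoid the colour of the second edge instead.
module CycleFrom (p : ℕ) (L : ℕ → List ℕ) (L-unique : ∀ j → Unique (L j)) (L-long : ∀ j → 3 ≤ length (L j))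
                 {c : ℕ} (c∈ : c ∈ L 0) (c∉ : c ∉ L (3 + p)) where

  abstract
    avoid₂ : ∀ j a b → ∃ λ x → x ∈ L j × x ≢ a × x ≢ b
    avoid₂ j a b with pick (a ∷ b ∷ []) (L-unique j) (L-long j)
    ... | x , x∈ , x∉ = x , x∈ , (λ e → x∉ (here e)) , λ e → x∉ (there (here e))

  pair : ℕ → ℕ × ℕ
  pair zero = c , proj₁ (avoid₂ 1 c c)
  pair (suc j) = proj₂ (pair j) , proj₁ (avoid₂ (2 + j) (proj₁ (pair j)) (proj₂ (pair j)))

  s : ℕ → ℕ
  s j = proj₁ (pair j)

  s∈ : ∀ j → s j ∈ L j
  s∈ zero = c∈
  s∈ (suc zero) = proj₁ (proj₂ (avoid₂ 1 c c))
  s∈ (suc (suc j)) = proj₁ (proj₂ (avoid₂ (2 + j) _ _))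

  s₁ : ∀ j → s (suc j) ≢ s j
  s₁ zero = proj₁ (proj₂ (proj₂ (avoid₂ 1 c c)))
  s₁ (suc j) = proj₂ (proj₂ (proj₂ (avoid₂ (2 + j) _ _)))

  s₂ : ∀ j → s (2 + j) ≢ s j
  s₂ j = proj₁ (proj₂ (proj₂ (avoid₂ (2 + j) _ _)))

  final : ∃ λ x → x ∈ L (3 + p) × x ≢ s (1 + p) × x ≢ s (2 + p) × ¬ (s (2 + p) ≡ c × x ≡ s 1)
  final with s (2 + p) ≟ c
  ... | no ne with avoid₂ (3 + p) (s (1 + p)) (s (2 + p))
  ...   | x , x∈ , n₁ , n₂ = x , x∈ , n₁ , n₂ , λ (e , _) → ne e
  final | yes e with avoid₂ (3 + p) (s (1 + p)) (s 1)
  ...   | x , x∈ , n₁ , n₂ = x , x∈ , n₁ , (λ e′ → c∉ (subst (_∈ L (3 + p)) (trans e′ e) x∈)) , λ (_ , e′) → n₂ e′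

  s′ : ℕ → ℕ
  s′ j with j ≟ 3 + p
  ... | yes _ = proj₁ final
  ... | no _ = s j

  s′∈ : ∀ j → s′ j ∈ L j
  s′∈ j with j ≟ 3 + p
  ... | yes refl = proj₁ (proj₂ final)
  ... | no _ = s∈ j

  s′-last : s′ (3 + p) ≡ proj₁ final
  s′-last with 3 + p ≟ 3 + p
  ... | yes _ = refl
  ... | no ne = contradiction refl ne

  s′-< : ∀ {j} → j < 3 + p → s′ j ≡ s j
  s′-< {j} lt with j ≟ 3 + p
  ... | yes e = contradiction e (<⇒≢ lt)
  ... | no _ = refl

  star : StarCycle {4 + p} (s′ ∘ toℕ)
  star = close-up s′ inside w₀ w₁ w₂
    where
    x = proj₁ final
    fin = proj₂ (proj₂ final)
    inside : ∀ j → j < 1 + p → Window (s′ j) (s′ (1 + j)) (s′ (2 + j)) (s′ (3 + j))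
    inside j lt rewrite s′-< {j} (≤-trans lt (s≤s (m≤n+m p 2))) | s′-< {1 + j} (s≤s (≤-trans lt (s≤s (n≤1+n p)))) | s′-< {2 + j} (s≤s (s≤s lt)) =
      (λ e → s₁ j (sym e)) , λ (e , _) → s₂ j (sym e)
    w₀ : Window (s′ (1 + p)) (s′ (2 + p)) (s′ (3 + p)) (s′ 0)
    w₀ rewrite s′-last | s′-< {1 + p} (s≤s (s≤s (n≤1+n p))) | s′-< {2 + p} ≤-refl =
      (λ e → s₁ (1 + p) (sym e)) , λ (e , _) → proj₁ fin (sym e)
    w₁ : Window (s′ (2 + p)) (s′ (3 + p)) (s′ 0) (s′ 1)
    w₁ rewrite s′-last | s′-< {2 + p} ≤-refl =
      (λ e → proj₁ (proj₂ fin) (sym e)) , λ (e , e′) → proj₂ (proj₂ fin) (e , e′)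
    w₂ : Window (s′ (3 + p)) (s′ 0) (s′ 1) (s′ 2)
    w₂ rewrite s′-last = (λ e → c∉ (subst (_∈ L (3 + p)) e (proj₁ (proj₂ final)))) , λ (_ , e) → s₂ 0 (sym e)

nth : List ℕ → ℕ → ℕ
nth [] _ = 0
nth (x ∷ _) zero = x
nth (_ ∷ l) (suc j) = nth l j

nth-∈ : ∀ l {j} → j < length l → nth l j ∈ l
nth-∈ (x ∷ l) {zero} _ = here refl
nth-∈ (x ∷ l) {suc j} (s≤s lt) = there (nth-∈ l lt)

nth-++ : ∀ l k {j} → j < length l → nth (l ++ k) j ≡ nth l j
nth-++ (x ∷ l) k {zero} _ = refl
nth-++ (x ∷ l) k {suc j} (s≤s lt) = nth-++ l k lt

nth-++ʳ : ∀ l k j → nth (l ++ k) (j + length l) ≡ nth k j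
nth-++ʳ [] k j = cong (nth k) (+-identityʳ j)
nth-++ʳ (x ∷ l) k j = trans (cong (nth (x ∷ l ++ k)) (+-suc j (length l))) (nth-++ʳ l k j)

Windows : List ℕ → Set
Windows (a ∷ k@(b ∷ c ∷ d ∷ l)) = Window a b c d × Windows k
Windows _ = ⊤

nth-Window : ∀ l → Windows l → ∀ j → 3 + j < length l → Window (nth l j) (nth l (1 + j)) (nth l (2 + j)) (nth l (3 + j))
nth-Window (a ∷ b ∷ c ∷ d ∷ l) (w , _) zero _ = w
nth-Window (a ∷ k@(b ∷ c ∷ d ∷ l)) (_ , ws) (suc j) (s≤s lt) = nth-Window k ws j lt
nth-Window (_ ∷ []) _ _ (s≤s ())
nth-Window (_ ∷ _ ∷ []) _ _ (s≤s (s≤s ()))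
nth-Window (_ ∷ _ ∷ _ ∷ []) _ _ (s≤s (s≤s (s≤s ())))

window₁ : ∀ {a b c d} → a ≢ b → a ≢ c → Window a b c d
window₁ a≢b a≢c = a≢b , λ (e , _) → a≢c e

window₂ : ∀ {a b c d} → a ≢ b → b ≢ d → Window a b c d
window₂ a≢b b≢d = a≢b , λ (_ , e) → b≢d e

module Constant {a b c : ℕ} (a≢b : a ≢ b) (a≢c : a ≢ c) (b≢c : b ≢ c) where

  abc : List ℕ
  abc = a ∷ b ∷ c ∷ []

  -- The cycle reads `abc ++ l`. The trailing `abc` repeats its first three colours, so that plain
  -- windows include those that wrap round; the leading `abc` lets a further block be put in front.
  Pattern : List ℕ → Set
  Pattern l = Windows (abc ++ l ++ abc) × (∀ {x} → x ∈ l → x ∈ abc)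

  private
    abca : Window a b c a
    abca = window₁ a≢b a≢c
    bcab : Window b c a b
    bcab = window₁ b≢c (≢-sym a≢b)
    cabc : Window c a b c
    cabc = window₁ (≢-sym a≢c) (≢-sym b≢c)
    abcb : Window a b c b
    abcb = window₁ a≢b a≢c
    bcba : Window b c b a
    bcba = window₂ b≢c (≢-sym a≢c)
    cbab : Window c b a b
    cbab = window₁ (≢-sym b≢c) (≢-sym a≢c)
    babc : Window b a b c
    babc = window₂ (≢-sym a≢b) a≢c

    a∈ : a ∈ abc
    a∈ = here refl
    b∈ : b ∈ abc
    b∈ = there (here refl)
    c∈ : c ∈ abc
    c∈ = there (there (here refl))

    infixr 5 _∷′_
    _∷′_ : ∀ {y l} → y ∈ abc → (∀ {x} → x ∈ l → x ∈ abc) → ∀ {x} → x ∈ y ∷ l → x ∈ abc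
    (y∈ ∷′ f) (here refl) = y∈
    (y∈ ∷′ f) (there x∈) = f x∈

    []′ : ∀ {x} → x ∈ [] → x ∈ abc
    []′ ()

  -- Blocks abc and abcb can be strung together in any order.
  pattern-of : ∀ m → ∃ λ l → length l ≡ 5 + m × Pattern l
  -- The whole cycles of length 8, 9 and 10 are `abcb abcb`, `abc abc abc` and `abcb abc abc`;
  -- adding blocks `abc` reaches all greater lengths.
  pattern-of 0 = b ∷ abc ++ b ∷ [] , refl ,
    (abcb , bcba , cbab , babc , abcb , bcba , cbab , babc , tt) , (b∈ ∷′ a∈ ∷′ b∈ ∷′ c∈ ∷′ b∈ ∷′ []′)
  pattern-of 1 = abc ++ abc , refl ,
    (abca , bcab , cabc , abca , bcab , cabc , abca , bcab , cabc , tt) , (a∈ ∷′ b∈ ∷′ c∈ ∷′ a∈ ∷′ b∈ ∷′ c∈ ∷′ []′)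
  pattern-of 2 = b ∷ abc ++ abc , refl ,
    (abcb , bcba , cbab , babc , abca , bcab , cabc , abca , bcab , cabc , tt) , (b∈ ∷′ a∈ ∷′ b∈ ∷′ c∈ ∷′ a∈ ∷′ b∈ ∷′ c∈ ∷′ []′)
  pattern-of (suc (suc (suc m))) with pattern-of m
  ... | l , e , w , f = abc ++ l , trans (cong (3 +_) e) (trans (+-comm 3 (5 + m)) (trans (+-assoc 5 m 3) (cong (5 +_) (+-comm m 3)))) ,
    (abca , bcab , cabc , w) , (a∈ ∷′ b∈ ∷′ c∈ ∷′ f)

  constant-cycle : ∀ {m} (L : Fin (8 + m) → List ℕ) → (∀ {x} → x ∈ abc → ∀ i → x ∈ L i) → ListStarCycle L
  constant-cycle {m} L abc∈ with pattern-of m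
  ... | l , e , w , f = s ∘ toℕ , member , star e
    where
    F = abc ++ l ++ abc
    s : ℕ → ℕ
    s = nth F
    wrap : ∀ j → j < 3 → s (j + (3 + length l)) ≡ s j
    wrap j lt = trans (cong (λ k → s k) (trans (sym (+-assoc j 3 (length l))) (cong (_+ length l) (+-comm j 3))))
                  (trans (nth-++ʳ l abc j) (sym (nth-++ abc (l ++ abc) lt)))
    F-length : length F ≡ 6 + length l
    F-length = cong (3 +_) (trans (length-++ l) (+-comm (length l) 3))
    window : ∀ j → j < 3 + length l → Window (s j) (s (1 + j)) (s (2 + j)) (s (3 + j))
    window j lt = nth-Window F w j (subst (3 + j <_) (sym F-length) (+-monoʳ-< 3 lt))
    star : ∀ {p} → length l ≡ p → StarCycle {3 + p} (s ∘ toℕ)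
    star refl = close-up s (λ j lt → window j (≤-trans lt (m≤n+m _ 3)))
      (subst (Window _ _ _) (wrap 0 z<s) (window (length l) (s≤s (m≤n+m _ 2))))
      (subst₂ (Window _ _) (wrap 0 z<s) (wrap 1 (s<s z<s)) (window (1 + length l) (s≤s (s≤s (n≤1+n _)))))
      (subst₂ (λ x (y , z) → Window (s (2 + length l)) x y z) (wrap 0 z<s) (cong₂ _,_ (wrap 1 (s<s z<s)) (wrap 2 (s<s (s<s z<s)))) (window (2 + length l) ≤-refl))
    member : ∀ i → s (toℕ i) ∈ L i
    member i = abc∈ (sub (nth-∈ (abc ++ l) lt)) i
      where
      lt : toℕ i < length (abc ++ l)
      lt = ≤-trans (Finₚ.toℕ<n i) (≤-reflexive (cong (3 +_) (sym e)))
      sub : nth (abc ++ l) (toℕ i) ∈ abc ++ l → s (toℕ i) ∈ abc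
      sub x∈ = subst (_∈ abc) (sym (nth-++ (abc ++ l) abc lt)) ([ id , f ]′ (∈-++⁻ abc x∈))

-- Either some list has a colour missing from the list before it, and the greedy colouring starts
-- there; or inclusions run all the way round, every list contains `L zero`, and three common
-- colours suffice.
cycle-star : ∀ {m} (L : Fin (8 + m) → List ℕ) → (∀ i → Unique (L i)) → (∀ i → 3 ≤ length (L i)) → ListStarCycle L
cycle-star {m} L L-unique L-long with Finₚ.any? (λ i → Any.any? (_∉? L i) (L (csuc i)))
... | yes (i , new) with find new
...   | c , c∈ , c∉ = rotate* (toℕ (csuc i)) (C.s′ ∘ toℕ , (λ j → subst (λ x → C.s′ (toℕ j) ∈ L′ x) (fin-toℕ j) (C.s′∈ (toℕ j))) , C.star)
  where
  k = toℕ (csuc i)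
  L′ : Fin (8 + m) → List ℕ
  L′ = L ∘ iter k csuc
  fin : ℕ → Fin (8 + m)
  fin j = fromℕ< (m%n<n j (8 + m))
  fin-toℕ : ∀ j → fin (toℕ j) ≡ j
  fin-toℕ j = Finₚ.toℕ-injective (trans (Finₚ.toℕ-fromℕ< _) (m<n⇒m%n≡m (Finₚ.toℕ<n j)))
  last-is : iter k csuc (fin (7 + m)) ≡ i
  last-is = csuc-injective (trans (iter-suc csuc k (fin (7 + m)))
    (trans (cong (iter k csuc) (Finₚ.toℕ-injective {i = csuc (fin (7 + m))} {zero} (csuc-last (fin (7 + m)) (cong suc (trans (Finₚ.toℕ-fromℕ< _) (m<n⇒m%n≡m {8 + m} {7 + m} ≤-refl))))))
      (csuc-from-zero (csuc i))))
  module C = CycleFrom (4 + m) (L′ ∘ fin) (λ _ → L-unique _) (λ _ → L-long _)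
               (subst (λ x → c ∈ L x) (sym (csuc-from-zero (csuc i))) c∈)
               (subst (λ x → c ∉ L x) (sym last-is) c∉)
cycle-star {m} L L-unique L-long | no ¬new = go (L zero) refl (L-unique zero) (L-long zero)
  where
  back : ∀ {x i} → x ∈ L (csuc i) → x ∈ L i
  back {x} {i} x∈ with x ∈? L i
  ... | yes p = p
  ... | no ¬p = contradiction (i , lose x∈ ¬p) ¬new
  back* : ∀ {x i} j → x ∈ L (iter j csuc i) → x ∈ L i
  back* zero x∈ = x∈
  back* (suc j) x∈ = back* j (back x∈)
  everywhere : ∀ {x} i → x ∈ L zero → x ∈ L i
  everywhere {x} i x∈ with csuc-to-zero i
  ... | j , e = back* (suc j) (subst (λ y → x ∈ L y) (sym e) x∈)
  go : ∀ l → L zero ≡ l → Unique l → 3 ≤ length l → ListStarCycle L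
  go (a ∷ b ∷ c ∷ l) e ((a≢b ∷ a≢c ∷ _) ∷ (b≢c ∷ _) ∷ _) _ =
    Constant.constant-cycle a≢b a≢c b≢c L (λ x∈ i → everywhere i (subst (_ ∈_) (sym e) (Anyₚ.++⁺ˡ x∈)))
  go (_ ∷ []) _ _ (s≤s ())
  go (_ ∷ _ ∷ []) _ _ (s≤s (s≤s ()))

cycle-star′ : ∀ k → 5 ≤ k → (L : Fin (3 + k) → List ℕ) → (∀ i → Unique (L i)) → (∀ i → 3 ≤ length (L i)) → ListStarCycle L
cycle-star′ (suc (suc (suc (suc (suc m))))) (s≤s (s≤s (s≤s (s≤s (s≤s z≤n))))) = cycle-star

csuc²≢ : ∀ {k} (i : Fin (3 + k)) → csuc (csuc i) ≢ i
csuc²≢ {k} i e with suc (toℕ i) <? 3 + k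
... | no ≮ = contradiction (trans (cong suc (trans (cong suc (sym (csuc-last i last))) (trans (sym (csuc-< (csuc i) (subst (λ x → suc x < 3 + k) (sym (csuc-last i last)) (s≤s (s≤s z≤n))))) (cong toℕ e)))) last) λ ()
  where
  last = ≤-antisym (Finₚ.toℕ<n i) (≮⇒≥ ≮)
... | yes lt with suc (toℕ (csuc i)) <? 3 + k
...   | yes lt′ = contradiction (trans (cong suc (sym (csuc-< i lt))) (trans (sym (csuc-< (csuc i) lt′)) (cong toℕ e))) (m+1+n≢n 1)
...   | no ≮ = contradiction (trans (cong (λ x → suc (suc x)) (trans (sym (csuc-last (csuc i) last)) (cong toℕ e))) (trans (cong suc (sym (csuc-< i lt))) last)) λ ()
  where
  last = ≤-antisym (Finₚ.toℕ<n (csuc i)) (≮⇒≥ ≮)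

-- Counting the leaves.

module LeafCount {n} (G : Graph n) (r : Fin n) (R : Rooting G r) where
  open Rooting R

  data Below (v : Fin n) : Fin n → Set where
    self : Below v v
    down : ∀ {x} → x ≢ r → Below v (par x) → Below v x

  below-depth : ∀ {v x} → Below v x → depth v ≤ depth x
  below-depth self = ≤-refl
  below-depth (down x≢r b) = ≤-trans (below-depth b) (≤-trans (n≤1+n _) (≤-reflexive (sym (depth-par x≢r))))

  below-< : ∀ {v x} → x ≢ r → Below v (par x) → depth v < depth x
  below-< x≢r b = ≤-trans (s≤s (below-depth b)) (≤-reflexive (sym (depth-par x≢r)))

  below-unique : ∀ {v w x} → Below v x → Below w x → depth v ≡ depth w → v ≡ w
  below-unique self self _ = refl
  below-unique self (down x≢r b) e = contradiction (sym e) (<⇒≢ (below-< x≢r b))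
  below-unique (down x≢r b) self e = contradiction e (<⇒≢ (below-< x≢r b))
  below-unique (down _ a) (down _ b) e = below-unique a b e

  below-trans : ∀ {v w x} → Below v w → Below w x → Below v x
  below-trans a self = a
  below-trans a (down x≢r b) = down x≢r (below-trans a b)

  child-exists : ∀ {v} → v ≢ r → ¬ IsLeaf G v → ∃ λ w → w ≢ r × par w ≡ v
  child-exists {v} v≢r inner with Finₚ.any? (λ w → T? (adj G v w) ×-dec ¬? (w Finₚ.≟ par v))
  ... | yes (w , a , ne) with edge a
  ...   | inj₁ (_ , e) = contradiction (sym e) ne
  ...   | inj₂ p = w , p
  child-exists {v} v≢r inner | no none = contradiction
    (≤-antisym (deg≤cover G (par v ∷ []) only) (unique-nbrs≤deg G {xs = par v ∷ []} ([] ∷ []) (λ { (here refl) → par-adj v≢r })))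
    inner
    where
    only : ∀ {x} → Adj G v x → x ∈ par v ∷ []
    only {x} a with x Finₚ.≟ par v
    ... | yes e = here e
    ... | no ne = contradiction (x , a , ne) none

  -- Each step to a child raises the depth, which stays below `n`; the fuel measures what is left.
  leaf-below : ∀ fuel {v} → v ≢ r → n ≤ fuel + depth v → ∃ λ x → IsLeaf G x × Below v x
  leaf-below zero {v} _ le = contradiction (depth< v) (≤⇒≯ le)
  leaf-below (suc fuel) {v} v≢r le with leaf? G v
  ... | yes l = v , l , self
  ... | no inner with child-exists v≢r inner
  ...   | w , w≢r , refl with leaf-below fuel w≢r (≤-trans le (≤-reflexive (trans (sym (+-suc fuel _)) (cong (fuel +_) (sym (depth-par w≢r))))))
  ...     | x , l , b = x , l , below-trans (down w≢r self) b

  -- Each child of the root is sent to a leaf below it, and a leaf has only one ancestor at the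
  -- depth of the children. This makes the outer cycle long.
  deg≤leaves : ∀ {m} (c : Fin (suc m) → Fin n) → (∀ v → IsLeaf G v → ∃ λ i → c i ≡ v) → deg G r ≤ suc m
  deg≤leaves {m} c c-all = ≤-trans (≤-reflexive (sym (length-map f (nbrs G r))))
      (≤-trans (unique-⊆⇒length≤ (map-unique f f-inj (nbrs-unique G r)) (λ {x} _ → ∈-allFin x))
        (≤-reflexive (length-tabulate id)))
    where
    descend : ∀ {w} → w ≢ r → ∃ λ x → IsLeaf G x × Below w x
    descend w≢r = leaf-below n w≢r (m≤m+n n _)
    f : Fin n → Fin (suc m)
    f w with w Finₚ.≟ r
    -- An arbitrary value: the root is not its own neighbour.
    ... | yes _ = zero
    ... | no w≢r = proj₁ (c-all _ (proj₁ (proj₂ (descend w≢r))))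
    f-spec : ∀ {w} → w ≢ r → Below w (c (f w))
    f-spec {w} w≢r with w Finₚ.≟ r
    ... | yes e = contradiction e w≢r
    ... | no w≢r = subst (Below w) (sym (proj₂ (c-all _ (proj₁ (proj₂ (descend w≢r)))))) (proj₂ (proj₂ (descend w≢r)))
    child : ∀ {w} → w ∈ nbrs G r → w ≢ r × par w ≡ r
    child w∈ with edge (∈-nbrs⁻ G w∈)
    ... | inj₁ (ne , _) = contradiction refl ne
    ... | inj₂ p = p
    f-inj : ∀ {v w} → v ∈ nbrs G r → w ∈ nbrs G r → f v ≡ f w → v ≡ w
    f-inj {v} {w} v∈ w∈ e with child v∈ | child w∈
    ... | v≢r , pv | w≢r , pw = below-unique (f-spec v≢r) (subst (Below w ∘ c) (sym e) (f-spec w≢r))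
      (trans (depth-par v≢r) (trans (cong (suc ∘ depth) (trans pv (sym pw))) (sym (depth-par w≢r))))

-- From the tree to the generalized Halin graph.

module HalinEdges {n} (H G : Graph n) (k : ℕ) (c : Fin (3 + k) → Fin n) (c-inj : Injective _≡_ _≡_ c)
    (c-leaf : ∀ i → IsLeaf G (c i))
    (H-edges : ∀ u v → (Adj H u v → Adj G u v ⊎ CEdge k c u v) × (Adj G u v ⊎ CEdge k c u v → Adj H u v)) where

  tree⇒H : ∀ {u v} → Adj G u v → Adj H u v
  tree⇒H a = proj₂ (H-edges _ _) (inj₁ a)

  cycle⇒H : ∀ i → Adj H (c i) (c (csuc i))
  cycle⇒H i = proj₂ (H-edges _ _) (inj₂ (i , inj₁ (refl , refl)))

  at-leaf : ∀ {i x} → Adj H (c i) x → Adj G (c i) x ⊎ x ≡ c (csuc i) ⊎ x ≡ c (cpred i)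
  at-leaf {i} a with proj₁ (H-edges _ _) a
  ... | inj₁ b = inj₁ b
  ... | inj₂ (j , inj₁ (e , e′)) = inj₂ (inj₁ (trans (sym e′) (cong (c ∘ csuc) (c-inj e))))
  ... | inj₂ (j , inj₂ (e , e′)) = inj₂ (inj₂ (trans (sym e) (cong c (trans (sym (cpred-csuc j)) (cong cpred (c-inj e′))))))

  at-inner : ∀ {v x} → ¬ IsLeaf G v → Adj H v x → Adj G v x
  at-inner inner a with proj₁ (H-edges _ _) a
  ... | inj₁ b = b
  ... | inj₂ (j , inj₁ (e , _)) = contradiction (subst (IsLeaf G) e (c-leaf j)) inner
  ... | inj₂ (j , inj₂ (_ , e)) = contradiction (subst (IsLeaf G) e (c-leaf (csuc j))) inner

  deg-leaf≤3 : ∀ i → deg H (c i) ≤ 3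
  deg-leaf≤3 i = ≤-trans (deg≤cover H (nbrs G (c i) ++ c (csuc i) ∷ c (cpred i) ∷ []) (cover ∘ at-leaf))
                   (≤-reflexive (trans (length-++ (nbrs G (c i))) (cong (_+ 2) (c-leaf i))))
    where
    cover : ∀ {x} → Adj G (c i) x ⊎ x ≡ c (csuc i) ⊎ x ≡ c (cpred i) → x ∈ nbrs G (c i) ++ c (csuc i) ∷ c (cpred i) ∷ []
    cover (inj₁ b) = ∈-++⁺ˡ (∈-nbrs⁺ G b)
    cover (inj₂ (inj₁ e)) = ∈-++⁺ʳ (nbrs G (c i)) (here e)
    cover (inj₂ (inj₂ e)) = ∈-++⁺ʳ (nbrs G (c i)) (there (here e))

module HalinGraph {n} (H G : Graph n)
    (rot : Fin n → Fin n → Fin n) (isRot : IsRotation G rot)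
    (k : ℕ) (c : Fin (3 + k) → Fin n) (c-inj : Injective _≡_ _≡_ c)
    (c-leaf : ∀ i → IsLeaf G (c i)) (c-all : ∀ v → IsLeaf G v → ∃ λ i → c i ≡ v)
    (order : LeafOrder G rot k c)
    (H-edges : ∀ u v → (Adj H u v → Adj G u v ⊎ CEdge k c u v) × (Adj G u v ⊎ CEdge k c u v → Adj H u v))
    (D : ℕ) (deg≤D : ∀ v → deg H v ≤ D) (13≤D : 13 ≤ D) (r : Fin n) (deg-r : deg H r ≡ D) (R : Rooting G r) where

  open Rooting R

  open HalinEdges H G k c c-inj c-leaf H-edges

  degG≤D : ∀ v → deg G v ≤ D
  degG≤D v = ≤-trans (deg≤cover G (nbrs H v) (λ a → ∈-nbrs⁺ H (tree⇒H a))) (deg≤D v)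

  r-inner : ¬ IsLeaf G r
  r-inner l = contradiction (≤-trans 13≤D (≤-trans (≤-reflexive (sym deg-r)) deg≤3)) λ { (s≤s (s≤s (s≤s ()))) }
    where
    deg≤3 : deg H r ≤ 3
    deg≤3 = subst (λ v → deg H v ≤ 3) (proj₂ (c-all r l)) (deg-leaf≤3 (proj₁ (c-all r l)))

  D≤leaves : D ≤ 3 + k
  D≤leaves = ≤-trans (≤-reflexive (sym deg-r))
    (≤-trans (deg≤cover H (nbrs G r) (λ a → ∈-nbrs⁺ G (at-inner r-inner a))) (LeafCount.deg≤leaves G r R c c-all))

  t : ℕ
  t = D / 2

  D≤1+2t : D ≤ 1 + (t + t)
  D≤1+2t = begin
    D ≡⟨ m≡m%n+[m/n]*n D 2 ⟩
    D % 2 + t * 2 ≤⟨ +-monoˡ-≤ (t * 2) (≤-pred (m%n<n D 2)) ⟩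
    1 + t * 2 ≡⟨ cong suc (trans (*-comm t 2) (cong (t +_) (+-identityʳ t))) ⟩
    1 + (t + t) ∎
    where open ≤-Reasoning

  6≤t : 6 ≤ t
  6≤t = /-monoˡ-≤ 2 13≤D

  -- This says that ⌈D/2⌉ is at least 7: removing 2t + 4 colours from `D + t` leaves ⌈D/2⌉ - 4,
  -- which must be at least 3. For `t ≥ 7` it follows from `2t ≤ D`; for `t = 6` the value 12 would
  -- fail and 13 suffices.
  7+t≤D : 7 + t ≤ D
  7+t≤D with 7 ≤? t
  ... | no ≰ = ≤-trans (+-monoʳ-≤ 7 (≤-pred (≰⇒> ≰))) 13≤D
  ... | yes le = ≤-trans (+-monoˡ-≤ t le) (≤-trans (≤-reflexive (sym (trans (*-comm t 2) (cong (t +_) (+-identityʳ t))))) (m/n*n≤m D 2))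

  leaf≢r : ∀ i → c i ≢ r
  leaf≢r i e = r-inner (subst (IsLeaf G) e (c-leaf i))

  leaf-par : ∀ {i x} → Adj G (c i) x → x ≡ par (c i)
  leaf-par {i} a = leaf-nbr-unique G (c-leaf i) a (par-adj (leaf≢r i))

  cycle-nbrs : Fin n → List (Fin n)
  cycle-nbrs z with Finₚ.any? (λ i → c i Finₚ.≟ z)
  ... | yes (i , _) = c (csuc i) ∷ c (cpred i) ∷ []
  ... | no _ = []

  cycle-nbrs≤2 : ∀ z → length (cycle-nbrs z) ≤ 2
  cycle-nbrs≤2 z with Finₚ.any? (λ i → c i Finₚ.≟ z)
  ... | yes _ = ≤-refl
  ... | no _ = z≤n

  cycle-nbrs-∈ : ∀ i → c (csuc i) ∈ cycle-nbrs (c i) × c (cpred i) ∈ cycle-nbrs (c i)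
  cycle-nbrs-∈ i with Finₚ.any? (λ j → c j Finₚ.≟ c i)
  ... | no none = contradiction (i , refl) none
  ... | yes (j , e) with c-inj e
  ...   | refl = here refl , there (here refl)

  cycle-nbrs-∋ : ∀ i → c i ∈ cycle-nbrs (c (csuc i))
  cycle-nbrs-∋ i = subst (λ j → c j ∈ cycle-nbrs (c (csuc i))) (cpred-csuc i) (proj₂ (cycle-nbrs-∈ (csuc i)))

  open FaceWalk G r R r-inner rot isRot using (parent-inner; next-leaf)

  module Coloured (L : Fin n → Fin n → List ℕ) (L-sym : ∀ u v → Adj H u v → L u v ≡ L v u)
                  (L-list : ∀ u v → Adj H u v → Unique (L u v) × D + t ≤ length (L u v)) where

    module TC = TreeColouring G r R r-inner rot isRot D t degG≤D D≤1+2t 6≤t (λ z → L z (par z)) cycle-nbrs cycle-nbrs≤2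
    open TC using (Incident; Threat; threats; threats⁺; threats≤t; key; posAt; pos)

    Result : Set
    Result = ∃ λ (ψ : Fin n → Fin n → ℕ) → (∀ u v → Adj H u v → ψ u v ≡ ψ v u) ×
               (∀ u v → Adj H u v → ψ u v ∈ L u v) × IsStarEdgeColoring H ψ

    tree-colouring : ∃ TC.Colouring
    tree-colouring = TC.colouring (λ z≢r → proj₁ (L-list _ _ (tree⇒H (par-adj z≢r)))) (λ z≢r → proj₂ (L-list _ _ (tree⇒H (par-adj z≢r))))

    module Tree (φ : Fin n → ℕ) (col : TC.Colouring φ) where
      module Φ = TC.Colouring col

      -- For leaves that are not siblings, whichever is coloured second is a last or first child and
      -- has avoided its neighbours on the cycle.
      consecutive : ∀ i → φ (c i) ≢ φ (c (csuc i))
      consecutive i with order i (par z) (par z′) (par-adj (leaf≢r i)) (par-adj (leaf≢r (csuc i)))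
        where
        z = c i
        z′ = c (csuc i)
      ... | j , e , inner with next-leaf (leaf≢r i) j (c-leaf (csuc i)) e inner
      ...   | last , first = go last first
        where
        z = c i
        z′ = c (csuc i)
        sib : par z′ ≡ par z → φ z ≢ φ z′
        sib e′ = Φ.siblings (leaf≢r i) (leaf≢r (csuc i)) (sym e′) (λ e″ → csuc≢ i (sym (c-inj e″)))
        go : _ → _ → φ z ≢ φ z′
        go (inj₂ (inj₂ e′)) _ = sib e′
        go _ (inj₂ (inj₂ e′)) = sib e′
        go (inj₂ (inj₁ lt)) (inj₂ (inj₁ gt)) = contradiction gt (<-asym lt)
        go (inj₁ l) (inj₂ (inj₁ gt)) = Φ.special (leaf≢r i) (inj₁ l) (proj₁ (cycle-nbrs-∈ i)) (TC.key-depth gt)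
        go (inj₂ (inj₁ lt)) (inj₁ f) = λ e′ → Φ.special (leaf≢r (csuc i)) (inj₂ f) (cycle-nbrs-∋ i) (TC.key-depth lt) (sym e′)
        go (inj₁ l) (inj₁ f) with <-cmp (key z) (key z′)
        ... | tri< lt _ _ = λ e′ → Φ.special (leaf≢r (csuc i)) (inj₂ f) (cycle-nbrs-∋ i) lt (sym e′)
        ... | tri≈ _ ke _ = contradiction (sym (c-inj (TC.key-injective ke))) (csuc≢ i)
        ... | tri> _ _ gt = Φ.special (leaf≢r i) (inj₁ l) (proj₁ (cycle-nbrs-∈ i)) gt

      blocked : Fin n → List (Fin n)
      blocked x = x ∷ threats x

      -- Besides what the stems at both ends forbid, the stems of the next leaf on either side are
      -- avoided: they could complete a bichromatic path centred at an end of the edge.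
      bad : Fin (3 + k) → List (Fin n)
      bad i = (blocked (c i) ++ blocked (c (csuc i))) ++ c (cpred i) ∷ c (csuc (csuc i)) ∷ []

      bad-length : ∀ i → length (bad i) ≤ 4 + (t + t)
      bad-length i = begin
        length (bad i) ≡⟨ length-++ (blocked (c i) ++ blocked (c (csuc i))) ⟩
        length (blocked (c i) ++ blocked (c (csuc i))) + 2 ≡⟨ cong (_+ 2) (length-++ (blocked (c i))) ⟩
        suc (length (threats (c i))) + suc (length (threats (c (csuc i)))) + 2
          ≤⟨ +-monoˡ-≤ 2 (+-mono-≤ (s≤s (threats≤t (c i))) (s≤s (threats≤t (c (csuc i))))) ⟩
        suc t + suc t + 2 ≡⟨ cong (_+ 2) (cong suc (+-suc t t)) ⟩
        2 + (t + t) + 2 ≡⟨ +-comm (2 + (t + t)) 2 ⟩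
        4 + (t + t) ∎
        where open ≤-Reasoning

      residue : Fin (3 + k) → List ℕ
      residue i = L (c i) (c (csuc i)) ∖ map φ (bad i)

      residue-length : ∀ i → 3 ≤ length (residue i)
      residue-length i = +-cancelˡ-≤ (4 + (t + t)) 3 _ (begin
        4 + (t + t) + 3 ≡⟨ +-comm (4 + (t + t)) 3 ⟩
        7 + (t + t) ≤⟨ +-monoˡ-≤ t 7+t≤D ⟩
        D + t ≤⟨ proj₂ (L-list _ _ (cycle⇒H i)) ⟩
        length (L (c i) (c (csuc i))) ≤⟨ length-∖ (map φ (bad i)) (proj₁ (L-list _ _ (cycle⇒H i))) ⟩
        length (map φ (bad i)) + length (residue i) ≤⟨ +-monoˡ-≤ _ (≤-trans (≤-reflexive (length-map φ (bad i))) (bad-length i)) ⟩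
        4 + (t + t) + length (residue i) ∎)
        where open ≤-Reasoning

      cycle-colouring : ListStarCycle residue
      cycle-colouring = cycle-star′ k (≤-trans (m≤n+m 5 5) (≤-pred (≤-pred (≤-pred (≤-trans 13≤D D≤leaves))))) residue
        (λ i → ∖-unique _ (proj₁ (L-list _ _ (cycle⇒H i)))) residue-length

      module Cycle (s : Fin (3 + k) → ℕ) (s∈ : ∀ i → s i ∈ residue i) (s-star : StarCycle s) where

        s-∈ : ∀ i → s i ∈ L (c i) (c (csuc i))
        s-∈ i = proj₁ (∈-∖⁻ {xs = L (c i) (c (csuc i))} (map φ (bad i)) (s∈ i))

        s≢ : ∀ i {x} → x ∈ bad i → s i ≢ φ x
        s≢ i x∈ e = proj₂ (∈-∖⁻ {xs = L (c i) (c (csuc i))} (map φ (bad i)) (s∈ i)) (subst (_∈ map φ (bad i)) (sym e) (∈-map⁺ φ x∈))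

        s≢start : ∀ i {x} → x ∈ blocked (c i) → s i ≢ φ x
        s≢start i x∈ = s≢ i (∈-++⁺ˡ (∈-++⁺ˡ x∈))

        s≢end : ∀ i {x} → x ∈ blocked (c (csuc i)) → s i ≢ φ x
        s≢end i x∈ = s≢ i (∈-++⁺ˡ (∈-++⁺ʳ (blocked (c i)) x∈))

        s≢before : ∀ i → s i ≢ φ (c (cpred i))
        s≢before i = s≢ i (∈-++⁺ʳ (blocked (c i) ++ blocked (c (csuc i))) (here refl))

        s≢after : ∀ i → s i ≢ φ (c (csuc (csuc i)))
        s≢after i = s≢ i (∈-++⁺ʳ (blocked (c i) ++ blocked (c (csuc i))) (there (here refl)))

        Joins : Fin n → Fin n → Fin n → Set
        Joins u v z = z ≢ r × ((z ≡ u × par z ≡ v) ⊎ (z ≡ v × par z ≡ u))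

        joins-unique : ∀ {u v z z′} → Joins u v z → Joins u v z′ → z ≡ z′
        joins-unique (_ , inj₁ (refl , _)) (_ , inj₁ (e , _)) = sym e
        joins-unique (_ , inj₂ (refl , _)) (_ , inj₂ (e , _)) = sym e
        joins-unique (z≢r , inj₁ (refl , refl)) (z′≢r , inj₂ (refl , e)) =
          contradiction (cong depth (sym e)) (<⇒≢ (<-trans (TC.par-depth< z′≢r) (TC.par-depth< z≢r)) ∘ sym)
        joins-unique (z≢r , inj₂ (refl , refl)) (z′≢r , inj₁ (refl , e)) =
          contradiction (cong depth (sym e)) (<⇒≢ (<-trans (TC.par-depth< z′≢r) (TC.par-depth< z≢r)) ∘ sym)

        CEdgeAt : Fin n → Fin n → Fin (3 + k) → Set
        CEdgeAt u v i = (c i ≡ u × c (csuc i) ≡ v) ⊎ (c i ≡ v × c (csuc i) ≡ u)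

        cedge-unique : ∀ {u v i j} → CEdgeAt u v i → CEdgeAt u v j → i ≡ j
        cedge-unique (inj₁ (refl , _)) (inj₁ (e , _)) = sym (c-inj e)
        cedge-unique (inj₂ (refl , _)) (inj₂ (e , _)) = sym (c-inj e)
        cedge-unique {i = i} (inj₁ (refl , refl)) (inj₂ (e , e′)) =
          contradiction (trans (cong csuc (sym (c-inj e))) (c-inj e′)) (csuc²≢ i)
        cedge-unique {i = i} (inj₂ (refl , refl)) (inj₁ (e , e′)) =
          contradiction (trans (cong csuc (sym (c-inj e))) (c-inj e′)) (csuc²≢ i)

        cedge-leaf : ∀ {u v i} → CEdgeAt u v i → IsLeaf G u × IsLeaf G v
        cedge-leaf {i = i} (inj₁ (refl , refl)) = c-leaf i , c-leaf (csuc i)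
        cedge-leaf {i = i} (inj₂ (refl , refl)) = c-leaf (csuc i) , c-leaf i

        abstract
          joins? : ∀ u v → Dec (∃ (Joins u v))
          joins? u v = Finₚ.any? λ z → ¬? (z Finₚ.≟ r) ×-dec
            (((z Finₚ.≟ u) ×-dec (par z Finₚ.≟ v)) ⊎-dec ((z Finₚ.≟ v) ×-dec (par z Finₚ.≟ u)))

          cedge? : ∀ u v → Dec (CEdge k c u v)
          cedge? u v = Finₚ.any? λ i → ((c i Finₚ.≟ u) ×-dec (c (csuc i) Finₚ.≟ v)) ⊎-dec ((c i Finₚ.≟ v) ×-dec (c (csuc i) Finₚ.≟ u))

          ψ-by : ∀ u v → Dec (∃ (Joins u v)) → Dec (CEdge k c u v) → ℕ
          ψ-by _ _ (yes (z , _)) _ = φ z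
          ψ-by _ _ (no _) (yes (i , _)) = s i
          ψ-by _ _ (no _) (no _) = 0

          ψ : Fin n → Fin n → ℕ
          ψ u v = ψ-by u v (joins? u v) (cedge? u v)

          ψ-tree : ∀ {u v z} → Joins u v z → ψ u v ≡ φ z
          ψ-tree {u} {v} {z} p = go (joins? u v)
            where
            go : ∀ d → ψ-by u v d (cedge? u v) ≡ φ z
            go (yes (_ , q)) = cong φ (joins-unique q p)
            go (no none) = contradiction (z , p) none

          -- No conflict with the tree edges, which take precedence in `ψ-by`: both ends of an edge
          -- of the cycle are leaves, while the upper end of a tree edge is not.
          ψ-cycle : ∀ {u v i} → CEdgeAt u v i → ψ u v ≡ s i
          ψ-cycle {u} {v} {i} p = go (joins? u v) (cedge? u v)
            where
            go : ∀ d d′ → ψ-by u v d d′ ≡ s i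
            go (yes (z , z≢r , inj₁ (_ , e))) _ = contradiction (subst (IsLeaf G) (sym e) (proj₂ (cedge-leaf p))) (parent-inner z≢r)
            go (yes (z , z≢r , inj₂ (_ , e))) _ = contradiction (subst (IsLeaf G) (sym e) (proj₁ (cedge-leaf p))) (parent-inner z≢r)
            go (no _) (yes (_ , q)) = cong s (cedge-unique q p)
            go (no _) (no none) = contradiction (i , p) none

        via : ∀ {v x} → Adj G v x → ∃ (Joins v x)
        via a = [ (λ (v≢r , e) → _ , v≢r , inj₁ (refl , e)) , (λ (x≢r , e) → _ , x≢r , inj₂ (refl , e)) ]′ (edge a)

        joins-incident : ∀ {v x e} → Joins v x e → Incident v e
        joins-incident (ne , inj₁ (e , _)) = ne , inj₁ e
        joins-incident (ne , inj₂ (_ , e)) = ne , inj₂ e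

        joins-swap : ∀ {v x e} → Joins v x e → Joins x v e
        joins-swap (ne , inj₁ p) = ne , inj₂ p
        joins-swap (ne , inj₂ p) = ne , inj₁ p

        joins-end : ∀ {v x y e} → Joins v x e → Joins v y e → x ≡ y
        joins-end (_ , inj₁ (_ , p)) (_ , inj₁ (_ , q)) = trans (sym p) q
        joins-end (_ , inj₂ (p , _)) (_ , inj₂ (q , _)) = trans (sym p) q
        joins-end (ne , inj₁ (refl , _)) (_ , inj₂ (_ , q)) = contradiction (sym q) (Adj⇒≢ G (par-adj ne))
        joins-end (_ , inj₂ (_ , q)) (ne , inj₁ (refl , _)) = contradiction (sym q) (Adj⇒≢ G (par-adj ne))

        incident-distinct : ∀ {u e f} → Incident u e → Incident u f → e ≢ f → φ e ≢ φ f
        incident-distinct (_ , inj₁ refl) (_ , inj₁ refl) ne = contradiction refl ne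
        incident-distinct (e≢r , inj₁ refl) (f≢r , inj₂ refl) ne = λ q → Φ.parent f≢r e≢r (sym q)
        incident-distinct (e≢r , inj₂ refl) (f≢r , inj₁ refl) ne = Φ.parent e≢r f≢r
        incident-distinct (e≢r , inj₂ p) (f≢r , inj₂ q) ne = Φ.siblings e≢r f≢r (trans p (sym q)) ne

        data LeafEdge (i : Fin (3 + k)) (x : Fin n) : Set where
          stem : x ≡ par (c i) → ψ (c i) x ≡ φ (c i) → LeafEdge i x
          next : x ≡ c (csuc i) → ψ (c i) x ≡ s i → LeafEdge i x
          prev : x ≡ c (cpred i) → ψ (c i) x ≡ s (cpred i) → LeafEdge i x

        leaf-edge : ∀ {i x} → Adj H (c i) x → LeafEdge i x
        leaf-edge {i} {x} a = go (at-leaf a)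
          where
          go : Adj G (c i) x ⊎ x ≡ c (csuc i) ⊎ x ≡ c (cpred i) → LeafEdge i x
          go (inj₁ b) = stem (leaf-par b) (ψ-tree (leaf≢r i , inj₁ (refl , sym (leaf-par b))))
          go (inj₂ (inj₁ e)) = next e (ψ-cycle (inj₁ (refl , sym e)))
          go (inj₂ (inj₂ e)) = prev e (ψ-cycle (inj₂ (sym e , cong c (csuc-cpred i))))

        cedge-swap : ∀ {u v i} → CEdgeAt u v i → CEdgeAt v u i
        cedge-swap (inj₁ p) = inj₂ p
        cedge-swap (inj₂ p) = inj₁ p

        ψ-sym : ∀ u v → Adj H u v → ψ u v ≡ ψ v u
        ψ-sym u v a = [ (λ b → trans (ψ-tree (proj₂ (via b))) (sym (ψ-tree (joins-swap (proj₂ (via b))))))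
                      , (λ (i , p) → trans (ψ-cycle p) (sym (ψ-cycle (cedge-swap p)))) ]′ (proj₁ (H-edges u v) a)

        cycle-listed : ∀ {u v} i → CEdgeAt u v i → s i ∈ L u v
        cycle-listed i (inj₁ (refl , refl)) = s-∈ i
        cycle-listed i (inj₂ (refl , refl)) = subst (s i ∈_) (L-sym (c i) (c (csuc i)) (cycle⇒H i)) (s-∈ i)

        tree-listed : ∀ {u v z} → Joins u v z → φ z ∈ L u v
        tree-listed (z≢r , inj₁ (refl , refl)) = Φ.listed z≢r
        tree-listed {z = z} (z≢r , inj₂ (refl , refl)) = subst (φ z ∈_) (L-sym z (par z) (tree⇒H (par-adj z≢r))) (Φ.listed z≢r)

        ψ-listed : ∀ u v → Adj H u v → ψ u v ∈ L u v
        ψ-listed u v a = [ (λ b → subst (_∈ L u v) (sym (ψ-tree (proj₂ (via b)))) (tree-listed (proj₂ (via b))))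
                         , (λ (i , p) → subst (_∈ L u v) (sym (ψ-cycle p)) (cycle-listed i p)) ]′ (proj₁ (H-edges u v) a)

        s-prev≢ : ∀ i → s (cpred i) ≢ s i
        s-prev≢ i e = proj₁ (s-star (cpred i)) (trans e (cong s (sym (csuc-cpred i))))

        s≢own : ∀ i → s i ≢ φ (c i)
        s≢own i = s≢start i (here refl)

        sp≢ : ∀ i {x} → x ∈ blocked (c i) → s (cpred i) ≢ φ x
        sp≢ i {x} x∈ = s≢end (cpred i) (subst (λ j → x ∈ blocked (c j)) (sym (csuc-cpred i)) x∈)

        proper-leaf : ∀ {i v w} → LeafEdge i v → LeafEdge i w → v ≢ w → ψ (c i) v ≢ ψ (c i) w
        proper-leaf (stem p _) (stem p′ _) v≢w = contradiction (trans p (sym p′)) v≢w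
        proper-leaf (next p _) (next p′ _) v≢w = contradiction (trans p (sym p′)) v≢w
        proper-leaf (prev p _) (prev p′ _) v≢w = contradiction (trans p (sym p′)) v≢w
        proper-leaf {i} (stem _ q) (next _ q′) _ e = s≢own i (trans (sym q′) (trans (sym e) q))
        proper-leaf {i} (next _ q) (stem _ q′) _ e = s≢own i (trans (sym q) (trans e q′))
        proper-leaf {i} (stem _ q) (prev _ q′) _ e = sp≢ i (here refl) (trans (sym q′) (trans (sym e) q))
        proper-leaf {i} (prev _ q) (stem _ q′) _ e = sp≢ i (here refl) (trans (sym q) (trans e q′))
        proper-leaf {i} (next _ q) (prev _ q′) _ e = s-prev≢ i (trans (sym q′) (trans (sym e) q))
        proper-leaf {i} (prev _ q) (next _ q′) _ e = s-prev≢ i (trans (sym q) (trans e q′))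

        proper-inner : ∀ {u v w e f} → Joins u v e → Joins u w f → v ≢ w → ψ u v ≢ ψ u w
        proper-inner {u} {v} je jf v≢w q = incident-distinct (joins-incident je) (joins-incident jf)
          (λ e≡f → v≢w (joins-end je (subst (Joins u _) (sym e≡f) jf))) (trans (sym (ψ-tree je)) (trans q (ψ-tree jf)))

        LeafIndex : Fin n → Set
        LeafIndex v = ∃ λ i → c i ≡ v

        kind : ∀ v → LeafIndex v ⊎ ¬ IsLeaf G v
        kind v = go (leaf? G v)
          where
          go : Dec (IsLeaf G v) → LeafIndex v ⊎ ¬ IsLeaf G v
          go (yes l) = inj₁ (c-all v l)
          go (no inner) = inj₂ inner

        ψ-proper : Proper H ψ
        ψ-proper u v w a b v≢w = go (kind u)
          where
          go : LeafIndex u ⊎ ¬ IsLeaf G u → ψ u v ≢ ψ u w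
          go (inj₁ (i , refl)) = proper-leaf (leaf-edge a) (leaf-edge b) v≢w
          go (inj₂ inner) = proper-inner (proj₂ (via (at-inner inner a))) (proj₂ (via (at-inner inner b))) v≢w

        loses-leaf : ∀ {i f x} → Incident (par (c i)) f → Threat (c i) f → LeafEdge i x → x ≢ par (c i) → ψ (c i) x ≢ φ f
        loses-leaf _ _ (stem e _) x≢p _ = x≢p e
        loses-leaf {i} inc th (next _ q) _ q′ = s≢start i (there (threats⁺ inc th)) (trans (sym q) q′)
        loses-leaf {i} inc th (prev _ q) _ q′ = sp≢ i (there (threats⁺ inc th)) (trans (sym q) q′)

        loses-child : ∀ {b f x g} → b ≢ r → Incident (par b) f → Threat b f → Joins b x g → x ≢ par b → ψ b x ≢ φ f
        loses-child b≢r inc th (_ , inj₁ (refl , e)) x≢p _ = x≢p (sym e)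
        loses-child b≢r inc th j@(x≢r , inj₂ (refl , refl)) _ q = Φ.threat x≢r b≢r inc th (trans (sym (ψ-tree j)) q)

        not-In-0 : ¬ In t 0 0
        not-In-0 (inj₁ (() , _))
        not-In-0 (inj₂ ())

        loses-parent : ∀ {p f x g} → p ≢ r → Incident p f → In t 0 (posAt p f) → Joins (par p) x g → ψ (par p) x ≢ φ f
        loses-parent {p} _ (_ , inj₁ refl) i _ _ = not-In-0 (subst (In t 0) (TC.posAt-self p) i)
        loses-parent p≢r (f≢r , inj₂ refl) i jg q = Φ.top f≢r p≢r (subst (In t 0) (TC.posAt-child f≢r) i) (joins-incident jg)
          (trans (sym q) (ψ-tree jg))

        -- Three sources: if `b` is a leaf below `p`, the further edges at `b` lie on the cycle and
        -- avoid its threats; if `b` is an inner child, `threat` applies; if `b` is the parent of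
        -- `p`, `top` does.
        loses : ∀ {p b e f x} → Joins p b e → Incident p f → In t (posAt p e) (posAt p f) → Adj H b x → x ≢ p → ψ b x ≢ φ f
        loses {p} {b} {_} {f} {x} (b≢r , inj₂ (refl , refl)) inc i a x≢p = go (kind b)
          where
          th : Threat b f
          th = subst (λ q → In t q (posAt (par b) f)) (TC.posAt-child b≢r) i
          go : LeafIndex b ⊎ ¬ IsLeaf G b → ψ b x ≢ φ f
          go (inj₁ (j , refl)) = loses-leaf inc th (leaf-edge a) x≢p
          go (inj₂ inner) = loses-child b≢r inc th (proj₂ (via (at-inner inner a))) x≢p
        loses {p} {f = f} (p≢r , inj₁ (refl , refl)) inc i a _ =
          loses-parent p≢r inc (subst (λ q → In t q (posAt p f)) (TC.posAt-self p) i) (proj₂ (via (at-inner (parent-inner p≢r) a)))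

        -- Meant for paths centred at `c i` that use its stem and the edge to its successor. Beyond
        -- the successor lie another stem, settled by `consecutive`, and an edge of the cycle that
        -- avoids the stem just before it.
        next-stem : ∀ {i x} → LeafEdge (csuc i) x → x ≢ c i → ψ (c (csuc i)) x ≢ φ (c i)
        next-stem {i} (stem _ q) _ e = consecutive i (trans (sym e) q)
        next-stem {i} (next _ q) _ e = s≢before (csuc i) (trans (sym q) (trans e (cong (φ ∘ c) (sym (cpred-csuc i)))))
        next-stem {i} (prev p _) x≢ _ = x≢ (trans p (cong c (cpred-csuc i)))

        prev-stem : ∀ {i x} → LeafEdge (cpred i) x → x ≢ c i → ψ (c (cpred i)) x ≢ φ (c i)
        prev-stem {i} (stem _ q) _ e = consecutive (cpred i) (trans (sym q) (trans e (cong (φ ∘ c) (sym (csuc-cpred i)))))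
        prev-stem {i} (next p _) x≢ _ = x≢ (trans p (cong c (csuc-cpred i)))
        prev-stem {i} (prev _ q) _ e = s≢after (cpred (cpred i)) (trans (sym q) (trans e (cong (φ ∘ c) (sym
                          (trans (cong csuc (csuc-cpred (cpred i))) (csuc-cpred i))))))

        -- Meant for paths centred at `c i` whose middle edges both lie on the cycle: leaving along
        -- the next stem is ruled out by `s≢after`, so the outer edge lies on the cycle as well.
        beyond-next : ∀ {i x} → LeafEdge (csuc i) x → x ≢ c i → ψ (c (csuc i)) x ≡ s (cpred i) → s (csuc i) ≡ s (cpred i)
        beyond-next {i} (stem _ q) _ e = contradiction (trans (sym e) (trans q (cong (φ ∘ c) (cong csuc (sym (csuc-cpred i)))))) (s≢after (cpred i))
        beyond-next (next _ q) _ e = trans (sym q) e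
        beyond-next {i} (prev p _) x≢ _ = contradiction (trans p (cong c (cpred-csuc i))) x≢

        beyond-prev : ∀ {i x} → LeafEdge (cpred i) x → x ≢ c i → ψ (c (cpred i)) x ≡ s i → s (cpred (cpred i)) ≡ s i
        beyond-prev {i} (stem _ q) _ e = contradiction (trans (sym e) q) (s≢before i)
        beyond-prev {i} (next p _) x≢ _ = contradiction (trans p (cong c (csuc-cpred i))) x≢
        beyond-prev (prev _ q) _ e = trans (sym q) e

        -- All four edges now lie on the cycle, and they form the window that starts two edges
        -- before `i`.
        no-alternation : ∀ i → s (cpred (cpred i)) ≡ s i → s (csuc i) ≡ s (cpred i) → ⊥
        no-alternation i e e′ = proj₂ (s-star j) (trans e (cong s (sym e₂)) , trans (cong s e₁) (trans (sym e′) (cong s (cong csuc (sym e₂)))))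
          where
          j = cpred (cpred i)
          e₁ : csuc j ≡ cpred i
          e₁ = csuc-cpred (cpred i)
          e₂ : csuc (csuc j) ≡ i
          e₂ = trans (cong csuc e₁) (csuc-cpred i)

        centre-leaf : ∀ {i x y v w} → LeafEdge i v → LeafEdge i w → v ≢ w → Adj H v x → Adj H w y → x ≢ c i → y ≢ c i →
                      ψ v x ≡ ψ (c i) w → ψ w y ≡ ψ (c i) v → ⊥
        centre-leaf (stem e _) (stem e′ _) v≢w _ _ _ _ _ _ = v≢w (trans e (sym e′))
        centre-leaf (next e _) (next e′ _) v≢w _ _ _ _ _ _ = v≢w (trans e (sym e′))
        centre-leaf (prev e _) (prev e′ _) v≢w _ _ _ _ _ _ = v≢w (trans e (sym e′))
        centre-leaf (stem _ e) (next refl _) _ _ b _ y≢ _ q = next-stem (leaf-edge b) y≢ (trans q e)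
        centre-leaf (stem _ e) (prev refl _) _ _ b _ y≢ _ q = prev-stem (leaf-edge b) y≢ (trans q e)
        centre-leaf (next refl _) (stem _ e) _ a _ x≢ _ p _ = next-stem (leaf-edge a) x≢ (trans p e)
        centre-leaf (prev refl _) (stem _ e) _ a _ x≢ _ p _ = prev-stem (leaf-edge a) x≢ (trans p e)
        centre-leaf {i} (next refl e) (prev refl e′) _ a b x≢ y≢ p q = no-alternation i
          (beyond-prev (leaf-edge b) y≢ (trans q e)) (beyond-next (leaf-edge a) x≢ (trans p e′))
        centre-leaf {i} (prev refl e) (next refl e′) _ a b x≢ y≢ p q = no-alternation i
          (beyond-prev (leaf-edge a) x≢ (trans p e′)) (beyond-next (leaf-edge b) y≢ (trans q e))

        -- One of the two middle edges loses to the other, and the outer edge on the losing side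
        -- cannot repeat the colour of the winner.
        centre-inner : ∀ {u v w x y e f} → Joins u v e → Joins u w f → v ≢ w → Adj H v x → Adj H w y → x ≢ u → y ≢ u →
                       ψ v x ≡ ψ u w → ψ w y ≡ ψ u v → ⊥
        centre-inner {u} je jf v≢w a b x≢ y≢ p q =
          [ (λ i → loses je (joins-incident jf) i a x≢ (trans p (ψ-tree jf)))
          , (λ i → loses jf (joins-incident je) i b y≢ (trans q (ψ-tree je))) ]′
          (In-total t (λ pe → v≢w (joins-end je (subst (Joins u _) (sym (TC.posAt-injective (joins-incident je) (joins-incident jf) pe)) jf))))

        ψ-no4 : NoBichromatic4 H ψ
        ψ-no4 v0 v1 v2 v3 v4 a01 a12 a23 a34 v0≢v2 _ v1≢v3 _ v2≢v4 (p , q) = go (kind v2)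
          where
          p′ : ψ v1 v0 ≡ ψ v2 v3
          p′ = trans (sym (ψ-sym v0 v1 a01)) p
          q′ : ψ v3 v4 ≡ ψ v2 v1
          q′ = trans (sym q) (ψ-sym v1 v2 a12)
          go : LeafIndex v2 ⊎ ¬ IsLeaf G v2 → ⊥
          go (inj₁ (i , refl)) = centre-leaf (leaf-edge (Adj-sym H a12)) (leaf-edge a23) v1≢v3 (Adj-sym H a01) a34 v0≢v2 (≢-sym v2≢v4) p′ q′
          go (inj₂ inner) = centre-inner (proj₂ (via (at-inner inner (Adj-sym H a12)))) (proj₂ (via (at-inner inner a23))) v1≢v3
            (Adj-sym H a01) a34 v0≢v2 (≢-sym v2≢v4) p′ q′

        coloured : Result
        coloured = ψ , ψ-sym , ψ-listed , ψ-proper , ψ-no4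

      coloured : Result
      coloured = Cycle.coloured (proj₁ cycle-colouring) (proj₁ (proj₂ cycle-colouring)) (proj₂ (proj₂ cycle-colouring))

    coloured : Result
    coloured = Tree.coloured (proj₁ tree-colouring) (proj₂ tree-colouring)

  choosable : StarChoosable H (D + t)
  choosable = Coloured.coloured

3D/2 : ∀ D → (3 * D) / 2 ≡ D + D / 2
3D/2 D = trans (cong (_/ 2) (trans (cong (D +_) (cong (D +_) (+-identityʳ D))) (trans (sym (+-assoc D D D)) (cong (_+ D) (trans (cong (D +_) (sym (+-identityʳ D))) (*-comm 2 D))))))
           (trans (+-distrib-/-∣ˡ D (divides D refl)) (cong (_+ D / 2) (m*n/n≡m D 2)))

halin-choosable : ∀ {n} (H : Graph n) {D} → IsGenHalin H → MaxDegree H D → 13 ≤ D → StarChoosable H ((3 * D) / 2)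
halin-choosable H {D} (G , tree , _ , rot , isRot , k , c , c-inj , c-leaf , c-all , order , H-edges) (deg≤D , r , deg-r) 13≤D =
  subst (StarChoosable H) (sym (3D/2 D))
    (HalinGraph.choosable H G rot isRot k c c-inj c-leaf c-all order H-edges D deg≤D 13≤D r deg-r
      (RootedTree.rooting G (proj₂ tree) r (proj₁ tree)))

-- Existence of the index: choosability is decidable.

least : {P : ℕ → Set} → (∀ k → Dec (P k)) → ∀ {B} → P B → ∃ λ m → P m × m ≤ B × (∀ k → P k → m ≤ k)
least {P} P? {B} pB = go 0 B refl (λ _ ())
  where
  go : ∀ b fuel → b + fuel ≡ B → (∀ k → k < b → ¬ P k) → ∃ λ m → P m × m ≤ B × (∀ k → P k → m ≤ k)
  go b fuel e below with P? b
  ... | yes p = b , p , ≤-trans (m≤m+n b fuel) (≤-reflexive e) , λ k pk → ≮⇒≥ (λ lt → below k lt pk)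
  go b zero e below | no ¬p = contradiction (subst P (trans (sym e) (+-identityʳ b)) pB) ¬p
  go b (suc fuel) e below | no ¬p = go (suc b) fuel (trans (sym (+-suc b fuel)) e) λ k lt pk →
    [ (λ lt′ → below k lt′ pk) , (λ { refl → ¬p pk }) ]′ (m≤n⇒m<n∨m≡n (≤-pred lt))

Searchable : Set → Set₁
Searchable A = {P : A → Set} → (∀ a → Dec (P a)) → Dec (∃ P)

search-all : {A : Set} → Searchable A → {P : A → Set} → (∀ a → Dec (P a)) → Dec (∀ a → P a)
search-all search P? with search (λ a → ¬? (P? a))
... | yes (a , ¬p) = no (λ f → ¬p (f a))
... | no none = yes (λ a → decidable-stable (P? a) (λ ¬p → none (a , ¬p)))

search-Vec : {A : Set} → Searchable A → ∀ n → Searchable (Vec A n)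
search-Vec search zero P? = map′ ([] ,_) (λ { ([] , p) → p }) (P? [])
search-Vec search (suc n) P? = map′ (λ (a , v , p) → a ∷ v , p) (λ { (a ∷ v , p) → a , v , p })
  (search (λ a → search-Vec search n (λ v → P? (a ∷ v))))

nth-injective : ∀ {l} → Unique l → ∀ {i j} → i < length l → j < length l → nth l i ≡ nth l j → i ≡ j
nth-injective (_ ∷ _) {zero} {zero} _ _ _ = refl
nth-injective {x ∷ l} (x∉ ∷ _) {zero} {suc j} _ (s≤s lt) e = contradiction e (All.lookup x∉ (nth-∈ l lt))
nth-injective {x ∷ l} (x∉ ∷ _) {suc i} {zero} (s≤s lt) _ e = contradiction (sym e) (All.lookup x∉ (nth-∈ l lt))
nth-injective (_ ∷ u) {suc i} {suc j} (s≤s p) (s≤s q) e = cong suc (nth-injective u p q e)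

-- At most n²k colours matter, so choosability can be tested with lists of
-- exactly k colours from a fixed finite palette.
module _ {n} (G : Graph n) (k : ℕ) where

  private
    -- One name for each ordered pair of vertices and list position, and one spare name as default.
    N : ℕ
    N = suc (n * n * k)

    Colours : Set
    Colours = Vec (Fin N) k
    Table : Set → Set
    Table A = Vec (Vec A n) n

    cell : {A : Set} → Table A → Fin n → Fin n → A
    cell t u v = Vec.lookup (Vec.lookup t u) v

    table : {A : Set} → (Fin n → Fin n → A) → Table A
    table f = Vec.tabulate (λ u → Vec.tabulate (f u))

    cell-table : {A : Set} (f : Fin n → Fin n → A) → ∀ u v → cell (table f) u v ≡ f u v
    cell-table f u v = trans (cong (λ r → Vec.lookup r v) (lookup∘tabulate (λ u → Vec.tabulate (f u)) u)) (lookup∘tabulate (f u) v)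

    Solves : Table Colours → Table (Fin N) → Set
    Solves L φ = (∀ u v → Adj G u v → cell φ u v ≡ cell φ v u) ×
                 (∀ u v → Adj G u v → ∃ λ i → Vec.lookup (cell L u v) i ≡ cell φ u v) ×
                 IsStarEdgeColoring G (λ u v → toℕ (cell φ u v))

    Admissible : Table Colours → Set
    Admissible L = (∀ u v → Adj G u v → cell L u v ≡ cell L v u) ×
                   (∀ u v → Adj G u v → ∀ i j → Vec.lookup (cell L u v) i ≡ Vec.lookup (cell L u v) j → i ≡ j)

    Finitely : Set
    Finitely = ∀ L → Admissible L → ∃ (Solves L)

    ∀? : ∀ {m} {P : Fin m → Set} → (∀ a → Dec (P a)) → Dec (∀ a → P a)
    ∀? = Finₚ.all?

    adj? : ∀ u v → Dec (Adj G u v)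
    adj? u v = T? (adj G u v)

    solves? : ∀ L φ → Dec (Solves L φ)
    solves? L φ =
      (∀? λ u → ∀? λ v → adj? u v →-dec (cell φ u v Finₚ.≟ cell φ v u)) ×-dec
      ((∀? λ u → ∀? λ v → adj? u v →-dec Finₚ.any? λ i → Vec.lookup (cell L u v) i Finₚ.≟ cell φ u v) ×-dec
      ((∀? λ u → ∀? λ v → ∀? λ w → adj? u v →-dec (adj? u w →-dec (¬? (v Finₚ.≟ w) →-dec ¬? (toℕ (cell φ u v) ≟ toℕ (cell φ u w))))) ×-dec
      (∀? λ v0 → ∀? λ v1 → ∀? λ v2 → ∀? λ v3 → ∀? λ v4 →
        adj? v0 v1 →-dec (adj? v1 v2 →-dec (adj? v2 v3 →-dec (adj? v3 v4 →-dec
        (¬? (v0 Finₚ.≟ v2) →-dec (¬? (v0 Finₚ.≟ v3) →-dec (¬? (v1 Finₚ.≟ v3) →-dec (¬? (v1 Finₚ.≟ v4) →-dec (¬? (v2 Finₚ.≟ v4) →-dec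
        ¬? ((toℕ (cell φ v0 v1) ≟ toℕ (cell φ v2 v3)) ×-dec (toℕ (cell φ v1 v2) ≟ toℕ (cell φ v3 v4))))))))))))))

    admissible? : ∀ L → Dec (Admissible L)
    admissible? L =
      (∀? λ u → ∀? λ v → adj? u v →-dec Vecₚ.≡-dec Finₚ._≟_ (cell L u v) (cell L v u)) ×-dec
      (∀? λ u → ∀? λ v → adj? u v →-dec (∀? λ i → ∀? λ j →
        (Vec.lookup (cell L u v) i Finₚ.≟ Vec.lookup (cell L u v) j) →-dec (i Finₚ.≟ j)))

    search-table : {A : Set} → Searchable A → Searchable (Table A)
    search-table s = search-Vec (search-Vec s n) n

    finitely? : Dec Finitely
    finitely? = search-all (search-table (search-Vec Finₚ.any? k)) λ L → admissible? L →-dec search-table Finₚ.any? (solves? L)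

    toList-unique : ∀ {m} (v : Vec (Fin N) m) → (∀ i j → Vec.lookup v i ≡ Vec.lookup v j → i ≡ j) → Unique (Vec.toList v)
    toList-unique [] _ = []
    toList-unique (x ∷ v) inj = All.tabulate fresh ∷ toList-unique v (λ i j e → Finₚ.suc-injective (inj (suc i) (suc j) e))
      where
      fresh : ∀ {y} → y ∈ Vec.toList v → x ≢ y
      fresh y∈ e = Finₚ.0≢1+n (inj zero (suc (VAny.index (∈-toList⁻ y∈))) (trans e (VAnyₚ.lookup-index (∈-toList⁻ y∈))))

    module ToFinite (L : Table Colours) (adm : Admissible L) where
      Lℕ : Fin n → Fin n → List ℕ
      Lℕ u v = map toℕ (Vec.toList (cell L u v))

      Lℕ-list : ∀ u v → Adj G u v → Unique (Lℕ u v) × k ≤ length (Lℕ u v)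
      Lℕ-list u v a = map-unique toℕ (λ _ _ → Finₚ.toℕ-injective) (toList-unique (cell L u v) (proj₂ adm u v a)) ,
        ≤-reflexive (sym (trans (length-map toℕ (Vec.toList (cell L u v))) (Vecₚ.length-toList (cell L u v))))

      module _ (φ : Fin n → Fin n → ℕ) (φ-sym : ∀ u v → Adj G u v → φ u v ≡ φ v u)
               (φ∈ : ∀ u v → Adj G u v → φ u v ∈ Lℕ u v) (star : IsStarEdgeColoring G φ) where

        named : ∀ {u v} → φ u v ∈ Lℕ u v → ∃ λ i → toℕ (Vec.lookup (cell L u v) i) ≡ φ u v
        named {u} {v} p with ∈-map⁻ toℕ p
        ... | y , y∈ , e = VAny.index (∈-toList⁻ y∈) , trans (cong toℕ (sym (VAnyₚ.lookup-index (∈-toList⁻ y∈)))) (sym e)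

        pick-name : ∀ u v → Dec (Adj G u v) → Fin N
        pick-name u v (yes a) = Vec.lookup (cell L u v) (proj₁ (named (φ∈ u v a)))
        pick-name u v (no _) = zero

        f : Table (Fin N)
        f = table (λ u v → pick-name u v (adj? u v))

        pick-spec : ∀ {u v} d → Adj G u v → ∃ λ i → Vec.lookup (cell L u v) i ≡ pick-name u v d × toℕ (pick-name u v d) ≡ φ u v
        pick-spec {u} {v} (yes a) _ = proj₁ (named (φ∈ u v a)) , refl , proj₂ (named (φ∈ u v a))
        pick-spec (no ¬a) a = contradiction a ¬a

        f-spec : ∀ {u v} → Adj G u v → ∃ λ i → Vec.lookup (cell L u v) i ≡ cell f u v × toℕ (cell f u v) ≡ φ u v
        f-spec {u} {v} a = subst (λ y → ∃ λ i → Vec.lookup (cell L u v) i ≡ y × toℕ y ≡ φ u v) (sym (cell-table _ u v))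
                             (pick-spec (adj? u v) a)

        val : ∀ {u v} → Adj G u v → toℕ (cell f u v) ≡ φ u v
        val a = proj₂ (proj₂ (f-spec a))

        solves : Solves L f
        solves = (λ u v a → Finₚ.toℕ-injective (trans (val a) (trans (φ-sym u v a) (sym (val (Adj-sym G a)))))) ,
          (λ u v a → proj₁ (f-spec a) , proj₁ (proj₂ (f-spec a))) ,
          (λ u v w a b ne e → proj₁ star u v w a b ne (trans (sym (val a)) (trans e (val b)))) ,
          λ v0 v1 v2 v3 v4 a b c d n1 n2 n3 n4 n5 (e , e′) → proj₂ star v0 v1 v2 v3 v4 a b c d n1 n2 n3 n4 n5
            (trans (sym (val a)) (trans e (val c)) , trans (sym (val b)) (trans e′ (val d)))

    to-finite : StarChoosable G k → Finitely
    to-finite ch L adm = f φ φ-sym φ∈ star , solves φ φ-sym φ∈ star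
      where
      open ToFinite L adm
      given = ch Lℕ (λ u v a → cong (map toℕ ∘ Vec.toList) (proj₁ adm u v a)) Lℕ-list
      φ = proj₁ given
      φ-sym = proj₁ (proj₂ given)
      φ∈ = proj₁ (proj₂ (proj₂ given))
      star = proj₂ (proj₂ (proj₂ given))

    module FromFinite (L : Fin n → Fin n → List ℕ) (L-sym : ∀ u v → Adj G u v → L u v ≡ L v u)
                      (L-list : ∀ u v → Adj G u v → Unique (L u v) × k ≤ length (L u v)) where
      colour : Fin n → Fin n → Fin k → ℕ
      colour u v i = nth (L u v) (toℕ i)

      palette : Fin N → ℕ
      palette zero = 0
      palette (suc j) = uncurry (λ uv i → uncurry colour (Fin.remQuot n uv) i) (Fin.remQuot {n * n} k j)

      -- A colour occurring in several lists has several names in `palette`. The search depends on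
      -- the colour alone, so all its occurrences receive the same name, and equality of colours can
      -- be read off from names.
      name : ℕ → Fin N
      name x with Finₚ.any? (λ j → palette j ≟ x)
      ... | yes (j , _) = j
      ... | no _ = zero

      palette-colour : ∀ u v i → palette (suc (Fin.combine (Fin.combine u v) i)) ≡ colour u v i
      palette-colour u v i = trans
        (cong (uncurry (λ uv i → uncurry colour (Fin.remQuot n uv) i)) (Finₚ.remQuot-combine (Fin.combine u v) i))
        (cong (λ p → uncurry colour p i) (Finₚ.remQuot-combine u v))

      palette-name : ∀ u v i → palette (name (colour u v i)) ≡ colour u v i
      palette-name u v i with Finₚ.any? (λ j → palette j ≟ colour u v i)
      ... | yes (_ , e) = e
      ... | no none = contradiction (_ , palette-colour u v i) none

      names : List ℕ → Colours
      names l = Vec.tabulate (λ i → name (nth l (toℕ i)))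

      L̂ : Table Colours
      L̂ = table (λ u v → names (L u v))

      L̂-lookup : ∀ u v i → Vec.lookup (cell L̂ u v) i ≡ name (colour u v i)
      L̂-lookup u v i = trans (cong (λ w → Vec.lookup w i) (cell-table (λ u v → names (L u v)) u v))
                         (lookup∘tabulate (λ i → name (nth (L u v) (toℕ i))) i)

      in-range : ∀ {u v} → Adj G u v → ∀ i → toℕ {k} i < length (L u v)
      in-range a i = ≤-trans (Finₚ.toℕ<n i) (proj₂ (L-list _ _ a))

      admissible : Admissible L̂
      admissible = (λ u v a → trans (cell-table _ u v) (trans (cong names (L-sym u v a)) (sym (cell-table _ v u)))) ,
        λ u v a i j e → Finₚ.toℕ-injective (nth-injective (proj₁ (L-list u v a)) (in-range a i) (in-range a j)
          (trans (sym (palette-name u v i)) (trans (cong palette (trans (sym (L̂-lookup u v i)) (trans e (L̂-lookup u v j)))) (palette-name u v j))))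

      module _ (t : Table (Fin N)) (solved : Solves L̂ t) where
        φ : Fin n → Fin n → ℕ
        φ u v = palette (cell t u v)

        index-of : ∀ {u v} → Adj G u v → Fin k
        index-of {u} {v} a = proj₁ (proj₁ (proj₂ solved) u v a)

        t-value : ∀ {u v} (a : Adj G u v) → cell t u v ≡ name (colour u v (index-of a))
        t-value {u} {v} a = trans (sym (proj₂ (proj₁ (proj₂ solved) u v a))) (L̂-lookup u v (index-of a))

        φ-value : ∀ {u v} (a : Adj G u v) → φ u v ≡ colour u v (index-of a)
        φ-value {u} {v} a = trans (cong palette (t-value a)) (palette-name u v (index-of a))

        reflects : ∀ {u v w x} → Adj G u v → Adj G w x → φ u v ≡ φ w x → toℕ (cell t u v) ≡ toℕ (cell t w x)
        reflects a b e = cong toℕ (trans (t-value a) (trans (cong name (trans (sym (φ-value a)) (trans e (φ-value b)))) (sym (t-value b))))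

        φ∈ : ∀ u v → Adj G u v → φ u v ∈ L u v
        φ∈ u v a = subst (_∈ L u v) (sym (φ-value a)) (nth-∈ (L u v) (in-range a (index-of a)))

        star : IsStarEdgeColoring G φ
        star = (λ u v w a b ne e → proj₁ (proj₂ (proj₂ solved)) u v w a b ne (reflects a b e)) ,
          λ v0 v1 v2 v3 v4 a b c d n1 n2 n3 n4 n5 (e , e′) → proj₂ (proj₂ (proj₂ solved)) v0 v1 v2 v3 v4 a b c d n1 n2 n3 n4 n5
            (reflects a c e , reflects b d e′)

        φ-sym : ∀ u v → Adj G u v → φ u v ≡ φ v u
        φ-sym u v a = cong palette (proj₁ solved u v a)

    from-finite : Finitely → StarChoosable G k
    from-finite fin L L-sym L-list = φ t solved , φ-sym t solved , φ∈ t solved , star t solved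
      where
      open FromFinite L L-sym L-list
      t = proj₁ (fin L̂ admissible)
      solved = proj₂ (fin L̂ admissible)

  abstract
    StarChoosable? : Dec (StarChoosable G k)
    StarChoosable? = map′ from-finite to-finite finitely?

star-index-exists : ∀ {n} (G : Graph n) {B} → StarChoosable G B → ∃ λ m → IsListStarChromaticIndex G m × m ≤ B
star-index-exists G p = let m , pm , m≤B , min = least (StarChoosable? G) p in m , (pm , min) , m≤B

-- The extremal graph.

module FromRelation {n} (E : Fin n → Fin n → Set) (E? : ∀ u v → Dec (E u v))
                    (E-sym : ∀ {u v} → E u v → E v u) (E-irrefl : ∀ {v} → ¬ E v v) where

  abstract
    graph : Graph n
    graph = record
      { adj = λ u v → does (E? u v)
      ; sym = λ u v → does-⇔ (mk⇔ E-sym E-sym) (E? u v) (E? v u)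
      ; irrefl = λ v → dec-false (E? v v) E-irrefl }

    Adj⁻ : ∀ {u v} → Adj graph u v → E u v
    Adj⁻ {u} {v} a with E? u v
    ... | yes e = e

    Adj⁺ : ∀ {u v} → E u v → Adj graph u v
    Adj⁺ {u} {v} e with E? u v
    ... | yes _ = tt
    ... | no ¬e = ¬e e

walk-trans : ∀ {n} {G : Graph n} {u v w} → Walk G u v → Walk G v w → Walk G u w
walk-trans here q = q
walk-trans (step a p) q = step a (walk-trans p q)

walk-sym : ∀ {n} {G : Graph n} {u v} → Walk G u v → Walk G v u
walk-sym here = here
walk-sym {G = G} (step a p) = walk-trans (walk-sym p) (step (Adj-sym G a) here)

argmax : ∀ {m} (g : Fin (suc m) → ℕ) → ∃ λ i → ∀ j → g j ≤ g i
argmax {zero} g = zero , λ { zero → ≤-refl }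
argmax {suc m} g with argmax (g ∘ suc)
... | i , max with g zero ≤? g (suc i)
...   | yes le = suc i , λ { zero → le ; (suc j) → max j }
...   | no ≰ = zero , λ { zero → ≤-refl ; (suc j) → ≤-trans (max j) (<⇒≤ (≰⇒> ≰)) }

-- A deepest vertex of a cycle would have two parents.
rooting⇒tree : ∀ {n} {G : Graph n} {r} → Rooting G r → IsTree G
rooting⇒tree {n} {G} {r} R = (λ u v → walk-trans (climb n u (m≤m+n n 0)) (walk-sym (climb n v (m≤m+n n 0)))) , acyclic
  where
  open Rooting R
  climb : ∀ fuel v → n ≤ fuel + 0 → Walk G v r
  climb fuel v le = go fuel v (<⇒≤ (≤-trans (depth< v) (≤-trans le (≤-reflexive (+-identityʳ fuel)))))
    where
    go : ∀ fuel v → depth v ≤ fuel → Walk G v r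
    go fuel v le with v Finₚ.≟ r
    ... | yes refl = here
    go zero v le | no v≢r = contradiction (≤-trans (≤-reflexive (sym (depth-par v≢r))) le) λ ()
    go (suc fuel) v le | no v≢r = step (par-adj v≢r) (go fuel (par v) (≤-pred (≤-trans (≤-reflexive (sym (depth-par v≢r))) le)))
  acyclic : Acyclic G
  acyclic m f (f-inj , f-adj) with argmax (depth ∘ f)
  ... | i , max = csuc²≢ (cpred i) (trans (cong csuc (csuc-cpred i)) (f-inj (trans (sym up) down)))
    where
    to-par : ∀ {j} → Adj G (f i) (f j) → par (f i) ≡ f j
    to-par {j} a with edge a
    ... | inj₁ (_ , e) = e
    ... | inj₂ (ne , e) = contradiction (max j) (<⇒≱ (≤-reflexive (sym (trans (depth-par ne) (cong (suc ∘ depth) e)))))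
    up : par (f i) ≡ f (csuc i)
    up = to-par (f-adj i)
    down : par (f i) ≡ f (cpred i)
    down = to-par (Adj-sym G (subst (λ x → Adj G (f (cpred i)) (f x)) (csuc-cpred i) (f-adj (cpred i))))

csuc-reach : ∀ {k} (i j : Fin (suc k)) → ∃ λ l → iter (suc l) csuc i ≡ j
csuc-reach i j with csuc-to-zero i
... | l , e = toℕ j + l , trans (cong csuc (iter-+ (toℕ j) l)) (trans (sym (iter-shift (toℕ j) l)) (trans (cong (iter (toℕ j) csuc) e) (csuc-from-zero j)))
  where
  iter-+ : ∀ a b → iter (a + b) csuc i ≡ iter a csuc (iter b csuc i)
  iter-+ zero b = refl
  iter-+ (suc a) b = cong csuc (iter-+ a b)
  iter-shift : ∀ a b → iter a csuc (csuc (iter b csuc i)) ≡ csuc (iter a csuc (iter b csuc i))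
  iter-shift a b = sym (iter-suc csuc a (iter b csuc i))

csuc-combine-< : ∀ {m n} (i : Fin m) (j : Fin n) → suc (toℕ j) < n → csuc (Fin.combine i j) ≡ Fin.combine i (csuc j)
csuc-combine-< {m} {n} i j lt = Finₚ.toℕ-injective (trans (csuc-< (Fin.combine i j) bound) (trans (sym e) (sym (Finₚ.toℕ-combine i (csuc j)))))
  where
  e : n * toℕ i + toℕ (csuc j) ≡ suc (toℕ (Fin.combine i j))
  e = trans (cong (n * toℕ i +_) (csuc-< j lt)) (trans (+-suc (n * toℕ i) (toℕ j)) (cong suc (sym (Finₚ.toℕ-combine i j))))
  bound : suc (toℕ (Fin.combine i j)) < m * n
  bound = subst (_< m * n) (trans (Finₚ.toℕ-combine i (csuc j)) e) (Finₚ.toℕ<n (Fin.combine i (csuc j)))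

csuc-combine-last : ∀ {m n} (i : Fin m) (j : Fin (suc n)) → toℕ j ≡ n → csuc (Fin.combine i j) ≡ Fin.combine (csuc i) zero
csuc-combine-last {m} {n} i j last = Finₚ.toℕ-injective (go (suc (toℕ i) <? m))
  where
  e : suc (toℕ (Fin.combine i j)) ≡ suc n * suc (toℕ i)
  e = trans (cong suc (trans (Finₚ.toℕ-combine i j) (cong (suc n * toℕ i +_) last)))
        (trans (sym (+-suc (suc n * toℕ i) n)) (trans (+-comm (suc n * toℕ i) (suc n)) (sym (*-suc (suc n) (toℕ i)))))
  target : toℕ (Fin.combine {m} {suc n} (csuc i) zero) ≡ suc n * toℕ (csuc i)
  target = trans (Finₚ.toℕ-combine (csuc i) zero) (+-identityʳ _)
  go : Dec (suc (toℕ i) < m) → toℕ (csuc (Fin.combine i j)) ≡ toℕ (Fin.combine {m} {suc n} (csuc i) zero)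
  go (yes lt) = trans (csuc-< (Fin.combine i j) (subst (_< m * suc n) (trans target (trans (cong (suc n *_) (csuc-< i lt)) (sym e)))
                    (Finₚ.toℕ<n (Fin.combine {m} {suc n} (csuc i) zero))))
                  (trans e (sym (trans target (cong (suc n *_) (csuc-< i lt)))))
  go (no ≮) = trans (csuc-last (Fin.combine i j) (trans e (trans (cong (suc n *_) m≡) (*-comm (suc n) m))))
                (sym (trans target (trans (cong (suc n *_) (csuc-last i m≡)) (*-zeroʳ (suc n)))))
    where
    m≡ : suc (toℕ i) ≡ m
    m≡ = ≤-antisym (Finₚ.toℕ<n i) (≮⇒≥ ≮)

-- A root with 4 + b children (the hubs), each of which has 3 + b leaf children:
-- node i 0 is a hub, and node i (1 + j) are its leaves.
module Example (b : ℕ) where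

  A D n k : ℕ
  A = 3 + b
  D = 4 + b
  -- The root, and for each of the `D` hubs the hub itself with its `A` leaves, where `D` is
  -- `1 + A`. The next value makes `3 + k` compute to `D * A`, the number of leaves.
  n = suc (D * D)
  k = b + A * A

  data Code : Set where
    root : Code
    node : Fin D → Fin D → Code

  pattern hub i = node i zero
  pattern leaf i j = node i (suc j)

  abstract
    encode : Code → Fin n
    encode root = zero
    encode (node i j) = suc (Fin.combine i j)

    decode : Fin n → Code
    decode zero = root
    decode (suc x) = uncurry node (Fin.remQuot D x)

    decode-encode : ∀ x → decode (encode x) ≡ x
    decode-encode root = refl
    decode-encode (node i j) = cong (uncurry node) (Finₚ.remQuot-combine i j)

    encode-decode : ∀ v → encode (decode v) ≡ v
    encode-decode zero = refl
    encode-decode (suc x) = cong suc (Finₚ.combine-remQuot {D} D x)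

  encode-injective : ∀ {x y} → encode x ≡ encode y → x ≡ y
  encode-injective {x} {y} e = trans (sym (decode-encode x)) (trans (cong decode e) (decode-encode y))

  on-codes : {P : Fin n → Set} → (∀ x → P (encode x)) → ∀ v → P v
  on-codes {P} f v = subst P (encode-decode v) (f (decode v))

  parC : Code → Code
  parC root = root
  parC (hub i) = root
  parC (leaf i j) = hub i

  depthC : Code → ℕ
  depthC root = 0
  depthC (hub i) = 1
  depthC (leaf i j) = 2

  par : Fin n → Fin n
  par v = encode (parC (decode v))

  par-encode : ∀ x → par (encode x) ≡ encode (parC x)
  par-encode x = cong (encode ∘ parC) (decode-encode x)

  r : Fin n
  r = encode root

  TreeEdge : Fin n → Fin n → Set
  TreeEdge u v = (u ≢ r × par u ≡ v) ⊎ (v ≢ r × par v ≡ u)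

  TreeEdge? : ∀ u v → Dec (TreeEdge u v)
  TreeEdge? u v = (¬? (u Finₚ.≟ r) ×-dec (par u Finₚ.≟ v)) ⊎-dec (¬? (v Finₚ.≟ r) ×-dec (par v Finₚ.≟ u))

  TreeEdge-sym : ∀ {u v} → TreeEdge u v → TreeEdge v u
  TreeEdge-sym (inj₁ p) = inj₂ p
  TreeEdge-sym (inj₂ p) = inj₁ p

  depth : Fin n → ℕ
  depth v = depthC (decode v)

  depth-par : ∀ {v} → v ≢ r → depth v ≡ suc (depth (par v))
  depth-par {v} = on-codes {λ v → v ≢ r → depth v ≡ suc (depth (par v))} step-up v
    where
    codes : ∀ x → x ≢ root → depthC x ≡ suc (depthC (parC x))
    codes root ne = contradiction refl ne
    codes (hub i) _ = refl
    codes (leaf i j) _ = refl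
    step-up : ∀ x → encode x ≢ r → depth (encode x) ≡ suc (depth (par (encode x)))
    step-up x ne = trans (cong depthC (decode-encode x)) (trans (codes x (ne ∘ cong encode))
      (cong suc (trans (cong depthC (sym (decode-encode (parC x)))) (cong depth (sym (par-encode x))))))

  TreeEdge-irrefl : ∀ {v} → ¬ TreeEdge v v
  TreeEdge-irrefl (inj₁ (ne , e)) = contradiction (trans (sym (depth-par ne)) (cong depth (sym e))) 1+n≢n
  TreeEdge-irrefl (inj₂ (ne , e)) = contradiction (trans (sym (depth-par ne)) (cong depth (sym e))) 1+n≢n

  module G = FromRelation TreeEdge TreeEdge? (λ {u} {v} → TreeEdge-sym {u} {v}) TreeEdge-irrefl
  tree : Graph n
  tree = G.graph

  depth<n : ∀ v → depth v < n
  depth<n v = ≤-trans (s≤s (depthC≤2 (decode v))) (s≤s (s≤s (s≤s z≤n)))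
    where
    depthC≤2 : ∀ x → depthC x ≤ 2
    depthC≤2 root = z≤n
    depthC≤2 (hub i) = s≤s z≤n
    depthC≤2 (leaf i j) = ≤-refl

  rooting : Rooting tree r
  rooting = record
    { par = par
    ; depth = depth
    ; par-adj = λ ne → G.Adj⁺ (inj₁ (ne , refl))
    ; depth-par = depth-par
    ; edge = G.Adj⁻
    ; depth< = depth<n }

  data Joined : Code → Code → Set where
    root-hub : ∀ {i} → Joined root (hub i)
    hub-root : ∀ {i} → Joined (hub i) root
    hub-leaf : ∀ {i j} → Joined (hub i) (leaf i j)
    leaf-hub : ∀ {i j} → Joined (leaf i j) (hub i)

  node≢r : ∀ {i j} → encode (node i j) ≢ r
  node≢r {i} {j} e = absurd (encode-injective e)
    where
    absurd : node i j ≢ root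
    absurd ()

  joined⁺ : ∀ {x y} → Joined x y → Adj tree (encode x) (encode y)
  joined⁺ (root-hub {i}) = G.Adj⁺ (inj₂ (node≢r , par-encode (hub i)))
  joined⁺ (hub-root {i}) = G.Adj⁺ (inj₁ (node≢r , par-encode (hub i)))
  joined⁺ (hub-leaf {i} {j}) = G.Adj⁺ (inj₂ (node≢r , par-encode (leaf i j)))
  joined⁺ (leaf-hub {i} {j}) = G.Adj⁺ (inj₁ (node≢r , par-encode (leaf i j)))

  joined⁻ : ∀ {x y} → Adj tree (encode x) (encode y) → Joined x y
  joined⁻ {x} {y} a with G.Adj⁻ a
  ... | inj₁ (ne , e) with x | encode-injective (trans (sym (par-encode x)) e)
  ...   | root | _ = contradiction refl ne
  ...   | hub _ | refl = hub-root
  ...   | leaf _ _ | refl = leaf-hub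
  joined⁻ {x} {y} a | inj₂ (ne , e) with y | encode-injective (trans (sym (par-encode y)) e)
  ...   | root | _ = contradiction refl ne
  ...   | hub _ | refl = root-hub
  ...   | leaf _ _ | refl = hub-leaf

  joined-from : ∀ {x v} → Adj tree (encode x) v → Joined x (decode v)
  joined-from {x} {v} a = joined⁻ (subst (Adj tree (encode x)) (sym (encode-decode v)) a)

  -- The neighbours of a hub in cyclic order, starting with the root.
  around : Fin D → Fin D → Code
  around i zero = root
  around i (suc j) = leaf i j

  -- The last clause serves a leaf, whose only neighbour is fixed, and fills in the remaining pairs.
  rotC : Code → Code → Code
  rotC root (hub i) = hub (csuc i)
  rotC (hub i) root = around i (csuc zero)
  rotC (hub i) (leaf _ j) = around i (csuc (suc j))
  rotC _ y = y

  rot : Fin n → Fin n → Fin n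
  rot u v = encode (rotC (decode u) (decode v))

  rot-encode : ∀ x y → rot (encode x) (encode y) ≡ encode (rotC x y)
  rot-encode x y = cong₂ (λ a c → encode (rotC a c)) (decode-encode x) (decode-encode y)

  rotC-around : ∀ i j → rotC (hub i) (around i j) ≡ around i (csuc j)
  rotC-around i zero = refl
  rotC-around i (suc j) = refl

  joined-around : ∀ i j → Joined (hub i) (around i j)
  joined-around i zero = hub-root
  joined-around i (suc j) = hub-leaf

  around-index : ∀ {i y} → Joined (hub i) y → ∃ λ j → around i j ≡ y
  around-index hub-root = zero , refl
  around-index (hub-leaf {j = j}) = suc j , refl

  iter-encode : ∀ x y j → iter j (rot (encode x)) (encode y) ≡ encode (iter j (rotC x) y)
  iter-encode x y zero = refl
  iter-encode x y (suc j) = trans (cong (rot (encode x)) (iter-encode x y j)) (rot-encode x _)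

  iter-hub : ∀ i l j → iter l (rotC (hub i)) (around i j) ≡ around i (iter l csuc j)
  iter-hub i zero j = refl
  iter-hub i (suc l) j = trans (cong (rotC (hub i)) (iter-hub i l j)) (rotC-around i (iter l csuc j))

  iter-root : ∀ l i → iter l (rotC root) (hub i) ≡ hub (iter l csuc i)
  iter-root zero i = refl
  iter-root (suc l) i = cong (rotC root) (iter-root l i)

  isRotation : IsRotation tree rot
  isRotation = closed , transitive
    where
    closedC : ∀ {x y} → Joined x y → Joined x (rotC x y)
    closedC root-hub = root-hub
    closedC {hub i} hub-root = joined-around i _
    closedC {hub i} hub-leaf = joined-around i _
    closedC leaf-hub = leaf-hub
    closed : ∀ v u → Adj tree v u → Adj tree v (rot v u)
    closed v u a = subst (λ w → Adj tree w (rot v u)) (encode-decode v)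
      (joined⁺ (closedC (joined-from (subst (λ w → Adj tree w u) (sym (encode-decode v)) a))))
    hub-transitive : ∀ {i z} → Joined (hub i) z → ∀ j → ∃ λ l → iter (suc l) (rotC (hub i)) (around i j) ≡ z
    hub-transitive {i} q j with around-index q
    ... | j′ , e′ with csuc-reach j j′
    ...   | l , e = l , trans (iter-hub i (suc l) j) (trans (cong (around i) e) e′)
    transitiveC : ∀ {x y z} → Joined x y → Joined x z → ∃ λ l → iter (suc l) (rotC x) y ≡ z
    transitiveC (root-hub {i}) (root-hub {i′}) with csuc-reach i i′
    ... | l , e = l , trans (iter-root (suc l) i) (cong (λ x → hub x) e)
    transitiveC {hub i} hub-root q = hub-transitive q zero
    transitiveC {hub i} (hub-leaf {j = j}) q = hub-transitive q (suc j)
    transitiveC leaf-hub leaf-hub = 0 , refl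
    transitive : ∀ v u w → Adj tree v u → Adj tree v w → ∃ λ j → iter (suc j) (rot v) u ≡ w
    transitive v u w a c with transitiveC (joined-from (subst (λ x → Adj tree x u) (sym (encode-decode v)) a))
                                          (joined-from (subst (λ x → Adj tree x w) (sym (encode-decode v)) c))
    ... | j , e = j , trans (cong₂ (λ x y → iter (suc j) (rot x) y) (sym (encode-decode v)) (sym (encode-decode u)))
                        (trans (iter-encode (decode v) (decode u) (suc j)) (trans (cong encode e) (encode-decode w)))

  leafC : Fin D × Fin A → Code
  leafC (i , j) = leaf i j

  abstract
    coord : Fin (3 + k) → Fin D × Fin A
    coord = Fin.remQuot {D} A

    coord-combine : ∀ i j → coord (Fin.combine i j) ≡ (i , j)
    coord-combine = Finₚ.remQuot-combine

    combine-coord : ∀ x → uncurry Fin.combine (coord x) ≡ x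
    combine-coord = Finₚ.combine-remQuot {D} A

  c : Fin (3 + k) → Fin n
  c x = encode (leafC (coord x))

  c-combine : ∀ i j → c (Fin.combine i j) ≡ encode (leaf i j)
  c-combine i j = cong (encode ∘ leafC) (coord-combine i j)

  c-inj : Injective _≡_ _≡_ c
  c-inj {x} {y} e = trans (sym (combine-coord x)) (trans (cong (uncurry Fin.combine) (leafC-inj (encode-injective e))) (combine-coord y))
    where
    leafC-inj : ∀ {p q} → leafC p ≡ leafC q → p ≡ q
    leafC-inj refl = refl

  leaf-isLeaf : ∀ i j → IsLeaf tree (encode (leaf i j))
  leaf-isLeaf i j = ≤-antisym
      (deg≤cover tree (encode (hub i) ∷ []) (λ {v} a → here (trans (sym (encode-decode v)) (cong encode (only (joined-from a))))))
      (unique-nbrs≤deg tree {xs = encode (hub i) ∷ []} ([] ∷ []) λ { (here refl) → joined⁺ leaf-hub })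
    where
    only : ∀ {y} → Joined (leaf i j) y → y ≡ hub i
    only leaf-hub = refl

  c-leaf : ∀ x → IsLeaf tree (c x)
  c-leaf x = leaf-isLeaf _ _

  root-inner : ¬ IsLeaf tree (encode root)
  root-inner = two-nbrs⇒nonleaf tree (joined⁺ (root-hub {zero})) (joined⁺ (root-hub {suc zero})) (λ e → hub-inj (encode-injective e))
    where
    hub-inj : hub zero ≢ hub (suc zero)
    hub-inj ()

  hub-inner : ∀ i → ¬ IsLeaf tree (encode (hub i))
  hub-inner i = two-nbrs⇒nonleaf tree (joined⁺ (hub-root {i})) (joined⁺ (hub-leaf {i} {zero})) (λ e → distinct (encode-injective e))
    where
    distinct : root ≢ leaf i zero
    distinct ()

  c-all : ∀ v → IsLeaf tree v → ∃ λ x → c x ≡ v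
  c-all = on-codes λ where
    root l → contradiction l root-inner
    (hub i) l → contradiction l (hub-inner i)
    (leaf i j) _ → Fin.combine i j , c-combine i j

  Dart : Set
  Dart = Code × Code

  dart : Dart → Fin n × Fin n
  dart (x , y) = encode x , encode y

  turn : Dart → Dart
  turn (x , y) = y , rotC y x

  iter-turn : ∀ d m → iter m (faceStep rot) (dart d) ≡ dart (iter m turn d)
  iter-turn d zero = refl
  iter-turn d (suc m) = trans (cong (faceStep rot) (iter-turn d m)) (cong (encode (proj₂ (iter m turn d)) ,_) (rot-encode (proj₂ (iter m turn d)) (proj₁ (iter m turn d))))

  Turns : Code → Code → Code → Code → Set
  Turns x p y q = ∃ λ j → iter (suc j) turn (x , p) ≡ (y , q) ×
                    (∀ m → 1 ≤ m → m ≤ j → ¬ IsLeaf tree (encode (proj₁ (iter m turn (x , p)))))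

  next-index : Fin D × Fin A → Fin D × Fin A
  next-index (i , j) with suc (toℕ j) <? A
  ... | yes _ = i , csuc j
  ... | no _ = csuc i , zero

  csuc-next : ∀ i j → csuc (Fin.combine i j) ≡ uncurry Fin.combine (next-index (i , j))
  csuc-next i j with suc (toℕ j) <? A
  ... | yes lt = csuc-combine-< i j lt
  ... | no ≮ = csuc-combine-last i j (≤-antisym (Finₚ.toℕ≤pred[n] j) (≤-pred (≮⇒≥ ≮)))

  -- Between leaves of one hub the walk takes two steps, through the hub; after the last leaf it
  -- takes four, through the hub, the root and the next hub. The witness is one less than the number
  -- of steps.
  turns : ∀ i j → let (i′ , j′) = next-index (i , j) in Turns (leaf i j) (hub i) (leaf i′ j′) (hub i′)
  turns i j with suc (toℕ j) <? A
  ... | yes lt = 1 , cong (λ y → y , rotC y (hub i)) step₁ , λ { (suc zero) _ _ → hub-inner i ; (suc (suc _)) _ (s≤s ()) }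
    where
    step₁ : around i (csuc (suc j)) ≡ leaf i (csuc j)
    step₁ = cong (around i) (Finₚ.toℕ-injective {i = csuc (suc j)} {suc (csuc j)}
              (trans (csuc-< (suc j) (s≤s lt)) (cong suc (sym (csuc-< j lt)))))
  ... | no ≮ = 3 , whole , inner
    where
    last : csuc (suc j) ≡ zero
    last = Finₚ.toℕ-injective (csuc-last (suc j) (cong suc (≤-antisym (Finₚ.toℕ<n j) (≮⇒≥ ≮))))
    after₂ : iter 2 turn (leaf i j , hub i) ≡ (root , hub (csuc i))
    after₂ = cong (λ x → around i x , rotC (around i x) (hub i)) last
    whole : iter 4 turn (leaf i j , hub i) ≡ (leaf (csuc i) zero , hub (csuc i))
    whole = cong (turn ∘ turn) after₂
    inner : ∀ m → 1 ≤ m → m ≤ 3 → ¬ IsLeaf tree (encode (proj₁ (iter m turn (leaf i j , hub i))))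
    inner 1 _ _ = hub-inner i
    inner 2 _ _ = subst (λ d → ¬ IsLeaf tree (encode (proj₁ d))) (sym after₂) root-inner
    inner 3 _ _ = subst (λ d → ¬ IsLeaf tree (encode (proj₁ d))) (sym (cong turn after₂)) (hub-inner (csuc i))
    inner (suc (suc (suc (suc _)))) _ (s≤s (s≤s (s≤s ())))

  order : LeafOrder tree rot k c
  order x p q a a′ = l , trans (cong (iter (suc l) (faceStep rot)) start) (trans (iter-turn _ (suc l)) (trans (cong dart e) (sym end))) ,
        λ m 1≤m m≤l → subst (λ d → ¬ IsLeaf tree (proj₁ d))
          (sym (trans (cong (iter m (faceStep rot)) start) (iter-turn (leaf i j , hub i) m))) (inner m 1≤m m≤l)
    where
    i = proj₁ (coord x)
    j = proj₂ (coord x)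
    i′ = proj₁ (next-index (i , j))
    j′ = proj₂ (next-index (i , j))
    t = turns i j
    l = proj₁ t
    e = proj₁ (proj₂ t)
    inner = proj₂ (proj₂ t)
    stem-end : ∀ i j {p} → Adj tree (encode (leaf i j)) p → p ≡ encode (hub i)
    stem-end i j a = leaf-nbr-unique tree (leaf-isLeaf i j) a (joined⁺ leaf-hub)
    start : (encode (leaf i j) , p) ≡ dart (leaf i j , hub i)
    start = cong (encode (leaf i j) ,_) (stem-end i j a)
    x≡ : x ≡ Fin.combine i j
    x≡ = sym (combine-coord x)
    cx : c (csuc x) ≡ encode (leaf i′ j′)
    cx = trans (cong c (trans (cong csuc x≡) (csuc-next i j))) (c-combine i′ j′)
    end : (c (csuc x) , q) ≡ dart (leaf i′ j′ , hub i′)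
    end = cong₂ _,_ cx (stem-end i′ j′ (subst (λ w → Adj tree w q) cx a′))

  HalinEdge : Fin n → Fin n → Set
  HalinEdge u v = Adj tree u v ⊎ CEdge k c u v

  CEdge-sym : ∀ {u v} → CEdge k c u v → CEdge k c v u
  CEdge-sym (i , inj₁ p) = i , inj₂ p
  CEdge-sym (i , inj₂ p) = i , inj₁ p

  HalinEdge? : ∀ u v → Dec (HalinEdge u v)
  HalinEdge? u v = T? (adj tree u v) ⊎-dec Finₚ.any? λ i →
    ((c i Finₚ.≟ u) ×-dec (c (csuc i) Finₚ.≟ v)) ⊎-dec ((c i Finₚ.≟ v) ×-dec (c (csuc i) Finₚ.≟ u))

  HalinEdge-sym : ∀ {u v} → HalinEdge u v → HalinEdge v u
  HalinEdge-sym (inj₁ a) = inj₁ (Adj-sym tree a)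
  HalinEdge-sym (inj₂ e) = inj₂ (CEdge-sym e)

  HalinEdge-irrefl : ∀ {v} → ¬ HalinEdge v v
  HalinEdge-irrefl (inj₁ a) = Adj-irrefl tree a
  HalinEdge-irrefl (inj₂ (i , inj₁ (e , e′))) = csuc≢ i (c-inj (trans e′ (sym e)))
  HalinEdge-irrefl (inj₂ (i , inj₂ (e , e′))) = csuc≢ i (c-inj (trans e′ (sym e)))

  module HG = FromRelation HalinEdge HalinEdge? (λ {u} {v} → HalinEdge-sym {u} {v}) HalinEdge-irrefl
  halin : Graph n
  halin = HG.graph

  halin-edges : ∀ u v → (Adj halin u v → Adj tree u v ⊎ CEdge k c u v) × (Adj tree u v ⊎ CEdge k c u v → Adj halin u v)
  halin-edges u v = HG.Adj⁻ , HG.Adj⁺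

  open HalinEdges halin tree k c c-inj c-leaf halin-edges

  hubs : List (Fin n)
  hubs = map (λ i → encode (hub i)) (allFin D)

  hubs-unique : Unique hubs
  hubs-unique = map-unique _ (λ _ _ e → hub-inj (encode-injective e)) (Uniqueₚ.allFin⁺ D)
    where
    hub-inj : ∀ {i i′} → hub i ≡ hub i′ → i ≡ i′
    hub-inj refl = refl

  length-image : {B : Set} (f : Fin D → B) → length (map f (allFin D)) ≡ D
  length-image f = trans (length-map f (allFin D)) (length-tabulate id)

  hubs-adjacent : ∀ {x} → x ∈ hubs → Adj tree r x
  hubs-adjacent x∈ with ∈-map⁻ (λ i → encode (hub i)) x∈
  ... | i , _ , refl = joined⁺ root-hub

  deg-root≥ : ∀ {G : Graph n} → (∀ {x} → Adj tree r x → Adj G r x) → D ≤ deg G r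
  deg-root≥ {G} sub = ≤-trans (≤-reflexive (sym (length-image _))) (unique-nbrs≤deg G hubs-unique (sub ∘ hubs-adjacent))

  deg-halin : ∀ v → deg halin v ≤ D
  deg-halin = on-codes bound
    where
    at-root : ∀ {v} → Joined root (decode v) → v ∈ hubs
    at-root {v} p with decode v | encode-decode v | p
    ... | hub i | refl | root-hub = ∈-map⁺ (λ i → encode (hub i)) (∈-allFin i)
    at-hub : ∀ {i v} → Joined (hub i) (decode v) → v ∈ map (encode ∘ around i) (allFin D)
    at-hub {i} {v} p with around-index p
    ... | j , e = subst (_∈ map (encode ∘ around i) (allFin D)) (trans (cong encode e) (encode-decode v)) (∈-map⁺ (encode ∘ around i) (∈-allFin j))
    bound : ∀ x → deg halin (encode x) ≤ D
    bound root = ≤-trans (deg≤cover halin hubs (at-root ∘ joined-from ∘ at-inner root-inner)) (≤-reflexive (length-image _))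
    bound (hub i) = ≤-trans (deg≤cover halin (map (encode ∘ around i) (allFin D)) (at-hub ∘ joined-from ∘ at-inner (hub-inner i))) (≤-reflexive (length-image _))
    bound (leaf i j) = ≤-trans (subst (λ v → deg halin v ≤ 3) (c-combine i j) (deg-leaf≤3 (Fin.combine i j))) (m≤m+n 3 (suc b))

  maxDegree : MaxDegree halin D
  maxDegree = deg-halin , r , ≤-antisym (deg-halin r) (deg-root≥ {halin} tree⇒H)

  isGenHalin : IsGenHalin halin
  isGenHalin = tree , rooting⇒tree rooting , (r , ≤-trans (m≤m+n 3 (suc b)) (deg-root≥ {tree} id)) ,
    rot , isRotation , k , c , c-inj , c-leaf , c-all , order , halin-edges

-- The lower bound.

module Summation where
  open import Algebra.Properties.CommutativeMonoid.Sum +-0-commutativeMonoid public using (sum; sum-remove; ∑-distrib-+; ∑-comm)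

  indicator : {P : Set} → Dec P → ℕ
  indicator (yes _) = 1
  indicator (no _) = 0

  indicator≤1 : {P : Set} (d : Dec P) → indicator d ≤ 1
  indicator≤1 (yes _) = ≤-refl
  indicator≤1 (no _) = z≤n

  sum-mono : ∀ {m} {f g : Fin m → ℕ} → (∀ i → f i ≤ g i) → sum f ≤ sum g
  sum-mono {zero} le = z≤n
  sum-mono {suc m} le = +-mono-≤ (le zero) (sum-mono (le ∘ suc))

  sum-const : ∀ m x → sum {m} (λ _ → x) ≡ m * x
  sum-const zero x = refl
  sum-const (suc m) x = cong (x +_) (sum-const m x)

  sum-hollow : ∀ {m} (g : Fin (suc m) → ℕ) i → g i ≡ 0 → (∀ j → g j ≤ 1) → sum g ≤ m
  sum-hollow {m} g i gi≡0 g≤1 = begin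
    sum g ≡⟨ sum-remove {i = i} g ⟩
    g i + sum (g ∘ Fin.punchIn i) ≤⟨ +-mono-≤ (≤-reflexive gi≡0) (sum-mono (g≤1 ∘ Fin.punchIn i)) ⟩
    sum {m} (λ _ → 1) ≡⟨ trans (sum-const m 1) (*-identityʳ m) ⟩
    m ∎
    where open ≤-Reasoning

  count-complement : {A : Set} {P : A → Set} (P? : ∀ a → Dec (P a)) (m : ℕ) (f : Fin m → A) →
                     length (filter (λ a → ¬? (P? a)) (List.tabulate f)) + sum (λ i → indicator (P? (f i))) ≡ m
  count-complement P? zero f = refl
  count-complement P? (suc m) f with P? (f zero) | count-complement P? m (f ∘ suc)
  ... | yes _ | e = trans (+-suc _ _) (cong suc e)
  ... | no _ | e = cong suc e

-- If hub i has a leaf edge coloured like the root edge of hub i′, then hub i′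
-- has none coloured like the root edge of hub i; so on average at most half of
-- the other root colours are reused at a hub.
module LowerBound (b : ℕ) {q : ℕ} (choosable : StarChoosable (Example.halin b) q) where
  open Example b
  open HalinEdges halin tree k c c-inj c-leaf halin-edges using (tree⇒H)
  open Summation

  private
    -- With all lists equal to 0, ..., q - 1, this is an ordinary star edge colouring with `q`
    -- colours.
    given = choosable (λ _ _ → List.upTo q) (λ _ _ _ → refl) (λ _ _ _ → Uniqueₚ.upTo⁺ q , ≤-reflexive (sym (length-applyUpTo id q)))

  φ : Fin n → Fin n → ℕ
  φ = proj₁ given

  φ-sym : ∀ u v → Adj halin u v → φ u v ≡ φ v u
  φ-sym = proj₁ (proj₂ given)

  φ∈ : ∀ u v → Adj halin u v → φ u v ∈ List.upTo q
  φ∈ = proj₁ (proj₂ (proj₂ given))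

  proper : Proper halin φ
  proper = proj₁ (proj₂ (proj₂ (proj₂ given)))

  no4 : NoBichromatic4 halin φ
  no4 = proj₂ (proj₂ (proj₂ (proj₂ given)))

  joined : ∀ {x y} → Joined x y → Adj halin (encode x) (encode y)
  joined p = tree⇒H (joined⁺ p)

  encode≢ : ∀ {x y} → x ≢ y → encode x ≢ encode y
  encode≢ ne e = ne (encode-injective e)

  ρ : Fin D → ℕ
  ρ i = φ (encode root) (encode (hub i))

  μ : Fin D → Fin A → ℕ
  μ i j = φ (encode (hub i)) (encode (leaf i j))

  ρ-injective : ∀ {i i′} → ρ i ≡ ρ i′ → i ≡ i′
  ρ-injective {i} {i′} e with i Finₚ.≟ i′
  ... | yes p = p
  ... | no ne = contradiction e (proper _ _ _ (joined root-hub) (joined root-hub) (encode≢ λ { refl → ne refl }))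

  μ-injective : ∀ {i j j′} → μ i j ≡ μ i j′ → j ≡ j′
  μ-injective {i} {j} {j′} e with j Finₚ.≟ j′
  ... | yes p = p
  ... | no ne = contradiction e (proper _ _ _ (joined hub-leaf) (joined hub-leaf) (encode≢ λ { refl → ne refl }))

  ρ≢μ : ∀ {i j} → ρ i ≢ μ i j
  ρ≢μ {i} {j} e = proper _ _ _ (joined hub-root) (joined hub-leaf) (encode≢ λ ()) (trans (sym (φ-sym _ _ (joined root-hub))) e)

  -- Otherwise the path from a leaf through hub `i`, the root and hub `i′` to a leaf would be
  -- bichromatic; the hubs differ because a leaf edge differs from the root edge of its own hub.
  asymmetric : ∀ {i i′ j j′} → ρ i′ ≡ μ i j → ρ i ≢ μ i′ j′
  asymmetric {i} {i′} {j} {j′} e e′ = no4 (encode (leaf i j)) (encode (hub i)) (encode root) (encode (hub i′)) (encode (leaf i′ j′))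
    (joined leaf-hub) (joined hub-root) (joined root-hub) (joined hub-leaf)
    (encode≢ λ ()) (encode≢ λ ()) (encode≢ λ { refl → ρ≢μ e }) (encode≢ λ ()) (encode≢ λ ())
    (trans (φ-sym _ _ (joined leaf-hub)) (sym e) , trans (φ-sym _ _ (joined hub-root)) e′)

  leaf-colours : Fin D → List ℕ
  leaf-colours i = map (μ i) (allFin A)

  reused? : ∀ i i′ → Dec (ρ i′ ∈ leaf-colours i)
  reused? i i′ = ρ i′ ∈? leaf-colours i

  arc : Fin D → Fin D → ℕ
  arc i i′ = indicator (reused? i i′)

  arc-loop : ∀ i → arc i i ≡ 0
  arc-loop i with reused? i i
  ... | no _ = refl
  ... | yes p with ∈-map⁻ (μ i) p
  ...   | j , _ , e = contradiction e ρ≢μ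

  arc-pair : ∀ i i′ → arc i i′ + arc i′ i ≤ 1
  arc-pair i i′ with reused? i i′ | reused? i′ i
  ... | no _ | d = indicator≤1 d
  ... | yes _ | no _ = ≤-refl
  ... | yes p | yes p′ with ∈-map⁻ (μ i) p | ∈-map⁻ (μ i′) p′
  ...   | _ , _ , e | _ , _ , e′ = contradiction e′ (asymmetric e)

  -- The `A` leaf edges at hub `i` and the `D` root edges carry distinct colours, except for the
  -- root colours reused at the hub.
  row : ∀ i → A + D ≤ q + sum (arc i)
  row i = begin
    A + D ≡⟨ cong (A +_) (sym (count-complement (reused? i) D id)) ⟩
    A + (length unused + sum (arc i)) ≡⟨ sym (+-assoc A (length unused) (sum (arc i))) ⟩
    A + length unused + sum (arc i) ≤⟨ +-monoˡ-≤ (sum (arc i)) colours≤q ⟩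
    q + sum (arc i) ∎
    where
    open ≤-Reasoning
    unused : List (Fin D)
    unused = filter (λ i′ → ¬? (reused? i i′)) (allFin D)
    colours : List ℕ
    colours = leaf-colours i ++ map ρ unused
    colours-unique : Unique colours
    colours-unique = Uniqueₚ.++⁺ (map-unique (μ i) (λ _ _ → μ-injective) (Uniqueₚ.allFin⁺ A))
      (map-unique ρ (λ _ _ → ρ-injective) (Uniqueₚ.filter⁺ (λ i′ → ¬? (reused? i i′)) (Uniqueₚ.allFin⁺ D)))
      λ (p , p′) → case ∈-map⁻ ρ p′ of λ where
        (i′ , i′∈ , refl) → proj₂ (∈-filter⁻ (λ i′ → ¬? (reused? i i′)) {xs = allFin D} i′∈) p
    available : ∀ {x} → x ∈ colours → x ∈ List.upTo q
    available x∈ with ∈-++⁻ (leaf-colours i) x∈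
    ... | inj₁ p with ∈-map⁻ (μ i) p
    ...   | _ , _ , refl = φ∈ _ _ (joined hub-leaf)
    available x∈ | inj₂ p with ∈-map⁻ ρ p
    ...   | _ , _ , refl = φ∈ _ _ (joined root-hub)
    colours≤q : A + length unused ≤ q
    colours≤q = begin
      A + length unused ≡⟨ sym (cong₂ _+_ (trans (length-map (μ i) (allFin A)) (length-tabulate {n = A} id)) (length-map ρ unused)) ⟩
      length (leaf-colours i) + length (map ρ unused) ≡⟨ sym (length-++ (leaf-colours i)) ⟩
      length colours ≤⟨ unique-⊆⇒length≤ colours-unique available ⟩
      length (List.upTo q) ≡⟨ length-applyUpTo id q ⟩
      q ∎

  arcs : ℕ
  arcs = sum (λ i → sum (arc i))

  -- Adding to each arc its reversal, a hub shares at most one with each of the `A` other hubs and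
  -- none with itself.
  arcs-twice : arcs + arcs ≤ D * A
  arcs-twice = begin
    arcs + arcs ≡⟨ cong (arcs +_) (∑-comm arc) ⟩
    arcs + sum (λ i → sum (λ i′ → arc i′ i)) ≡⟨ sym (∑-distrib-+ (λ i → sum (arc i)) (λ i → sum (λ i′ → arc i′ i))) ⟩
    sum (λ i → sum (arc i) + sum (λ i′ → arc i′ i)) ≤⟨ sum-mono (λ i → ≤-trans (≤-reflexive (sym (∑-distrib-+ (arc i) (λ i′ → arc i′ i))))
        (sum-hollow (λ i′ → arc i i′ + arc i′ i) i (cong₂ _+_ (arc-loop i) (arc-loop i)) (arc-pair i))) ⟩
    sum {D} (λ _ → A) ≡⟨ sum-const D A ⟩
    D * A ∎
    where open ≤-Reasoning

  rows : D * (A + D) ≤ D * q + arcs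
  rows = begin
    D * (A + D) ≡⟨ sym (sum-const D (A + D)) ⟩
    sum {D} (λ _ → A + D) ≤⟨ sum-mono row ⟩
    sum (λ i → q + sum (arc i)) ≡⟨ ∑-distrib-+ (λ _ → q) (λ i → sum (arc i)) ⟩
    sum {D} (λ _ → q) + arcs ≡⟨ cong (_+ arcs) (sum-const D q) ⟩
    D * q + arcs ∎
    where open ≤-Reasoning

  -- Averaging over the hubs gives `2q ≥ A + 2D = 3D ∸ 1`, and rounding does the rest. Adding `A` to
  -- both sides avoids subtraction.
  bound : (3 * D) / 2 ≤ q
  bound = ≤-pred (m<n*o⇒m/o<n (s≤s (+-cancelˡ-≤ A _ _ (begin
      A + 3 * D ≡⟨ solve 1 (λ a → a :+ con 3 :* (con 1 :+ a) := con 1 :+ ((a :+ (con 1 :+ a)) :+ (a :+ (con 1 :+ a)))) refl A ⟩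
      1 + ((A + D) + (A + D)) ≤⟨ s≤s averaged ⟩
      1 + (q + q + A) ≡⟨ solve 2 (λ a p → con 1 :+ (p :+ p :+ a) := a :+ (con 1 :+ p :* con 2)) refl A q ⟩
      A + (1 + q * 2) ∎))))
    where
    open ≤-Reasoning
    open +-*-Solver
    averaged : (A + D) + (A + D) ≤ q + q + A
    averaged = *-cancelˡ-≤ D (begin
      D * ((A + D) + (A + D)) ≡⟨ *-distribˡ-+ D (A + D) (A + D) ⟩
      D * (A + D) + D * (A + D) ≤⟨ +-mono-≤ rows rows ⟩
      (D * q + arcs) + (D * q + arcs) ≡⟨ solve 2 (λ x y → (x :+ y) :+ (x :+ y) := (x :+ x) :+ (y :+ y)) refl (D * q) arcs ⟩
      (D * q + D * q) + (arcs + arcs) ≤⟨ +-monoʳ-≤ (D * q + D * q) arcs-twice ⟩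
      (D * q + D * q) + D * A ≡⟨ solve 3 (λ d p a → (d :* p :+ d :* p) :+ d :* a := d :* (p :+ p :+ a)) refl D q A ⟩
      D * (q + q + A) ∎)

tight-example : ∀ b → 13 ≤ 4 + b → let D = 4 + b in
                Σ ℕ λ n → Σ (Graph n) λ H → IsGenHalin H × MaxDegree H D × IsListStarChromaticIndex H ((3 * D) / 2)
tight-example b 13≤D = n , halin , isGenHalin , maxDegree , halin-choosable halin isGenHalin maxDegree 13≤D , λ _ → LowerBound.bound b
  where open Example b

theorem9 : ((n : ℕ) (H : Graph n) (D : ℕ) → IsGenHalin H → MaxDegree H D → 13 ≤ D →
    ∃ λ m → IsListStarChromaticIndex H m × m ≤ (3 * D) / 2) ×
    ((D : ℕ) → 13 ≤ D →
    Σ ℕ λ n → Σ (Graph n) λ H →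
    IsGenHalin H × MaxDegree H D × IsListStarChromaticIndex H ((3 * D) / 2))
theorem9 = (λ n H D halin Δ 13≤D → star-index-exists H (halin-choosable H halin Δ 13≤D)) ,
  λ D 13≤D → let D≡ = m+[n∸m]≡n (≤-trans (m≤m+n 4 9) 13≤D) in
    subst (λ D → Σ ℕ λ n → Σ (Graph n) λ H → IsGenHalin H × MaxDegree H D × IsListStarChromaticIndex H ((3 * D) / 2)) D≡
      (tight-example (D ∸ 4) (≤-trans 13≤D (≤-reflexive (sym D≡))))
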